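{- For every integer $n\ge0$, $$c\phi_9(9n+3)\equiv c\phi_9(9n+6)\equiv0\pmod 9,\qquad c\phi_9(3n+1)\equiv0\pmod{81},\qquad c\phi_9(3n+2)\equiv0\pmod{729}.$$
   Context: A $k$-colored generalized Frobenius symbol is a two-row array with $d\ge 0$ columns whose entries are colored nonnegative integers $\ell_c$ ($\ell\ge 0$, color $c\in\{1,\dots,k\}$), each row strictly decreasing with respect to the total order $0_1\prec 0_2\prec\cdots\prec 0_k\prec 1_1\prec\cdots\prec 1_k\prec 2_1\prec\cdots$. It is a $k$-colored generalized Frobenius partition of $n=d+\sum(\text{integer values of all entries})$, and $c\phi_k(n)$ is the number of such partitions of $n$. -}

module Defs where

open import Data.Nat using (ℕ; _+_; _<_)
open import Data.Fin using (Fin; toℕ)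
open import Data.Product using (_×_; _,_; proj₁; Σ)
open import Data.Sum using (_⊎_)
open import Data.List using (List; length; map)
open import Data.Nat.ListAction using (sum)
open import Data.List.Relation.Unary.Linked using (Linked)
open import Relation.Binary.PropositionalEquality using (_≡_)
open import Function.Bundles using (_↔_)

-- A colored nonnegative integer ℓ_c : value ℓ ≥ 0 and color c ∈ {1,…,k}
-- (colors represented by Fin k, color c ↦ c-1).
Colored : ℕ → Set
Colored k = ℕ × Fin k

value : ∀ {k} → Colored k → ℕ
value = proj₁

_≺_ : ∀ {k} → Colored k → Colored k → Set
(a , c) ≺ (b , c') = (a < b) ⊎ ((a ≡ b) × (toℕ c < toℕ c'))

_≻_ : ∀ {k} → Colored k → Colored k → Set
x ≻ y = y ≺ x

StrictlyDecreasing : ∀ {k} → List (Colored k) → Set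
StrictlyDecreasing = Linked _≻_

-- A k-colored generalized Frobenius partition of n: a two-row array with
-- d ≥ 0 columns (d = common length of the rows), each row strictly
-- decreasing, with n = d + sum of the integer values of all entries.
-- Proof fields are irrelevant, so two symbols are equal iff their rows are.
record CFrob (k n : ℕ) : Set where
  constructor frob
  field
    top    : List (Colored k)
    bottom : List (Colored k)
    .top-dec    : StrictlyDecreasing top
    .bottom-dec : StrictlyDecreasing bottom
    .columns    : length top ≡ length bottom
    .weight     : length top + sum (map value top) + sum (map value bottom) ≡ n

cφ≡ : ℕ → ℕ → ℕ → Set
cφ≡ k n m = Fin m ↔ CFrob k n

{-# OPTIONS --safe #-}
module Submission where

-- Write q for the size variable and let F(z) = ∏_{n ≥ 0} (1 + z qⁿ⁺¹)(1 + z⁻¹ qⁿ).  Sorting the entries of a symbol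
-- by color shows that ∑ cφ₉(n) qⁿ = Φ is the constant term in z of F(z)⁹.  Shifting Maya diagrams gives
-- F(z) = G ∑ z^m q^(m(m+1)/2) with G independent of z, so Φ = Θ G⁹, where Θ is the theta series of the lattice A₈.
-- Let a, b, c be the cubic theta functions and A = a(q³), C = c(q³), so that a = A + 2 C and b = A - C.
-- Arranging ℤ⁹ in a 3 × 3 matrix and splitting each row as t (1,1,1) + y gives Θ = a³ A + 2 c³ (a + C).  The same
-- sum twisted by ω^(r₂ + 2 r₃), with rᵢ the row sums, equals A (a³ - c³) when split by rows and A b³ when split by
-- columns, hence a³ = b³ + c³.  The factorisation ∏ (1 + ωⁱ u) = 1 + u³ gives b G³ = G(q³).
-- Multiplying Φ by (A³ - C³)³, a power series in q³ with constant term 1, therefore turns it into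
-- G(q³)³ times a form of degree 10 in A and C.  Since A is a series in q³ and C is 3 q times such a series, the
-- exponents modulo 3 separate the monomials of this form, and its coefficients have the required divisibility.
-- Modulo 9 what remains is Φ ≡ A G(q³)³, whose coefficient at q³ⁿ is that of a G³ at qⁿ.

-- The factor (A³ - C³)³ has two sources. Cubing b G³ = G(q³) shows that Φ = Θ G⁹ has b³ in the
-- denominator, and b = A - C. Multiplying by Q = A² + A C + C² completes b to A³ - C³, which
-- involves only exponents divisible by three. Hence Z³ Φ = Θ Q³ G(q³)³ with Z = b Q, where Θ has
-- degree four and Q³ degree six. The cube of c turns into a form as well: with a = b + 3 C, the
-- relation a³ = b³ + c³ gives c³ = 9 C Q. The same device with Z in place of Z³ treats a G³. Modulo
-- 9, a Q is A³ + 2 C³, so a G³ has no exponents prime to three; this excludes the residues 3 and 6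
-- modulo 9 from A G(q³)³. No limits occur. An infinite sum is taken over an index set in which
-- finite lists cover all small weights, identities between sums come from weight-preserving
-- bijections, infinite products are identified through functional equations, and a factor is
-- cancelled because its constant term is 1. The twists need a cube root of unity ω, so everything
-- is counted in ℤ[ω].

open import Algebra.Bundles using (CommutativeRing)
open import Level using (0ℓ)

-- Formal power series over a commutative ring

module PowerSeries (R : CommutativeRing 0ℓ 0ℓ) where

  open import Data.Nat as ℕ using (ℕ; zero; suc; z≤n; s≤s)
  import Data.Nat.Properties as ℕₚ
  open import Data.List using (List; []; _∷_; _++_; map; cartesianProduct)
  open import Data.List.Membership.Propositional using (_∈_)
  open import Data.List.Relation.Unary.Any using (here; there)
  open import Data.List.Relation.Unary.All as All using (All; []; _∷_)
  open import Data.List.Relation.Unary.AllPairs using ([]; _∷_)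
  open import Data.List.Relation.Unary.Unique.Propositional using (Unique)
  open import Data.Product using (_×_; _,_)
  open import Data.Sum using (_⊎_; inj₁; inj₂)
  open import Function using (_∘_)
  open import Relation.Nullary using (Dec; yes; no; ¬_; contradiction)
  open import Relation.Binary using (DecidableEquality)
  open import Relation.Binary.PropositionalEquality as ≡ using (_≡_; _≢_)
  open CommutativeRing R public hiding (zero)
  open import Relation.Binary.Reasoning.Setoid setoid
  open import Algebra.Solver.Ring.NaturalCoefficients.Default commutativeSemiring using (solve; _:=_; _:+_; _:*_)

  ≡⇒≈ : ∀ {x y} → x ≡ y → x ≈ y
  ≡⇒≈ ≡.refl = refl

  ind : ∀ {P : Set} → Dec P → Carrier
  ind (yes _) = 1#
  ind (no _)  = 0#

  ind-yes : ∀ {P : Set} (d : Dec P) → P → ind d ≈ 1#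
  ind-yes (yes _) p = refl
  ind-yes (no ¬p) p = contradiction p ¬p

  ind-no : ∀ {P : Set} (d : Dec P) → ¬ P → ind d ≈ 0#
  ind-no (yes p) ¬p = contradiction p ¬p
  ind-no (no _)  ¬p = refl

  ind-cong : ∀ {P Q : Set} (d : Dec P) (e : Dec Q) → (P → Q) → (Q → P) → ind d ≈ ind e
  ind-cong (yes p) e f g = sym (ind-yes e (f p))
  ind-cong (no ¬p) e f g = sym (ind-no e (¬p ∘ g))

  ∑ : {I : Set} → List I → (I → Carrier) → Carrier
  ∑ []       f = 0#
  ∑ (i ∷ is) f = f i + ∑ is f

  module _ {I : Set} where

    ∑-cong : ∀ (L : List I) {f g : I → Carrier} → (∀ i → f i ≈ g i) → ∑ L f ≈ ∑ L g
    ∑-cong []      e = refl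
    ∑-cong (i ∷ L) e = +-cong (e i) (∑-cong L e)

    ∑-zero : ∀ (L : List I) {f : I → Carrier} → (∀ i → f i ≈ 0#) → ∑ L f ≈ 0#
    ∑-zero []      e = refl
    ∑-zero (i ∷ L) e = trans (+-cong (e i) (∑-zero L e)) (+-identityˡ 0#)

    ∑-+ : ∀ (L : List I) (f g : I → Carrier) → ∑ L (λ i → f i + g i) ≈ ∑ L f + ∑ L g
    ∑-+ []      f g = sym (+-identityˡ 0#)
    ∑-+ (i ∷ L) f g = trans (+-congˡ (∑-+ L f g))
      (solve 4 (λ a b c d → (a :+ b) :+ (c :+ d) := (a :+ c) :+ (b :+ d)) refl _ _ _ _)

    ∑-*ˡ : ∀ (L : List I) x (f : I → Carrier) → ∑ L (λ i → x * f i) ≈ x * ∑ L f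
    ∑-*ˡ []      x f = sym (zeroʳ x)
    ∑-*ˡ (i ∷ L) x f = trans (+-congˡ (∑-*ˡ L x f)) (sym (distribˡ x _ _))

    ∑-*ʳ : ∀ (L : List I) x (f : I → Carrier) → ∑ L (λ i → f i * x) ≈ ∑ L f * x
    ∑-*ʳ []      x f = sym (zeroˡ x)
    ∑-*ʳ (i ∷ L) x f = trans (+-congˡ (∑-*ʳ L x f)) (sym (distribʳ x _ _))

    ∑-++ : ∀ (L M : List I) (f : I → Carrier) → ∑ (L ++ M) f ≈ ∑ L f + ∑ M f
    ∑-++ []      M f = sym (+-identityˡ _)
    ∑-++ (i ∷ L) M f = trans (+-congˡ (∑-++ L M f)) (sym (+-assoc _ _ _))

  ∑-map : ∀ {I J : Set} (φ : I → J) (L : List I) (f : J → Carrier) → ∑ (map φ L) f ≈ ∑ L (f ∘ φ)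
  ∑-map φ []      f = refl
  ∑-map φ (i ∷ L) f = +-congˡ (∑-map φ L f)

  ∑-swap : ∀ {I J : Set} (L : List I) (M : List J) (f : I → J → Carrier) →
    ∑ L (λ i → ∑ M (f i)) ≈ ∑ M (λ j → ∑ L (λ i → f i j))
  ∑-swap []      M f = sym (∑-zero M (λ _ → refl))
  ∑-swap (i ∷ L) M f = trans (+-congˡ (∑-swap L M f)) (sym (∑-+ M _ _))

  ∑-cartesian : ∀ {I J : Set} (L : List I) (M : List J) (f : I × J → Carrier) →
    ∑ (cartesianProduct L M) f ≈ ∑ L (λ i → ∑ M (λ j → f (i , j)))
  ∑-cartesian []      M f = refl
  ∑-cartesian (i ∷ L) M f =
    trans (∑-++ (map (i ,_) M) _ f) (+-cong (∑-map (i ,_) M f) (∑-cartesian L M f))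

  module _ {I : Set} (_≟_ : DecidableEquality I) where

    ∑-absent : ∀ (L : List I) b (f : I → Carrier) → All (b ≢_) L →
      ∑ L (λ i → ind (b ≟ i) * f i) ≈ 0#
    ∑-absent []      b f []       = refl
    ∑-absent (i ∷ L) b f (n ∷ ns) = trans
      (+-cong (trans (*-congʳ (ind-no (b ≟ i) n)) (zeroˡ _)) (∑-absent L b f ns)) (+-identityˡ 0#)

    -- Kronecker delta. The alternative `f b ≈ 0#` admits points outside the list, where both sides
    -- are zero.
    ∑-select : ∀ {L : List I} {b} (f : I → Carrier) → Unique L → b ∈ L ⊎ f b ≈ 0# →
      ∑ L (λ i → ind (b ≟ i) * f i) ≈ f b
    ∑-select {L} {b} f u (inj₂ z) = trans (∑-zero L vanish) (sym z)
      where
      vanish : ∀ i → ind (b ≟ i) * f i ≈ 0#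
      vanish i with b ≟ i
      ... | yes ≡.refl = trans (*-identityˡ _) z
      ... | no _       = zeroˡ _
    ∑-select {i ∷ L} {b} f (n ∷ u) (inj₁ (here ≡.refl)) = trans
      (+-cong (trans (*-congʳ (ind-yes (b ≟ i) ≡.refl)) (*-identityˡ _)) (∑-absent L b f n))
      (+-identityʳ _)
    ∑-select {i ∷ L} {b} f (n ∷ u) (inj₁ (there b∈L)) = trans
      (+-cong (trans (*-congʳ (ind-no (b ≟ i) (λ e → All.lookup n b∈L (≡.sym e)))) (zeroˡ _))
              (∑-select f u (inj₁ b∈L)))
      (+-identityˡ _)

  -- diagonal f n = ∑_{s ≤ n} f s (n ∸ s)
  diagonal : (ℕ → ℕ → Carrier) → ℕ → Carrier
  diagonal f zero    = f 0 0
  diagonal f (suc n) = f 0 (suc n) + diagonal (λ s → f (suc s)) n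

  diagonal-cong : ∀ n {f g : ℕ → ℕ → Carrier} →
    (∀ s k → s ℕ.≤ n → k ℕ.≤ n → f s k ≈ g s k) → diagonal f n ≈ diagonal g n
  diagonal-cong zero    e = e 0 0 z≤n z≤n
  diagonal-cong (suc n) e = +-cong (e 0 (suc n) z≤n ℕₚ.≤-refl)
    (diagonal-cong n (λ s k s≤n k≤n → e (suc s) k (s≤s s≤n) (ℕₚ.m≤n⇒m≤1+n k≤n)))

  diagonal-∑ : ∀ {I : Set} (L : List I) n (f : I → ℕ → ℕ → Carrier) →
    diagonal (λ s k → ∑ L (λ i → f i s k)) n ≈ ∑ L (λ i → diagonal (f i) n)
  diagonal-∑ L zero    f = refl
  diagonal-∑ L (suc n) f = trans (+-congˡ (diagonal-∑ L n (λ i s → f i (suc s)))) (sym (∑-+ L _ _))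

  diagonal-zero : ∀ n {f : ℕ → ℕ → Carrier} → (∀ s k → f s k ≈ 0#) → diagonal f n ≈ 0#
  diagonal-zero zero    z = z 0 0
  diagonal-zero (suc n) z = trans (+-cong (z _ _) (diagonal-zero n (λ s k → z (suc s) k))) (+-identityˡ 0#)

  Series : Set
  Series = ℕ → Carrier

  infix 4 _≋_ _≋[_]_

  _≋_ : Series → Series → Set
  X ≋ Y = ∀ n → X n ≈ Y n

  _≋[_]_ : Series → ℕ → Series → Set
  X ≋[ n ] Y = ∀ k → k ℕ.≤ n → X k ≈ Y k

  conv : Series → Series → Series
  conv X Y = diagonal (λ s k → X s * Y k)

  tail : Series → Series
  tail X n = X (suc n)

  -- `conv` recurses on its first argument; commutativity needs this mirror image of the recursion.
  conv-tailʳ : ∀ X Y n → conv X Y (suc n) ≈ X (suc n) * Y 0 + conv X (tail Y) n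
  conv-tailʳ X Y zero    = +-comm _ _
  conv-tailʳ X Y (suc n) = trans (+-congˡ (conv-tailʳ (tail X) Y n))
    (solve 3 (λ a b c → a :+ (b :+ c) := b :+ (a :+ c)) refl _ _ _)

  -- The relation is a parameter because the lemma is needed for `_≈_` and also, when the
  -- coefficients are themselves series, for agreement up to a given exponent.
  conv-congruence : ∀ (_~_ : Carrier → Carrier → Set) →
    (∀ {a b c d} → a ~ b → c ~ d → (a + c) ~ (b + d)) →
    (∀ {a b c d} → a ~ b → c ~ d → (a * c) ~ (b * d)) →
    ∀ n {X X′ Y Y′} → (∀ k → k ℕ.≤ n → X k ~ X′ k) → (∀ k → k ℕ.≤ n → Y k ~ Y′ k) →
    conv X Y n ~ conv X′ Y′ n
  conv-congruence _~_ ac mc zero    e f = mc (e 0 z≤n) (f 0 z≤n)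
  conv-congruence _~_ ac mc (suc n) e f = ac (mc (e 0 z≤n) (f (suc n) ℕₚ.≤-refl))
    (conv-congruence _~_ ac mc n (λ k l → e (suc k) (s≤s l)) (λ k l → f k (ℕₚ.m≤n⇒m≤1+n l)))

  conv-cong[] : ∀ n {X X′ Y Y′} → X ≋[ n ] X′ → Y ≋[ n ] Y′ → conv X Y ≋[ n ] conv X′ Y′
  conv-cong[] n e f k k≤n = conv-congruence _≈_ +-cong *-cong k
    (λ j l → e j (ℕₚ.≤-trans l k≤n)) (λ j l → f j (ℕₚ.≤-trans l k≤n))

  conv-cong : ∀ {X X′ Y Y′} → X ≋ X′ → Y ≋ Y′ → conv X Y ≋ conv X′ Y′
  conv-cong e f n = conv-cong[] n (λ k _ → e k) (λ k _ → f k) n ℕₚ.≤-refl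

  conv-comm : ∀ X Y → conv X Y ≋ conv Y X
  conv-comm X Y zero    = *-comm _ _
  conv-comm X Y (suc n) = trans (conv-tailʳ X Y n) (+-cong (*-comm _ _) (conv-comm X (tail Y) n))

  _⊕_ : Series → Series → Series
  (X ⊕ Y) n = X n + Y n

  𝟎 𝟏 : Series
  𝟎 n = 0#
  𝟏 zero    = 1#
  𝟏 (suc n) = 0#

  conv-distribʳ : ∀ X Y Z → conv (Y ⊕ Z) X ≋ (conv Y X ⊕ conv Z X)
  conv-distribʳ X Y Z zero    = distribʳ _ _ _
  conv-distribʳ X Y Z (suc n) = trans (+-cong (distribʳ _ _ _) (conv-distribʳ X (tail Y) (tail Z) n))
    (solve 4 (λ a b c d → (a :+ b) :+ (c :+ d) := (a :+ c) :+ (b :+ d)) refl _ _ _ _)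

  conv-distribˡ : ∀ X Y Z → conv X (Y ⊕ Z) ≋ (conv X Y ⊕ conv X Z)
  conv-distribˡ X Y Z n = trans (conv-comm X (Y ⊕ Z) n)
    (trans (conv-distribʳ X Y Z n) (+-cong (conv-comm Y X n) (conv-comm Z X n)))

  conv-scaleˡ : ∀ x X Y → conv (λ n → x * X n) Y ≋ (λ n → x * conv X Y n)
  conv-scaleˡ x X Y zero    = *-assoc _ _ _
  conv-scaleˡ x X Y (suc n) = trans (+-cong (*-assoc _ _ _) (conv-scaleˡ x (tail X) Y n)) (sym (distribˡ x _ _))

  conv-zeroˡ : ∀ X → conv 𝟎 X ≋ 𝟎
  conv-zeroˡ X n = diagonal-zero n (λ s k → zeroˡ _)

  conv-identityˡ : ∀ X → conv 𝟏 X ≋ X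
  conv-identityˡ X zero    = *-identityˡ _
  conv-identityˡ X (suc n) = trans (+-cong (*-identityˡ _) (conv-zeroˡ X n)) (+-identityʳ _)

  conv-assoc : ∀ X Y Z → conv (conv X Y) Z ≋ conv X (conv Y Z)
  conv-assoc X Y Z zero    = *-assoc _ _ _
  conv-assoc X Y Z (suc n) = begin
    X 0 * Y 0 * Z (suc n) + conv ((λ k → X 0 * tail Y k) ⊕ conv (tail X) Y) Z n
      ≈⟨ +-congˡ (conv-distribʳ Z (λ k → X 0 * tail Y k) (conv (tail X) Y) n) ⟩
    X 0 * Y 0 * Z (suc n) + (conv (λ k → X 0 * tail Y k) Z n + conv (conv (tail X) Y) Z n)
      ≈⟨ +-congˡ (+-cong (conv-scaleˡ (X 0) (tail Y) Z n) (conv-assoc (tail X) Y Z n)) ⟩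
    X 0 * Y 0 * Z (suc n) + (X 0 * conv (tail Y) Z n + conv (tail X) (conv Y Z) n)
      ≈⟨ solve 5 (λ a b c d e → a :* b :* c :+ (a :* d :+ e) := a :* (b :* c :+ d) :+ e) refl _ _ _ _ _ ⟩
    X 0 * (Y 0 * Z (suc n) + conv (tail Y) Z n) + conv (tail X) (conv Y Z) n ∎

  seriesRing : CommutativeRing 0ℓ 0ℓ
  seriesRing = record
    { Carrier = Series
    ; _≈_ = _≋_
    ; _+_ = _⊕_
    ; _*_ = conv
    ; -_  = λ X n → - X n
    ; 0#  = 𝟎
    ; 1#  = 𝟏
    ; isCommutativeRing = record
      { isRing = record
        { +-isAbelianGroup = record
          { isGroup = record
            { isMonoid = record
              { isSemigroup = record
                { isMagma = record
                  { isEquivalence = record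
                    { refl = λ n → refl ; sym = λ e n → sym (e n) ; trans = λ e f n → trans (e n) (f n) }
                  ; ∙-cong = λ e f n → +-cong (e n) (f n) }
                ; assoc = λ X Y Z n → +-assoc _ _ _ }
              ; identity = (λ X n → +-identityˡ _) , (λ X n → +-identityʳ _) }
            ; inverse = (λ X n → -‿inverseˡ _) , (λ X n → -‿inverseʳ _)
            ; ⁻¹-cong = λ e n → -‿cong (e n) }
          ; comm = λ X Y n → +-comm _ _ }
        ; *-cong = conv-cong
        ; *-assoc = conv-assoc
        ; *-identity = conv-identityˡ , (λ X n → trans (conv-comm X 𝟏 n) (conv-identityˡ X n))
        ; distrib = conv-distribˡ , conv-distribʳ }
      ; *-comm = conv-comm } }

  mono : ℕ → Series
  mono zero    = 𝟏
  mono (suc a) zero    = 0#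
  mono (suc a) (suc n) = mono a n

  mono-diag : ∀ a → mono a a ≈ 1#
  mono-diag zero    = refl
  mono-diag (suc a) = mono-diag a

  mono-off : ∀ {a n} → a ≢ n → mono a n ≈ 0#
  mono-off {zero}  {zero}  a≢n = contradiction ≡.refl a≢n
  mono-off {zero}  {suc n} a≢n = refl
  mono-off {suc a} {zero}  a≢n = refl
  mono-off {suc a} {suc n} a≢n = mono-off (a≢n ∘ ≡.cong suc)

  term : Carrier → ℕ → Series
  term x a n = x * mono a n

  conv-mono-suc : ∀ a X n → conv (mono (suc a)) X (suc n) ≈ conv (mono a) X n
  conv-mono-suc a X n = trans (+-congʳ (zeroˡ _)) (+-identityˡ _)

  conv-mono : ∀ a b → conv (mono a) (mono b) ≋ mono (a ℕ.+ b)
  conv-mono zero    b n       = conv-identityˡ (mono b) n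
  conv-mono (suc a) b zero    = zeroˡ _
  conv-mono (suc a) b (suc n) = trans (conv-mono-suc a (mono b) n) (conv-mono a b n)

  conv-scaleʳ : ∀ x X Y → conv X (λ n → x * Y n) ≋ (λ n → x * conv X Y n)
  conv-scaleʳ x X Y n = trans (conv-comm X _ n) (trans (conv-scaleˡ x Y X n) (*-congˡ (conv-comm Y X n)))

  conv-term : ∀ x y a b → conv (term x a) (term y b) ≋ term (x * y) (a ℕ.+ b)
  conv-term x y a b n = begin
    conv (term x a) (term y b) n      ≈⟨ conv-scaleˡ x (mono a) (term y b) n ⟩
    x * conv (mono a) (term y b) n    ≈⟨ *-congˡ (conv-scaleʳ y (mono a) (mono b) n) ⟩
    x * (y * conv (mono a) (mono b) n) ≈⟨ sym (*-assoc x y _) ⟩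
    x * y * conv (mono a) (mono b) n  ≈⟨ *-congˡ (conv-mono a b n) ⟩
    x * y * mono (a ℕ.+ b) n          ∎

  conv-∑ : ∀ {I J : Set} (L : List I) (M : List J) (F : I → Series) (G : J → Series) n →
    conv (λ k → ∑ L (λ i → F i k)) (λ k → ∑ M (λ j → G j k)) n
      ≈ ∑ (cartesianProduct L M) (λ (i , j) → conv (F i) (G j) n)
  conv-∑ L M F G n = begin
    diagonal (λ s k → ∑ L (λ i → F i s) * ∑ M (λ j → G j k)) n
      ≈⟨ diagonal-cong n (λ s k _ _ → sym (∑-*ʳ L _ _)) ⟩
    diagonal (λ s k → ∑ L (λ i → F i s * ∑ M (λ j → G j k))) n
      ≈⟨ diagonal-cong n (λ s k _ _ → ∑-cong L (λ i → sym (∑-*ˡ M _ _))) ⟩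
    diagonal (λ s k → ∑ L (λ i → ∑ M (λ j → F i s * G j k))) n
      ≈⟨ diagonal-∑ L n (λ i s k → ∑ M (λ j → F i s * G j k)) ⟩
    ∑ L (λ i → diagonal (λ s k → ∑ M (λ j → F i s * G j k)) n)
      ≈⟨ ∑-cong L (λ i → diagonal-∑ M n (λ j s k → F i s * G j k)) ⟩
    ∑ L (λ i → ∑ M (λ j → conv (F i) (G j) n))
      ≈⟨ sym (∑-cartesian L M _) ⟩
    ∑ (cartesianProduct L M) (λ (i , j) → conv (F i) (G j) n) ∎

-- Index sets with finitely many elements of each weight

module Grading where

  open import Data.Nat as ℕ using (ℕ)
  import Data.Nat.Properties as ℕₚ
  open import Data.Fin using (Fin)
  import Data.Fin.Properties as Finₚ
  open import Data.List using (List; map; cartesianProduct; deduplicate; allFin)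
  open import Data.List.Membership.Propositional using (_∈_)
  open import Data.List.Membership.Propositional.Properties using (∈-cartesianProduct⁺; ∈-deduplicate⁺; ∈-map⁺; ∈-allFin)
  open import Data.List.Relation.Unary.Unique.Propositional using (Unique)
  import Data.List.Relation.Unary.Unique.Propositional.Properties as Uniqueₚ
  import Data.List.Relation.Unary.Unique.DecPropositional.Properties as UniqueDecₚ
  open import Data.Product using (_,_)
  open import Data.Product.Properties using (≡-dec)
  open import Function using (_∘_)
  open import Relation.Nullary using (map′)
  open import Relation.Binary using (DecidableEquality)
  open import Relation.Binary.PropositionalEquality as ≡ using (_≡_)

  -- A cover may also list elements of larger weight. This slack is harmless, as those terms vanish
  -- in a coefficient, and it lets one cover serve any larger weight function and form products of
  -- covers.
  record Graded {I : Set} (w : I → ℕ) : Set where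
    field
      _≟_    : DecidableEquality I
      cover  : ℕ → List I
      unique : ∀ n → Unique (cover n)
      covers : ∀ {i n} → w i ℕ.≤ n → i ∈ cover n

  open Graded

  module _ {I : Set} {w : I → ℕ} where

    fromCover : DecidableEquality I → (c : ℕ → List I) → (∀ {i n} → w i ℕ.≤ n → i ∈ c n) → Graded w
    fromCover _≟_ c cov = record
      { _≟_    = _≟_
      ; cover  = deduplicate _≟_ ∘ c
      ; unique = λ n → UniqueDecₚ.deduplicate-! _≟_ (c n)
      ; covers = λ le → ∈-deduplicate⁺ _≟_ (cov le)
      }

    dominate : ∀ {w′ : I → ℕ} → Graded w → (∀ i → w i ℕ.≤ w′ i) → Graded w′
    dominate g le = record
      { _≟_    = _≟_ g
      ; cover  = cover g
      ; unique = unique g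
      ; covers = λ l → covers g (ℕₚ.≤-trans (le _) l)
      }

  finite : ∀ m → Graded {Fin m} (λ _ → 0)
  finite m = record
    { _≟_    = Finₚ._≟_
    ; cover  = λ _ → allFin m
    ; unique = λ _ → Uniqueₚ.allFin⁺ m
    ; covers = λ _ → ∈-allFin _
    }

  _⊗_ : ∀ {I J : Set} {w : I → ℕ} {w′ : J → ℕ} → Graded w → Graded w′ → Graded (λ (i , j) → w i ℕ.+ w′ j)
  g ⊗ h = record
    { _≟_    = ≡-dec (_≟_ g) (_≟_ h)
    ; cover  = λ n → cartesianProduct (cover g n) (cover h n)
    ; unique = λ n → Uniqueₚ.cartesianProduct⁺ (unique g n) (unique h n)
    ; covers = λ l → ∈-cartesianProduct⁺ (covers g (ℕₚ.≤-trans (ℕₚ.m≤m+n _ _) l))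
                                         (covers h (ℕₚ.≤-trans (ℕₚ.m≤n+m _ _) l))
    }

  pullback : ∀ {I J : Set} {w : J → ℕ} (φ : I → J) (ψ : J → I) → (∀ i → ψ (φ i) ≡ i) →
    Graded w → Graded (w ∘ φ)
  pullback φ ψ ψφ h = fromCover
    (λ i j → map′ (λ e → ≡.trans (≡.sym (ψφ i)) (≡.trans (≡.cong ψ e) (ψφ j))) (≡.cong φ) (_≟_ h (φ i) (φ j)))
    (map ψ ∘ cover h)
    (λ {i} {n} l → ≡.subst (_∈ map ψ (cover h n)) (ψφ i) (∈-map⁺ ψ (covers h l)))

-- Generating functions of graded index sets

module GenFun (R : CommutativeRing 0ℓ 0ℓ) where

  open import Data.Nat as ℕ using (ℕ; zero; suc; z≤n)
  import Data.Nat.Properties as ℕₚ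
  open import Data.Unit using (tt)
  open import Data.List using (List; []; _∷_; cartesianProduct; map; deduplicate)
  open import Data.List.Membership.Propositional using (_∈_)
  open import Data.List.Relation.Unary.Unique.Propositional using (Unique)
  open import Data.List.Membership.Propositional.Properties using (∈-cartesianProduct⁺; ∈-deduplicate⁺; ∈-map⁺)
  import Data.List.Relation.Unary.Unique.Propositional.Properties as Uniqueₚ
  import Data.List.Relation.Unary.Unique.DecPropositional.Properties as UniqueDecₚ
  open import Data.Product using (_×_; _,_; proj₂)
  open import Data.Sum using (_⊎_; inj₁; inj₂)
  open import Function using (_∘_)
  open import Relation.Nullary using (yes; no)
  open import Relation.Binary using (DecidableEquality)
  open import Relation.Binary.PropositionalEquality as ≡ using (_≡_; _≢_)
  open Grading
  open Graded
  open PowerSeries R public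
  open import Relation.Binary.Reasoning.Setoid setoid
  open import Algebra.Solver.Ring.NaturalCoefficients.Default commutativeSemiring using (solve; _:=_; _:*_)

  module S  = CommutativeRing seriesRing
  module PS = PowerSeries seriesRing

  -- Expanding each term by a Kronecker delta over the other list and exchanging the two sums avoids
  -- comparing the orders of the lists.
  ∑-support : ∀ {I : Set} → DecidableEquality I → ∀ {L M : List I} → Unique L → Unique M →
    (f : I → Carrier) → (∀ i → (i ∈ L × i ∈ M) ⊎ f i ≈ 0#) → ∑ L f ≈ ∑ M f
  ∑-support _≟_ {L} {M} uL uM f both = begin
    ∑ L f                                        ≈⟨ ∑-cong L (λ i → sym (∑-select _≟_ f uM (inM i))) ⟩
    ∑ L (λ i → ∑ M (λ j → ind (i ≟ j) * f j))    ≈⟨ ∑-swap L M _ ⟩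
    ∑ M (λ j → ∑ L (λ i → ind (i ≟ j) * f j))    ≈⟨ ∑-cong M pick ⟩
    ∑ M f                                        ∎
    where
    inM : ∀ i → i ∈ M ⊎ f i ≈ 0#
    inM i with both i
    ... | inj₁ (_ , m) = inj₁ m
    ... | inj₂ z       = inj₂ z
    inL : ∀ i → i ∈ L ⊎ f i ≈ 0#
    inL i with both i
    ... | inj₁ (l , _) = inj₁ l
    ... | inj₂ z       = inj₂ z
    flip-ind : ∀ j i → ind (i ≟ j) * f j ≈ ind (j ≟ i) * f i
    flip-ind j i with i ≟ j
    ... | yes ≡.refl = *-congʳ (sym (ind-yes (i ≟ i) ≡.refl))
    ... | no i≢j     = trans (zeroˡ _) (sym (trans (*-congʳ (ind-no (j ≟ i) (i≢j ∘ ≡.sym))) (zeroˡ _)))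
    pick : ∀ j → ∑ L (λ i → ind (i ≟ j) * f j) ≈ f j
    pick j = trans (∑-cong L (flip-ind j)) (∑-select _≟_ f uL (inL j))

  term-off : ∀ x {a n} → a ≢ n → term x a n ≈ 0#
  term-off x a≢n = trans (*-congˡ (mono-off a≢n)) (zeroʳ x)

  gf : ∀ {I : Set} {w : I → ℕ} → Graded w → (I → Carrier) → Series
  gf {w = w} g χ n = ∑ (cover g n) (λ i → term (χ i) (w i) n)

  module _ {I : Set} {w : I → ℕ} (g : Graded w) where

    -- Indices of weight other than `n` contribute zero, so the coefficient does not depend on the
    -- chosen cover.
    gf-by : ∀ χ {n} {L : List I} → Unique L → (∀ i → w i ≡ n → i ∈ L) →
      gf g χ n ≈ ∑ L (λ i → term (χ i) (w i) n)
    gf-by χ {n} {L} uL cov = ∑-support (_≟_ g) (unique g n) uL _ both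
      where
      both : ∀ i → (i ∈ cover g n × i ∈ L) ⊎ term (χ i) (w i) n ≈ 0#
      both i with w i ℕ.≟ n
      ... | yes e = inj₁ (covers g (ℕₚ.≤-reflexive e) , cov i e)
      ... | no ne = inj₂ (term-off (χ i) ne)

    gf-cover : ∀ χ {n k} → k ℕ.≤ n → gf g χ k ≈ ∑ (cover g n) (λ i → term (χ i) (w i) k)
    gf-cover χ {n} k≤n = gf-by χ (unique g n) (λ i e → covers g (≡.subst (ℕ._≤ n) (≡.sym e) k≤n))

    gf-cong : ∀ {χ χ′} → (∀ i → χ i ≈ χ′ i) → gf g χ ≋ gf g χ′
    gf-cong e n = ∑-cong (cover g n) (λ i → *-congʳ (e i))

    gf-scale : ∀ x χ → gf g (λ i → x * χ i) ≋ (λ n → x * gf g χ n)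
    gf-scale x χ n = trans (∑-cong (cover g n) (λ i → *-assoc _ _ _)) (∑-*ˡ (cover g n) x _)

    gf-zero : ∀ {χ} → (∀ i → χ i ≈ 0#) → gf g χ ≋ 𝟎
    gf-zero z n = ∑-zero (cover g n) (λ i → trans (*-congʳ (z i)) (zeroˡ _))

  -- The support of the target weight function need only be covered by φ.
  reindex : ∀ {I J : Set} {w : I → ℕ} {w′ : J → ℕ} (g : Graded w) (h : Graded w′)
    {χ : I → Carrier} {χ′ : J → Carrier} (φ : I → J) (ψ : J → I) →
    (∀ i → ψ (φ i) ≡ i) → (∀ j → φ (ψ j) ≡ j ⊎ χ′ j ≈ 0#) →
    (∀ i → w′ (φ i) ≡ w i) → (∀ i → χ′ (φ i) ≈ χ i) → gf g χ ≋ gf h χ′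
  reindex {I} {J} {w} {w′} g h {χ} {χ′} φ ψ ψφ φψ weights characters n = begin
    ∑ A (λ i → term (χ i) (w i) n)
      ≈⟨ ∑-cong A (λ i → sym (trans (∑-select (_≟_ h) f (unique h n) (inB i)) (value i))) ⟩
    ∑ A (λ i → ∑ B (λ j → ind (_≟_ h (φ i) j) * f j))
      ≈⟨ ∑-swap A B _ ⟩
    ∑ B (λ j → ∑ A (λ i → ind (_≟_ h (φ i) j) * f j))
      ≈⟨ ∑-cong B pick ⟩
    ∑ B f ∎
    where
    A = cover g n
    B = cover h n
    f : J → Carrier
    f j = term (χ′ j) (w′ j) n
    value : ∀ i → f (φ i) ≈ term (χ i) (w i) n
    value i = *-cong (characters i) (≡⇒≈ (≡.cong (λ k → mono k n) (weights i)))
    inB : ∀ i → φ i ∈ B ⊎ f (φ i) ≈ 0#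
    inB i with w′ (φ i) ℕ.≟ n
    ... | yes e = inj₁ (covers h (ℕₚ.≤-reflexive e))
    ... | no ne = inj₂ (term-off _ ne)
    zeros : ∀ j → f j ≈ 0# → ∑ A (λ i → ind (_≟_ h (φ i) j) * f j) ≈ f j
    zeros j z = trans (∑-zero A (λ i → trans (*-congˡ z) (zeroʳ _))) (sym z)
    pick : ∀ j → ∑ A (λ i → ind (_≟_ h (φ i) j) * f j) ≈ f j
    pick j with φψ j
    ... | inj₂ z = zeros j (trans (*-congʳ z) (zeroˡ _))
    ... | inj₁ e with w′ j ℕ.≟ n
    ...   | no ne = zeros j (term-off _ ne)
    ...   | yes w≡n = trans (∑-cong A (λ i → *-congʳ (ind-cong (_≟_ h (φ i) j) (_≟_ g (ψ j) i)
              (λ { ≡.refl → ψφ i }) (λ { ≡.refl → e }))))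
            (∑-select (_≟_ g) (λ _ → f j) (unique g n)
              (inj₁ (covers g (ℕₚ.≤-reflexive
                (≡.trans (≡.sym (weights (ψ j))) (≡.trans (≡.cong w′ e) w≡n))))))

  gf-graded : ∀ {I : Set} {w w′ : I → ℕ} (g : Graded w) (h : Graded w′) {χ χ′ : I → Carrier} →
    (∀ i → w′ i ≡ w i) → (∀ i → χ′ i ≈ χ i) → gf g χ ≋ gf h χ′
  gf-graded g h = reindex g h (λ i → i) (λ i → i) (λ _ → ≡.refl) (λ _ → inj₁ ≡.refl)

  gf-⊗ : ∀ {I J : Set} {w : I → ℕ} {w′ : J → ℕ} (g : Graded w) (h : Graded w′)
    (χ : I → Carrier) (χ′ : J → Carrier) →
    gf (g ⊗ h) (λ (i , j) → χ i * χ′ j) ≋ conv (gf g χ) (gf h χ′)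
  gf-⊗ {w = w} {w′} g h χ χ′ n = sym (begin
    conv (gf g χ) (gf h χ′) n
      -- The covers at `n` serve all exponents up to `n` at once, which turns the product into one
      -- double sum over fixed lists.
      ≈⟨ conv-cong[] n (λ k → gf-cover g χ) (λ k → gf-cover h χ′) n ℕₚ.≤-refl ⟩
    conv (λ k → ∑ A (λ i → term (χ i) (w i) k)) (λ k → ∑ B (λ j → term (χ′ j) (w′ j) k)) n
      ≈⟨ conv-∑ A B _ _ n ⟩
    ∑ (cartesianProduct A B) (λ (i , j) → conv (term (χ i) (w i)) (term (χ′ j) (w′ j)) n)
      ≈⟨ ∑-cong (cartesianProduct A B) (λ (i , j) → conv-term (χ i) (χ′ j) (w i) (w′ j) n) ⟩
    ∑ (cartesianProduct A B) (λ (i , j) → term (χ i * χ′ j) (w i ℕ.+ w′ j) n) ∎)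
    where
    A = cover g n
    B = cover h n

  gf-shift : ∀ {I : Set} {w w′ : I → ℕ} (g : Graded w) (h : Graded w′) c {χ χ′ : I → Carrier} →
    (∀ i → w′ i ≡ c ℕ.+ w i) → (∀ i → χ′ i ≈ χ i) → gf h χ′ ≋ conv (mono c) (gf g χ)
  gf-shift {w = w} {w′} g h c {χ} {χ′} weights characters n = sym (begin
    conv (mono c) (gf g χ) n
      ≈⟨ conv-cong[] n (λ k _ → trans (sym (*-identityˡ _)) (sym (+-identityʳ _))) (λ k → gf-cover g χ) n ℕₚ.≤-refl ⟩
    conv (λ k → ∑ (tt ∷ []) (λ _ → term 1# c k)) (λ k → ∑ A (λ i → term (χ i) (w i) k)) n
      ≈⟨ conv-∑ (tt ∷ []) A (λ _ → term 1# c) _ n ⟩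
    ∑ (cartesianProduct (tt ∷ []) A) (λ (_ , i) → conv (term 1# c) (term (χ i) (w i)) n)
      ≈⟨ ∑-cartesian (tt ∷ []) A _ ⟩
    ∑ A (λ i → conv (term 1# c) (term (χ i) (w i)) n) + 0#
      ≈⟨ +-identityʳ _ ⟩
    ∑ A (λ i → conv (term 1# c) (term (χ i) (w i)) n)
      ≈⟨ ∑-cong A (λ i → trans (conv-term 1# (χ i) c (w i) n)
           (*-cong (trans (*-identityˡ _) (sym (characters i)))
                   (≡⇒≈ (≡.cong (λ k → mono k n) (≡.sym (weights i)))))) ⟩
    ∑ A (λ i → term (χ′ i) (w′ i) n)
      ≈⟨ sym (gf-by h χ′ (unique g n) (λ i e → covers g
           (ℕₚ.≤-trans (ℕₚ.m≤n+m (w i) c) (ℕₚ.≤-reflexive (≡.trans (≡.sym (weights i)) e))))) ⟩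
    gf h χ′ n ∎)
    where A = cover g n

  PS-∑ : ∀ {I : Set} (L : List I) (F : I → Series) n → PS.∑ L F n ≈ ∑ L (λ i → F i n)
  PS-∑ []      F n = refl
  PS-∑ (i ∷ L) F n = +-congˡ (PS-∑ L F n)

  -- `K` carries the weight 0, so its cover at 0 lists the whole of `K`. The second components
  -- occurring in the cover of `g` form one list that suffices for every fibre.
  gf-fibres : ∀ {K I : Set} {w : K × I → ℕ} → DecidableEquality I → (k : Graded {K} (λ _ → 0)) (g : Graded w)
    (h : ∀ κ → Graded (λ i → w (κ , i))) (χ : K × I → Carrier) →
    gf g χ ≋ PS.∑ (cover k 0) (λ κ → gf (h κ) (λ i → χ (κ , i)))
  gf-fibres {w = w} _≟′_ k g h χ n = begin
    gf g χ n
      ≈⟨ gf-by g χ (Uniqueₚ.cartesianProduct⁺ (unique k 0) uN)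
           (λ (κ , i) e → ∈-cartesianProduct⁺ (covers k z≤n) (inN e)) ⟩
    ∑ (cartesianProduct (cover k 0) N) (λ p → term (χ p) (w p) n)
      ≈⟨ ∑-cartesian (cover k 0) N _ ⟩
    ∑ (cover k 0) (λ κ → ∑ N (λ i → term (χ (κ , i)) (w (κ , i)) n))
      ≈⟨ ∑-cong (cover k 0) (λ κ → sym (gf-by (h κ) (λ i → χ (κ , i)) uN (λ i → inN))) ⟩
    ∑ (cover k 0) (λ κ → gf (h κ) (λ i → χ (κ , i)) n)
      ≈⟨ sym (PS-∑ (cover k 0) _ n) ⟩
    PS.∑ (cover k 0) (λ κ → gf (h κ) (λ i → χ (κ , i))) n ∎
    where
    N = deduplicate _≟′_ (map proj₂ (cover g n))
    uN : Unique N
    uN = UniqueDecₚ.deduplicate-! _≟′_ _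
    inN : ∀ {κ i} → w (κ , i) ≡ n → i ∈ N
    inN e = ∈-deduplicate⁺ _≟′_ (∈-map⁺ proj₂ (covers g (ℕₚ.≤-reflexive e)))

  -- A generating function in two variables: the outer index is the exponent of z, recording the
  -- size, and the coefficients are series in q.
  gf₂ : ∀ {I : Set} {w : I → ℕ} → Graded w → (I → ℕ) → (I → Carrier) → PS.Series
  gf₂ g size χ s = gf g (λ i → χ i * mono (size i) s)

  term₂ : Carrier → ℕ → ℕ → PS.Series
  term₂ x a b s = term (x * mono a s) b

  ∑₂ : ∀ {I : Set} → List I → (I → ℕ) → (I → ℕ) → (I → Carrier) → PS.Series
  ∑₂ L size w χ s n = ∑ L (λ i → term₂ (χ i) (size i) (w i) s n)

  PS-diagonal : ∀ s (f : ℕ → ℕ → Series) n → PS.diagonal f s n ≈ diagonal (λ a b → f a b n) s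
  PS-diagonal zero    f n = refl
  PS-diagonal (suc s) f n = +-congˡ (PS-diagonal s (λ a → f (suc a)) n)

  diagonal-scaleʳ : ∀ n (f : ℕ → ℕ → Carrier) x → diagonal (λ s k → f s k * x) n ≈ diagonal f n * x
  diagonal-scaleʳ zero    f x = refl
  diagonal-scaleʳ (suc n) f x = trans (+-congˡ (diagonal-scaleʳ n (λ s → f (suc s)) x)) (sym (distribʳ x _ _))

  term₂-conv : ∀ x y a b c d → PS.conv (term₂ x a c) (term₂ y b d) PS.≋ term₂ (x * y) (a ℕ.+ b) (c ℕ.+ d)
  term₂-conv x y a b c d s n = begin
    PS.conv (term₂ x a c) (term₂ y b d) s n
      ≈⟨ PS-diagonal s _ n ⟩
    diagonal (λ u v → conv (term₂ x a c u) (term₂ y b d v) n) s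
      ≈⟨ diagonal-cong s (λ u v _ _ → conv-term _ _ c d n) ⟩
    diagonal (λ u v → (x * mono a u) * (y * mono b v) * mono (c ℕ.+ d) n) s
      ≈⟨ diagonal-scaleʳ s _ _ ⟩
    conv (term x a) (term y b) s * mono (c ℕ.+ d) n
      ≈⟨ *-congʳ (conv-term x y a b s) ⟩
    term₂ (x * y) (a ℕ.+ b) (c ℕ.+ d) s n ∎

  module _ {I J : Set} (L : List I) (M : List J) (size w : I → ℕ) (size′ w′ : J → ℕ)
    (χ : I → Carrier) (χ′ : J → Carrier) where

    conv-∑₂ : ∀ s t n → conv (∑₂ L size w χ s) (∑₂ M size′ w′ χ′ t) n ≈
      ∑ (cartesianProduct L M) (λ (i , j) → (χ i * mono (size i) s) * (χ′ j * mono (size′ j) t) * mono (w i ℕ.+ w′ j) n)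
    conv-∑₂ s t n = trans (conv-∑ L M _ _ n)
      (∑-cong (cartesianProduct L M) (λ (i , j) → conv-term _ _ (w i) (w′ j) n))

    ∑₂-conv : PS.conv (∑₂ L size w χ) (∑₂ M size′ w′ χ′) PS.≋
      ∑₂ (cartesianProduct L M) (λ (i , j) → size i ℕ.+ size′ j) (λ (i , j) → w i ℕ.+ w′ j) (λ (i , j) → χ i * χ′ j)
    ∑₂-conv s n = begin
      PS.conv (∑₂ L size w χ) (∑₂ M size′ w′ χ′) s n
        ≈⟨ PS-diagonal s _ n ⟩
      diagonal (λ u v → conv (∑₂ L size w χ u) (∑₂ M size′ w′ χ′ v) n) s
        ≈⟨ diagonal-cong s (λ u v _ _ → conv-∑₂ u v n) ⟩
      diagonal (λ u v → ∑ (cartesianProduct L M)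
        (λ (i , j) → (χ i * mono (size i) u) * (χ′ j * mono (size′ j) v) * mono (w i ℕ.+ w′ j) n)) s
        ≈⟨ diagonal-∑ (cartesianProduct L M) s _ ⟩
      ∑ (cartesianProduct L M) (λ (i , j) → diagonal
        (λ u v → (χ i * mono (size i) u) * (χ′ j * mono (size′ j) v) * mono (w i ℕ.+ w′ j) n) s)
        ≈⟨ ∑-cong (cartesianProduct L M) (λ (i , j) → trans (diagonal-scaleʳ s _ _)
             (*-congʳ (conv-term (χ i) (χ′ j) (size i) (size′ j) s))) ⟩
      ∑₂ (cartesianProduct L M) (λ (i , j) → size i ℕ.+ size′ j) (λ (i , j) → w i ℕ.+ w′ j)
        (λ (i , j) → χ i * χ′ j) s n ∎

  -- Constant term in z of X(z q) Y(1/z), for series in z over the series in q.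
  _⋆_ : PS.Series → PS.Series → Series
  X ⋆ Y = diagonal (λ s → conv (X s) (Y s))

  ⋆-cong[] : ∀ n {X X′ Y Y′} → (∀ s → X s ≋[ n ] X′ s) → (∀ s → Y s ≋[ n ] Y′ s) → (X ⋆ Y) n ≈ (X′ ⋆ Y′) n
  ⋆-cong[] n e f = diagonal-cong n (λ s k _ k≤n → conv-cong[] n (e s) (f s) k k≤n)

  diagonal-mono : ∀ n a c → diagonal (λ s k → mono a s * mono c k) n ≈ mono (a ℕ.+ c) n
  diagonal-mono n a c = conv-mono a c n

  -- The constant term in z keeps exactly the pairs of equal size, and the substitution of z q adds
  -- that common size to the weight. This is the number of columns in the weight of a symbol.
  ∑₂-⋆ : ∀ {I J : Set} (L : List I) (M : List J) (size w : I → ℕ) (size′ w′ : J → ℕ)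
    (χ : I → Carrier) (χ′ : J → Carrier) n →
    (∑₂ L size w χ ⋆ ∑₂ M size′ w′ χ′) n ≈
    ∑ (cartesianProduct L M) (λ (i , j) → term (χ i * χ′ j * ind (size i ℕ.≟ size′ j)) (size i ℕ.+ (w i ℕ.+ w′ j)) n)
  ∑₂-⋆ L M size w size′ w′ χ χ′ n = begin
    diagonal (λ s k → conv (∑₂ L size w χ s) (∑₂ M size′ w′ χ′ s) k) n
      ≈⟨ diagonal-cong n (λ s k _ _ → conv-∑₂ L M size w size′ w′ χ χ′ s s k) ⟩
    diagonal (λ s k → ∑ (cartesianProduct L M) (λ p → summand p s k)) n
      ≈⟨ diagonal-∑ (cartesianProduct L M) n summand ⟩
    ∑ (cartesianProduct L M) (λ p → diagonal (summand p) n)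
      ≈⟨ ∑-cong (cartesianProduct L M) evaluate ⟩
    ∑ (cartesianProduct L M) _ ∎
    where
    summand : _ → ℕ → ℕ → Carrier
    summand (i , j) s k = (χ i * mono (size i) s) * (χ′ j * mono (size′ j) s) * mono (w i ℕ.+ w′ j) k
    common : ∀ a b s → mono a s * mono b s ≈ ind (a ℕ.≟ b) * mono a s
    common a b s with a ℕ.≟ b
    common a b s | no a≢b with a ℕ.≟ s
    ... | no a≢s     = trans (*-congʳ (mono-off a≢s)) (trans (zeroˡ _) (sym (zeroˡ _)))
    ... | yes ≡.refl = trans (*-congˡ (mono-off (a≢b ∘ ≡.sym))) (trans (zeroʳ _) (sym (zeroˡ _)))
    common a b s | yes ≡.refl with a ℕ.≟ s
    ... | no a≢s     = trans (*-congʳ (mono-off a≢s)) (trans (zeroˡ _) (sym (trans (*-identityˡ _) (mono-off a≢s))))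
    ... | yes ≡.refl = *-congʳ (mono-diag a)
    evaluate : ∀ p → diagonal (summand p) n ≈ _
    evaluate (i , j) = begin
      diagonal (summand (i , j)) n
        ≈⟨ diagonal-cong n (λ s k _ _ → trans
             (solve 5 (λ x y a b c → (x :* a) :* (y :* b) :* c := (a :* b) :* (x :* y :* c)) refl _ _ _ _ _)
             (trans (*-congʳ (common (size i) (size′ j) s))
               (solve 5 (λ x y a b c → (b :* a) :* (x :* y :* c) := (a :* c) :* (x :* y :* b)) refl _ _ _ _ _))) ⟩
      diagonal (λ s k → (mono (size i) s * mono (w i ℕ.+ w′ j) k) * (χ i * χ′ j * ind (size i ℕ.≟ size′ j))) n
        ≈⟨ diagonal-scaleʳ n _ _ ⟩
      diagonal (λ s k → mono (size i) s * mono (w i ℕ.+ w′ j) k) n * (χ i * χ′ j * ind (size i ℕ.≟ size′ j))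
        ≈⟨ trans (*-congʳ (diagonal-mono n (size i) (w i ℕ.+ w′ j))) (*-comm _ _) ⟩
      term (χ i * χ′ j * ind (size i ℕ.≟ size′ j)) (size i ℕ.+ (w i ℕ.+ w′ j)) n ∎

  module _ {I J : Set} {w : I → ℕ} {w′ : J → ℕ} (g : Graded w) (h : Graded w′)
    (size : I → ℕ) (size′ : J → ℕ) (χ : I → Carrier) (χ′ : J → Carrier) where

    gf₂-⊗ : gf₂ (g ⊗ h) (λ (i , j) → size i ℕ.+ size′ j) (λ (i , j) → χ i * χ′ j) PS.≋
      PS.conv (gf₂ g size χ) (gf₂ h size′ χ′)
    gf₂-⊗ s n = sym (trans
      (PS.conv-congruence (λ X Y → X ≋[ n ] Y)
        (λ e f k l → +-cong (e k l) (f k l)) (conv-cong[] n) s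
        (λ _ _ k → gf-cover g _) (λ _ _ k → gf-cover h _) n ℕₚ.≤-refl)
      (∑₂-conv (cover g n) (cover h n) size w size′ w′ χ χ′ s n))

    gf-⋆ : (k : Graded (λ (i , j) → size i ℕ.+ (w i ℕ.+ w′ j))) →
      gf k (λ (i , j) → χ i * χ′ j * ind (size i ℕ.≟ size′ j)) ≋ (gf₂ g size χ ⋆ gf₂ h size′ χ′)
    gf-⋆ k n = begin
      gf k _ n
        ≈⟨ gf-by k _ (unique (g ⊗ h) n) (λ (i , j) e → covers (g ⊗ h)
             (ℕₚ.≤-trans (ℕₚ.m≤n+m (w i ℕ.+ w′ j) (size i)) (ℕₚ.≤-reflexive e))) ⟩
      ∑ (cartesianProduct (cover g n) (cover h n)) _
        ≈⟨ sym (∑₂-⋆ (cover g n) (cover h n) size w size′ w′ χ χ′ n) ⟩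
      (∑₂ (cover g n) size w χ ⋆ ∑₂ (cover h n) size′ w′ χ′) n
        ≈⟨ ⋆-cong[] n (λ s k → sym ∘ gf-cover g _) (λ s k → sym ∘ gf-cover h _) ⟩
      (gf₂ g size χ ⋆ gf₂ h size′ χ′) n ∎

-- Maya diagrams, charge and energy

module Maya where

  open import Data.Nat as ℕ using (ℕ; zero; suc; z≤n; s≤s)
  import Data.Nat.Properties as ℕₚ
  open import Data.Nat.Solver using (module +-*-Solver)
  open import Data.Integer as ℤ using (ℤ; +_; -[1+_]; _⊖_; 0ℤ; 1ℤ)
  import Data.Integer.Properties as ℤₚ
  import Data.Integer.Solver as ℤ-Solver
  open import Data.List using (List; []; _∷_; length; map; upTo; cartesianProductWith; _++_)
  import Data.List.Properties as Listₚ
  open import Data.List.Membership.Propositional using (_∈_)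
  open import Data.List.Membership.Propositional.Properties
    using (∈-cartesianProductWith⁺; ∈-upTo⁺; ∈-map⁺; ∈-++⁺ˡ; ∈-++⁺ʳ)
  open import Data.List.Relation.Unary.Any using (here; there)
  open import Data.List.Relation.Unary.All as All using (All; []; _∷_)
  open import Data.Product using (_×_; _,_; proj₁; proj₂; swap)
  open import Function using (_∘_)
  open import Relation.Binary.PropositionalEquality as ≡ using (_≡_; refl; sym; trans; cong; cong₂)
  open Grading
  open ≡.≡-Reasoning

  triangle : ℕ → ℕ
  triangle zero    = 0
  triangle (suc n) = suc n ℕ.+ triangle n

  -- This is x (x + 1) / 2 on all of ℤ; the two branches agree because the expression is invariant
  -- under x ↦ -1 - x.
  T : ℤ → ℕ
  T (+ n)    = triangle n
  T -[1+ n ] = triangle n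

  n≤triangle : ∀ n → n ℕ.≤ triangle n
  n≤triangle zero    = z≤n
  n≤triangle (suc n) = ℕₚ.m≤m+n (suc n) _

  triangle-double : ∀ n → 2 ℕ.* triangle n ≡ n ℕ.* suc n
  triangle-double zero    = refl
  triangle-double (suc n) = trans (ℕₚ.*-distribˡ-+ 2 (suc n) (triangle n))
    (trans (cong (2 ℕ.* suc n ℕ.+_) (triangle-double n))
      (solve 1 (λ n → con 2 :* (con 1 :+ n) :+ n :* (con 1 :+ n) := (con 1 :+ n) :* (con 2 :+ n)) refl n))
    where open +-*-Solver

  T-double : ∀ x → + 2 ℤ.* + T x ≡ x ℤ.* x ℤ.+ x
  T-double (+ n) = begin
    + 2 ℤ.* + triangle n     ≡⟨ sym (ℤₚ.pos-* 2 (triangle n)) ⟩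
    + (2 ℕ.* triangle n)     ≡⟨ cong +_ (triangle-double n) ⟩
    + (n ℕ.* suc n)          ≡⟨ ℤₚ.pos-* n (suc n) ⟩
    + n ℤ.* (1ℤ ℤ.+ + n)     ≡⟨ solve 1 (λ n → n :* (con 1ℤ :+ n) := n :* n :+ n) refl (+ n) ⟩
    + n ℤ.* + n ℤ.+ + n      ∎
    where open ℤ-Solver.+-*-Solver
  T-double -[1+ n ] = begin
    + 2 ℤ.* + triangle n     ≡⟨ sym (ℤₚ.pos-* 2 (triangle n)) ⟩
    + (2 ℕ.* triangle n)     ≡⟨ cong +_ (triangle-double n) ⟩
    + (n ℕ.* suc n)          ≡⟨ ℤₚ.pos-* n (suc n) ⟩
    + n ℤ.* (1ℤ ℤ.+ + n)
      ≡⟨ solve 1 (λ n → n :* (con 1ℤ :+ n) := (:- (con 1ℤ :+ n)) :* (:- (con 1ℤ :+ n)) :+ (:- (con 1ℤ :+ n))) refl (+ n) ⟩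
    -[1+ n ] ℤ.* -[1+ n ] ℤ.+ -[1+ n ] ∎
    where open ℤ-Solver.+-*-Solver

  gradedℤ : Graded T
  gradedℤ = fromCover ℤₚ._≟_ box inBox
    where
    box : ℕ → List ℤ
    box n = map +_ (upTo (suc n)) ++ map -[1+_] (upTo (suc n))
    inBox : ∀ {x n} → T x ℕ.≤ n → x ∈ box n
    inBox {+ k}      {n} le = ∈-++⁺ˡ (∈-map⁺ +_ (∈-upTo⁺ (s≤s (ℕₚ.≤-trans (n≤triangle k) le))))
    inBox { -[1+ k ]} {n} le = ∈-++⁺ʳ (map +_ (upTo (suc n)))
      (∈-map⁺ -[1+_] (∈-upTo⁺ (s≤s (ℕₚ.≤-trans (n≤triangle k) le))))

  -- A finite subset s₁ < s₂ < … of ℕ is encoded by its gaps s₁, s₂ - s₁ - 1, … ; wt is the sum of its elements.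
  Subset : Set
  Subset = List ℕ

  wt : Subset → ℕ
  wt []       = 0
  wt (g ∷ gs) = wt gs ℕ.+ length gs ℕ.* suc g ℕ.+ g

  -- Since only gaps are stored, raising the first one translates the entire subset by one.
  increment : Subset → Subset
  increment []       = []
  increment (g ∷ gs) = suc g ∷ gs

  length-increment : ∀ s → length (increment s) ≡ length s
  length-increment []       = refl
  length-increment (g ∷ gs) = refl

  wt-increment : ∀ s → wt (increment s) ≡ wt s ℕ.+ length s
  wt-increment []       = refl
  wt-increment (g ∷ gs) = solve 3 (λ w l g →
    w :+ l :* (con 2 :+ g) :+ (con 1 :+ g) := w :+ l :* (con 1 :+ g) :+ g :+ (con 1 :+ l)) refl (wt gs) (length gs) g
    where open +-*-Solver

  -- Prefixing the gap 0 translates the subset by one and inserts the element 0, which weighs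
  -- nothing.
  wt-0∷ : ∀ s → wt (0 ∷ s) ≡ wt s ℕ.+ length s
  wt-0∷ s = trans (ℕₚ.+-identityʳ _) (cong (wt s ℕ.+_) (ℕₚ.*-identityʳ (length s)))

  length≤suc-wt : ∀ s → length s ℕ.≤ suc (wt s)
  length≤suc-wt []       = z≤n
  length≤suc-wt (g ∷ gs) = s≤s (ℕₚ.≤-trans (ℕₚ.m≤m*n (length gs) (suc g))
    (ℕₚ.≤-trans (ℕₚ.m≤n+m _ (wt gs)) (ℕₚ.m≤m+n _ g)))

  gaps≤wt : ∀ s → All (ℕ._≤ wt s) s
  gaps≤wt []       = []
  gaps≤wt (g ∷ gs) = ℕₚ.m≤n+m g _ ∷ All.map (λ le → ℕₚ.≤-trans le
    (ℕₚ.≤-trans (ℕₚ.m≤m+n (wt gs) _) (ℕₚ.m≤m+n _ g))) (gaps≤wt gs)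

  gradedSubset : Graded wt
  gradedSubset = fromCover (Listₚ.≡-dec ℕ._≟_) (λ n → lists n (suc n)) (λ {s} {n} le →
      listed n (suc n) s (ℕₚ.≤-trans (length≤suc-wt s) (s≤s le)) (All.map (λ l → ℕₚ.≤-trans l le) (gaps≤wt s)))
    where
    lists : ℕ → ℕ → List Subset
    lists b zero    = [] ∷ []
    lists b (suc l) = [] ∷ cartesianProductWith _∷_ (upTo (suc b)) (lists b l)
    listed : ∀ b l s → length s ℕ.≤ l → All (ℕ._≤ b) s → s ∈ lists b l
    listed b zero    []      le bs       = here refl
    listed b (suc l) []      le bs       = here refl
    listed b (suc l) (g ∷ s) le (p ∷ bs) =
      there (∈-cartesianProductWith⁺ _∷_ (∈-upTo⁺ (s≤s p)) (listed b l s (ℕ.s≤s⁻¹ le) bs))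

  Maya : Set
  Maya = Subset × Subset

  -- An element n of the first subset stands for the factor z qⁿ⁺¹, one of the second for z⁻¹ qⁿ;
  -- the offset in the first kind accounts for `length s`.
  energy : Maya → ℕ
  energy (s , t) = length s ℕ.+ (wt s ℕ.+ wt t)

  gradedMaya : Graded energy
  gradedMaya = dominate (gradedSubset ⊗ gradedSubset) (λ (s , t) → ℕₚ.m≤n+m _ (length s))

  charge : Maya → ℤ
  charge (s , t) = length s ⊖ length t

  -- Coefficient form of F(z q) = z⁻¹ q⁻¹ F(z) for F(z) = ∏ (1 + z qⁿ⁺¹)(1 + z⁻¹ qⁿ), n ≥ 0.
  shift : Maya → Maya
  shift (s , [])        = 0 ∷ s , []
  shift (s , zero ∷ t)  = increment s , t
  shift (s , suc g ∷ t) = 0 ∷ s , g ∷ t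

  unshift : Maya → Maya
  unshift = swap ∘ shift ∘ swap

  shift-unshift : ∀ m → shift (unshift m) ≡ m
  shift-unshift ([] , [])              = refl
  shift-unshift ([] , g ∷ t)           = refl
  shift-unshift (zero ∷ s , [])        = refl
  shift-unshift (zero ∷ s , g ∷ t)     = refl
  shift-unshift (suc g ∷ s , t)        = refl

  unshift-shift : ∀ m → unshift (shift m) ≡ m
  unshift-shift (s , t) = cong swap (shift-unshift (t , s))

  -- The energy grows by the charge plus one. That may be negative, so the two lengths are put on
  -- opposite sides.
  shift-energy : ∀ m → energy (shift m) ℕ.+ length (proj₂ m) ≡ energy m ℕ.+ suc (length (proj₁ m))
  shift-energy (s , []) = begin
    suc (length s) ℕ.+ (wt (0 ∷ s) ℕ.+ 0) ℕ.+ 0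
      ≡⟨ cong (λ k → suc (length s) ℕ.+ (k ℕ.+ 0) ℕ.+ 0) (wt-0∷ s) ⟩
    suc (length s) ℕ.+ (wt s ℕ.+ length s ℕ.+ 0) ℕ.+ 0
      ≡⟨ solve 2 (λ l w → (con 1 :+ l) :+ (w :+ l :+ con 0) :+ con 0 := l :+ (w :+ con 0) :+ (con 1 :+ l)) refl
        (length s) (wt s) ⟩
    length s ℕ.+ (wt s ℕ.+ 0) ℕ.+ suc (length s) ∎
    where open +-*-Solver
  shift-energy (s , zero ∷ t) = begin
    length (increment s) ℕ.+ (wt (increment s) ℕ.+ wt t) ℕ.+ suc (length t)
      ≡⟨ cong₂ (λ a b → a ℕ.+ (b ℕ.+ wt t) ℕ.+ suc (length t)) (length-increment s) (wt-increment s) ⟩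
    length s ℕ.+ (wt s ℕ.+ length s ℕ.+ wt t) ℕ.+ suc (length t)
      ≡⟨ solve 4 (λ l w k v → l :+ (w :+ l :+ v) :+ (con 1 :+ k) := l :+ (w :+ (v :+ k)) :+ (con 1 :+ l)) refl
           (length s) (wt s) (length t) (wt t) ⟩
    length s ℕ.+ (wt s ℕ.+ (wt t ℕ.+ length t)) ℕ.+ suc (length s)
      ≡⟨ cong (λ k → length s ℕ.+ (wt s ℕ.+ k) ℕ.+ suc (length s)) (sym (wt-0∷ t)) ⟩
    length s ℕ.+ (wt s ℕ.+ wt (0 ∷ t)) ℕ.+ suc (length s) ∎
    where open +-*-Solver
  shift-energy (s , suc g ∷ t) = begin
    suc (length s) ℕ.+ (wt (0 ∷ s) ℕ.+ wt (g ∷ t)) ℕ.+ suc (length t)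
      ≡⟨ cong (λ k → suc (length s) ℕ.+ (k ℕ.+ wt (g ∷ t)) ℕ.+ suc (length t)) (wt-0∷ s) ⟩
    suc (length s) ℕ.+ (wt s ℕ.+ length s ℕ.+ wt (g ∷ t)) ℕ.+ suc (length t)
      ≡⟨ solve 4 (λ l w k v → (con 1 :+ l) :+ (w :+ l :+ v) :+ (con 1 :+ k)
           := l :+ (w :+ (v :+ (con 1 :+ k))) :+ (con 1 :+ l)) refl (length s) (wt s) (length t) (wt (g ∷ t)) ⟩
    length s ℕ.+ (wt s ℕ.+ (wt (g ∷ t) ℕ.+ suc (length t))) ℕ.+ suc (length s)
      ≡⟨ cong (λ k → length s ℕ.+ (wt s ℕ.+ k) ℕ.+ suc (length s)) (sym (wt-increment (g ∷ t))) ⟩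
    length s ℕ.+ (wt s ℕ.+ wt (suc g ∷ t)) ℕ.+ suc (length s) ∎
    where open +-*-Solver

  suc-⊖ : ∀ m n → suc m ⊖ n ≡ 1ℤ ℤ.+ (m ⊖ n)
  suc-⊖ m n = sym (ℤₚ.distribʳ-⊖-+-pos 1 m n)

  shift-charge : ∀ m → charge (shift m) ≡ 1ℤ ℤ.+ charge m
  shift-charge (s , [])        = suc-⊖ (length s) 0
  shift-charge (s , suc g ∷ t) = suc-⊖ (length s) (suc (length t))
  shift-charge (s , zero ∷ t)  = begin
    length (increment s) ⊖ length t    ≡⟨ cong (_⊖ length t) (length-increment s) ⟩
    length s ⊖ length t                ≡⟨ sym (ℤₚ.[1+m]⊖[1+n]≡m⊖n (length s) (length t)) ⟩
    suc (length s) ⊖ suc (length t)    ≡⟨ suc-⊖ (length s) (suc (length t)) ⟩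
    1ℤ ℤ.+ (length s ⊖ suc (length t)) ∎

  unshift-charge : ∀ m → charge (unshift m) ≡ -[1+ 0 ] ℤ.+ charge m
  unshift-charge m = begin
    charge (unshift m)                      ≡⟨ solve 1 (λ c → c := con -[1+ 0 ] :+ (con 1ℤ :+ c)) refl _ ⟩
    -[1+ 0 ] ℤ.+ (1ℤ ℤ.+ charge (unshift m)) ≡⟨ cong (λ k → -[1+ 0 ] ℤ.+ k) (sym (shift-charge (unshift m))) ⟩
    -[1+ 0 ] ℤ.+ charge (shift (unshift m)) ≡⟨ cong (λ k → -[1+ 0 ] ℤ.+ charge k) (shift-unshift m) ⟩
    -[1+ 0 ] ℤ.+ charge m                   ∎
    where open ℤ-Solver.+-*-Solver

  iterate : (Maya → Maya) → ℕ → Maya → Maya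
  iterate f zero    m = m
  iterate f (suc n) m = f (iterate f n m)

  iterate-suc : ∀ f n m → iterate f (suc n) m ≡ iterate f n (f m)
  iterate-suc f zero    m = refl
  iterate-suc f (suc n) m = cong f (iterate-suc f n m)

  iterate-inverse : ∀ {f g} → (∀ m → f (g m) ≡ m) → ∀ n m → iterate f n (iterate g n m) ≡ m
  iterate-inverse         fg zero    m = refl
  iterate-inverse {f} {g} fg (suc n) m = begin
    iterate f (suc n) (g (iterate g n m)) ≡⟨ iterate-suc f n _ ⟩
    iterate f n (f (g (iterate g n m)))   ≡⟨ cong (iterate f n) (fg _) ⟩
    iterate f n (iterate g n m)           ≡⟨ iterate-inverse fg n m ⟩
    m                                     ∎

  shiftBy : ℤ → Maya → Maya
  shiftBy (+ n)    = iterate shift n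
  shiftBy -[1+ n ] = iterate unshift (suc n)

  shiftBy-inverse : ∀ i m → shiftBy i (shiftBy (ℤ.- i) m) ≡ m
  shiftBy-inverse (+ zero)  m = refl
  shiftBy-inverse (+ suc n) m = iterate-inverse {shift} {unshift} shift-unshift (suc n) m
  shiftBy-inverse -[1+ n ]  m = iterate-inverse {unshift} {shift} unshift-shift (suc n) m

  shiftBy-charge : ∀ i m → charge (shiftBy i m) ≡ i ℤ.+ charge m
  shiftBy-charge (+ zero)  m = sym (ℤₚ.+-identityˡ _)
  shiftBy-charge (+ suc n) m = begin
    charge (shift (iterate shift n m)) ≡⟨ shift-charge (iterate shift n m) ⟩
    1ℤ ℤ.+ charge (iterate shift n m)  ≡⟨ cong (λ k → 1ℤ ℤ.+ k) (shiftBy-charge (+ n) m) ⟩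
    1ℤ ℤ.+ (+ n ℤ.+ charge m)          ≡⟨ sym (ℤₚ.+-assoc 1ℤ (+ n) (charge m)) ⟩
    + suc n ℤ.+ charge m               ∎
  shiftBy-charge -[1+ zero ]  m = unshift-charge m
  shiftBy-charge -[1+ suc n ] m = begin
    charge (unshift (iterate unshift (suc n) m))   ≡⟨ unshift-charge (iterate unshift (suc n) m) ⟩
    -[1+ 0 ] ℤ.+ charge (iterate unshift (suc n) m) ≡⟨ cong (λ k → -[1+ 0 ] ℤ.+ k) (shiftBy-charge -[1+ n ] m) ⟩
    -[1+ 0 ] ℤ.+ (-[1+ n ] ℤ.+ charge m)           ≡⟨ sym (ℤₚ.+-assoc -[1+ 0 ] -[1+ n ] (charge m)) ⟩
    -[1+ suc n ] ℤ.+ charge m                      ∎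

  ⊖-injective : ∀ {m n k} → m ⊖ n ≡ + k → m ≡ k ℕ.+ n
  ⊖-injective {m} {n} {k} e = ℤₚ.+-injective (begin
    + m                         ≡⟨ solve 2 (λ m n → m := (m :- n) :+ n) refl (+ m) (+ n) ⟩
    (+ m ℤ.- + n) ℤ.+ + n       ≡⟨ cong (ℤ._+ + n) (trans (ℤₚ.m-n≡m⊖n m n) e) ⟩
    + (k ℕ.+ n)                 ∎)
    where open ℤ-Solver.+-*-Solver

  -- From charge zero, successive shifts upwards cost 1, 2, 3, ... and successive shifts downwards
  -- cost 0, 1, 2, ...; the partial sums are the triangular numbers of `T`.
  shiftBy-energy : ∀ i m → charge m ≡ 0ℤ → energy (shiftBy i m) ≡ T i ℕ.+ energy m
  shiftBy-energy (+ zero)  m c = refl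
  shiftBy-energy (+ suc n) m c = ℕₚ.+-cancelʳ-≡ (length (proj₂ m′)) _ _ (begin
    energy (shift m′) ℕ.+ length (proj₂ m′)   ≡⟨ shift-energy m′ ⟩
    energy m′ ℕ.+ suc (length (proj₁ m′))     ≡⟨ cong₂ (λ a b → a ℕ.+ suc b) (shiftBy-energy (+ n) m c)
      (⊖-injective charge′) ⟩
    triangle n ℕ.+ energy m ℕ.+ suc (n ℕ.+ length (proj₂ m′))
      ≡⟨ solve 4 (λ t e n l → t :+ e :+ (con 1 :+ (n :+ l)) := (con 1 :+ n) :+ t :+ e :+ l) refl (triangle n) (energy m)
        n _ ⟩
    suc n ℕ.+ triangle n ℕ.+ energy m ℕ.+ length (proj₂ m′) ∎)
    where
    open +-*-Solver
    m′ = iterate shift n m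
    charge′ : charge m′ ≡ + n
    charge′ = trans (shiftBy-charge (+ n) m) (trans (cong (λ k → + n ℤ.+ k) c) (ℤₚ.+-identityʳ (+ n)))
  shiftBy-energy -[1+ n ] m c = ℕₚ.+-cancelʳ-≡ (suc (length (proj₁ m′))) _ _ (begin
    energy m′ ℕ.+ suc (length (proj₁ m′))   ≡⟨ sym (shift-energy m′) ⟩
    energy (shift m′) ℕ.+ length (proj₂ m′) ≡⟨ cong₂ (λ a b → energy a ℕ.+ b) (shift-unshift (iterate unshift n m))
      length₂ ⟩
    energy (iterate unshift n m) ℕ.+ (suc n ℕ.+ length (proj₁ m′)) ≡⟨ previous n ⟩
    triangle n ℕ.+ energy m ℕ.+ suc (length (proj₁ m′)) ∎)
    where
    open +-*-Solver
    m′ = shiftBy -[1+ n ] m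
    charge′ : charge m′ ≡ -[1+ n ]
    charge′ = trans (shiftBy-charge -[1+ n ] m) (cong (λ k → -[1+ n ] ℤ.+ k) c)
    length₂ : length (proj₂ m′) ≡ suc n ℕ.+ length (proj₁ m′)
    length₂ = ⊖-injective (trans (ℤₚ.⊖-swap (length (proj₂ m′)) (length (proj₁ m′))) (cong ℤ.-_ charge′))
    previous : ∀ k → energy (iterate unshift k m) ℕ.+ (suc k ℕ.+ length (proj₁ m′)) ≡
      triangle k ℕ.+ energy m ℕ.+ suc (length (proj₁ m′))
    previous zero    = refl
    previous (suc k) = trans
      (cong (ℕ._+ (suc (suc k) ℕ.+ length (proj₁ m′))) (shiftBy-energy -[1+ k ] m c))
      (solve 4 (λ t e k l → t :+ e :+ (con 2 :+ k :+ l) := (con 1 :+ k) :+ t :+ e :+ (con 1 :+ l)) refl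
        (triangle k) (energy m) k (length (proj₁ m′)))

  -- A diagram amounts to its charge together with this neutral diagram, which is the bijective form
  -- of Jacobi's triple product.
  normalise : Maya → Maya
  normalise m = shiftBy (ℤ.- charge m) m

  normalise-charge : ∀ m → charge (normalise m) ≡ 0ℤ
  normalise-charge m = trans (shiftBy-charge (ℤ.- charge m) m) (ℤₚ.+-inverseˡ (charge m))

  normalise-energy : ∀ m → T (charge m) ℕ.+ energy (normalise m) ≡ energy m
  normalise-energy m = trans (sym (shiftBy-energy (charge m) (normalise m) (normalise-charge m)))
    (cong energy (shiftBy-inverse (charge m) m))

  normalise-shiftBy : ∀ i m → charge m ≡ 0ℤ → (charge (shiftBy i m) , normalise (shiftBy i m)) ≡ (i , m)
  normalise-shiftBy i m c = cong₂ _,_ charge≡i (begin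
    shiftBy (ℤ.- charge (shiftBy i m)) (shiftBy i m)
      ≡⟨ cong (λ k → shiftBy (ℤ.- k) (shiftBy i m)) charge≡i ⟩
    shiftBy (ℤ.- i) (shiftBy i m)
      ≡⟨ cong (λ k → shiftBy (ℤ.- i) (shiftBy k m)) (sym (ℤₚ.neg-involutive i)) ⟩
    shiftBy (ℤ.- i) (shiftBy (ℤ.- (ℤ.- i)) m)
      ≡⟨ shiftBy-inverse (ℤ.- i) m ⟩
    m ∎)
    where
    charge≡i : charge (shiftBy i m) ≡ i
    charge≡i = trans (shiftBy-charge i m) (trans (cong (λ k → i ℤ.+ k) c) (ℤₚ.+-identityʳ i))

-- Infinite products and their functional equations

module Products (R : CommutativeRing 0ℓ 0ℓ) where

  open import Data.Nat as ℕ using (ℕ; zero; suc; s≤s)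
  import Data.Nat.Properties as ℕₚ
  open import Data.Integer using (+_)
  open import Data.Fin using (Fin; zero; suc)
  open import Data.Unit using (⊤; tt)
  import Data.Unit.Properties as ⊤ₚ
  open import Data.List using ([]; _∷_; length)
  open import Data.List.Relation.Unary.Any using (here)
  open import Data.Product using (_×_; _,_; proj₂)
  open import Data.Sum using (_⊎_; inj₁; inj₂)
  open import Function using (_∘_)
  open import Relation.Nullary using (yes; no)
  open import Relation.Binary.PropositionalEquality as ≡ using (_≡_)
  open Grading
  open Maya
  open GenFun R public
  open import Algebra.Properties.Semiring.Exp semiring using (_^_) public
  open import Algebra.Solver.Ring.NaturalCoefficients.Default commutativeSemiring using (solve; _:=_; _:*_)

  module S₂ = CommutativeRing PS.seriesRing

  unit : Graded {⊤} (λ _ → 0)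
  unit = fromCover ⊤ₚ._≟_ (λ _ → tt ∷ []) (λ _ → here ≡.refl)

  gf-unit : ∀ x → gf unit (λ _ → x) ≋ term x 0
  gf-unit x n = +-identityʳ _

  conv-mono-below : ∀ a X {k} → k ℕ.< a → conv (mono a) X k ≈ 0#
  conv-mono-below (suc a) X {zero}  lt = zeroˡ _
  conv-mono-below (suc a) X {suc k} lt = trans (conv-mono-suc a X k) (conv-mono-below a X (ℕ.s≤s⁻¹ lt))

  module _ {I : Set} {w size : I → ℕ} (g : Graded w) where

    gf₂-monomial : ∀ x a χ → gf₂ g (λ i → a ℕ.+ size i) (λ i → x * χ i) PS.≋ PS.conv (term₂ x a 0) (gf₂ g size χ)
    gf₂-monomial x a χ s = S.trans
      (S.sym (reindex (unit ⊗ g) g proj₂ (tt ,_) (λ _ → ≡.refl) (λ _ → inj₁ ≡.refl) (λ _ → ≡.refl) (λ _ → refl)))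
      (S.trans (gf₂-⊗ unit g (λ _ → a) size (λ _ → x) χ s)
        (PS.conv-cong (λ t → gf-unit (x * mono a t)) (λ t → S.refl) s))

  -- dilate N X = X(u qᴺ), for a series X in u over the series in q.
  dilate : ℕ → PS.Series → PS.Series
  dilate N X s = conv (mono (s ℕ.* N)) (X s)

  dilate-conv : ∀ N X Y → dilate N (PS.conv X Y) PS.≋ PS.conv (dilate N X) (dilate N Y)
  dilate-conv N X Y n = S.sym (general 0 X n)
    where
    c : ℕ → Series
    c k = mono (k ℕ.* N)
    c-+ : ∀ a b → conv (c a) (c b) ≋ c (a ℕ.+ b)
    c-+ a b = S.trans (conv-mono (a ℕ.* N) (b ℕ.* N)) (λ k → ≡⇒≈ (≡.cong (λ m → mono m k) (≡.sym (ℕₚ.*-distribʳ-+ N a b))))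
    regroup : ∀ a b x y → conv (conv (c a) x) (conv (c b) y) ≋ conv (c (a ℕ.+ b)) (conv x y)
    regroup a b x y = S.trans
      (solve′ 4 (λ p q x y → (p :*′ x) :*′ (q :*′ y) :=′ (p :*′ q) :*′ (x :*′ y)) S.refl (c a) (c b) x y)
      (conv-cong (c-+ a b) S.refl)
      where open import Algebra.Solver.Ring.NaturalCoefficients.Default S.commutativeSemiring
              using () renaming (solve to solve′; _:=_ to _:=′_; _:*_ to _:*′_)
    -- The offset `a` counts the coefficients of `X` already split off by the recursion of the
    -- convolution; `dilate` itself is the case of offset 0.
    general : ∀ a X n → PS.conv (λ k → conv (c (a ℕ.+ k)) (X k)) (dilate N Y) n ≋ conv (c (a ℕ.+ n)) (PS.conv X Y n)
    general a X zero    = S.trans (regroup (a ℕ.+ 0) 0 (X 0) (Y 0))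
      (λ k → ≡⇒≈ (≡.cong (λ m → conv (c m) (conv (X 0) (Y 0)) k) (ℕₚ.+-identityʳ (a ℕ.+ 0))))
    general a X (suc n) = S.trans (S.+-cong
        (S.trans (regroup (a ℕ.+ 0) (suc n) (X 0) (Y (suc n)))
          (λ k → ≡⇒≈ (≡.cong (λ m → conv (c (m ℕ.+ suc n)) (conv (X 0) (Y (suc n))) k) (ℕₚ.+-identityʳ a))))
        (S.trans (PS.conv-cong {λ k → conv (c (a ℕ.+ suc k)) (X (suc k))} {λ k → conv (c (suc a ℕ.+ k)) (X (suc k))}
          {dilate N Y} {dilate N Y}
                   (λ k j → ≡⇒≈ (≡.cong (λ m → conv (c m) (X (suc k)) j) (ℕₚ.+-suc a k))) (λ k → S.refl) n)
          (S.trans (general (suc a) (λ k → X (suc k)) n)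
            (λ k → ≡⇒≈ (≡.cong (λ m → conv (c m) (PS.conv (λ k → X (suc k)) Y n) k) (≡.sym (ℕₚ.+-suc a n)))))))
      (S.sym (conv-distribˡ (c (a ℕ.+ suc n)) (conv (X 0) (Y (suc n))) (PS.conv (λ k → X (suc k)) Y n)))

  dilate-cong : ∀ N {X Y} → X PS.≋ Y → dilate N X PS.≋ dilate N Y
  dilate-cong N e s = conv-cong S.refl (e s)

  dilate-1+ : ∀ N X → dilate N (PS._⊕_ PS.𝟏 X) PS.≋ PS._⊕_ PS.𝟏 (dilate N X)
  dilate-1+ N X zero    = S.trans (conv-distribˡ 𝟏 𝟏 (X 0)) (S.+-cong (conv-identityˡ 𝟏) S.refl)
  dilate-1+ N X (suc s) = S.trans (conv-cong S.refl (S.+-identityˡ (X (suc s)))) (S.sym (S.+-identityˡ _))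

  dilate-term₂ : ∀ N x a b → dilate N (term₂ x a b) PS.≋ term₂ x a (a ℕ.* N ℕ.+ b)
  dilate-term₂ N x a b s n = trans (trans (conv-cong (λ k → sym (*-identityˡ (mono (s ℕ.* N) k))) (λ k → refl) n)
      (conv-term 1# (x * mono a s) (s ℕ.* N) b n)) (trans (*-congʳ (*-identityˡ _)) compare)
    where
    compare : x * mono a s * mono (s ℕ.* N ℕ.+ b) n ≈ x * mono a s * mono (a ℕ.* N ℕ.+ b) n
    compare with a ℕ.≟ s
    ... | yes ≡.refl = refl
    ... | no a≢s     = trans (*-congʳ z) (trans (zeroˡ _) (sym (trans (*-congʳ z) (zeroˡ _))))
      where z = trans (*-congˡ (mono-off a≢s)) (zeroʳ x)

  dilate-dilate : ∀ N M X → dilate N (dilate M X) PS.≋ dilate (N ℕ.+ M) X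
  dilate-dilate N M X s = S.trans (S.sym (S.*-assoc (mono (s ℕ.* N)) (mono (s ℕ.* M)) (X s)))
    (conv-cong (S.trans (conv-mono (s ℕ.* N) (s ℕ.* M))
      (λ k → ≡⇒≈ (≡.cong (λ m → mono m k) (≡.sym (ℕₚ.*-distribˡ-+ s N M))))) S.refl)

  module _ {I : Set} {w size : I → ℕ} (g : Graded w) (h : Graded (λ i → size i ℕ.+ w i)) (χ : I → Carrier) where

    -- Only indices of size `s` contribute to the coefficient of uˢ, so adding the size to the
    -- weight multiplies that coefficient by qˢ.
    gf₂-dilate : gf₂ h size χ PS.≋ dilate 1 (gf₂ g size χ)
    gf₂-dilate s = S.trans step (λ n → conv-cong (λ k → ≡⇒≈ (≡.cong (λ m → mono m k) (≡.sym (ℕₚ.*-identityʳ s))))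
      (λ k → refl) n)
      where
      step : gf h (λ i → χ i * mono (size i) s) ≋ conv (mono s) (gf g (λ i → χ i * mono (size i) s))
      step n = trans
        (gf-by h _ (Graded.unique g n) (λ i e → Graded.covers g (ℕₚ.≤-trans (ℕₚ.m≤n+m (w i) (size i)) (ℕₚ.≤-reflexive e))))
        (trans (∑-cong (Graded.cover g n) compare)
          (trans (sym (gf-by h′ _ (Graded.unique g n)
            (λ i e → Graded.covers g (ℕₚ.≤-trans (ℕₚ.m≤n+m (w i) s) (ℕₚ.≤-reflexive e)))))
            (gf-shift g h′ s {λ i → χ i * mono (size i) s} (λ _ → ≡.refl) (λ _ → refl) n)))
        where
        h′ : Graded (λ i → s ℕ.+ w i)
        h′ = dominate g (λ i → ℕₚ.m≤n+m (w i) s)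
        compare : ∀ i → term (χ i * mono (size i) s) (size i ℕ.+ w i) n ≈ term (χ i * mono (size i) s) (s ℕ.+ w i) n
        compare i with size i ℕ.≟ s
        ... | yes e = *-congˡ (≡⇒≈ (≡.cong (λ m → mono (m ℕ.+ w i) n) e))
        ... | no ne = trans (*-congʳ z) (trans (zeroˡ _) (sym (trans (*-congʳ z) (zeroˡ _))))
          where z = trans (*-congˡ (mono-off ne)) (zeroʳ (χ i))

  gradedMultiple : ∀ {I : Set} {w : I → ℕ} d → Graded w → Graded (λ i → suc d ℕ.* w i)
  gradedMultiple d g = dominate g (λ i → ℕₚ.m≤m+n _ _)

  -- P d η = ∏_{n ≥ 0} (1 + η uᵈ qᵈⁿ), with d shifted by one.
  P : ℕ → Carrier → PS.Series
  P d η = gf₂ (gradedMultiple d gradedSubset) (λ s → suc d ℕ.* length s) (λ s → η ^ length s)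

  factor : Carrier → ℕ → ℕ → PS.Series
  factor x a b = PS._⊕_ PS.𝟏 (term₂ x a b)

  -- The factor n = 0 is split off: a subset either omits 0 and is the translate of another one, or
  -- it contains 0 and the rest is such a translate.
  P-functional : ∀ d η → P d η PS.≋ PS.conv (factor η (suc d) 0) (dilate 1 (P d η))
  P-functional d η = S₂.trans split (S₂.trans (S₂.+-cong left right)
    (S₂.sym (S₂.trans (S₂.distribʳ (dilate 1 (P d η)) PS.𝟏 (term₂ η (suc d) 0))
      (S₂.+-cong (S₂.*-identityˡ (dilate 1 (P d η))) S₂.refl))))
    where
    D = suc d
    g = gradedMultiple d gradedSubset
    size : Subset → ℕ
    size s = D ℕ.* length s
    h : Graded (λ s → size s ℕ.+ D ℕ.* wt s)
    h = dominate g (λ s → ℕₚ.m≤n+m _ (size s))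
    add : Fin 2 × Subset → Subset
    add (zero , s)  = increment s
    add (suc _ , s) = 0 ∷ s
    remove : Subset → Fin 2 × Subset
    remove []          = zero , []
    remove (zero ∷ s)  = suc zero , s
    remove (suc g ∷ s) = zero , g ∷ s
    remove-add : ∀ p → remove (add p) ≡ p
    remove-add (zero , [])         = ≡.refl
    remove-add (zero , g ∷ s)      = ≡.refl
    remove-add (suc zero , s)      = ≡.refl
    add-remove : ∀ s → add (remove s) ≡ s
    add-remove []          = ≡.refl
    add-remove (zero ∷ s)  = ≡.refl
    add-remove (suc g ∷ s) = ≡.refl
    distribute : ∀ s {k} → k ≡ wt s ℕ.+ length s → D ℕ.* k ≡ size s ℕ.+ D ℕ.* wt s
    distribute s e = ≡.trans (≡.cong (D ℕ.*_) (≡.trans e (ℕₚ.+-comm (wt s) (length s))))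
      (ℕₚ.*-distribˡ-+ D (length s) (wt s))
    weights : ∀ p → D ℕ.* wt (add p) ≡ size (proj₂ p) ℕ.+ D ℕ.* wt (proj₂ p)
    weights (zero , s)     = distribute s (wt-increment s)
    weights (suc zero , s) = distribute s (wt-0∷ s)
    χ : ℕ → Fin 2 × Subset → Carrier
    χ t (zero , s)  = η ^ length s * mono (size s) t
    χ t (suc _ , s) = η * η ^ length s * mono (D ℕ.+ size s) t
    characters : ∀ t p → η ^ length (add p) * mono (size (add p)) t ≈ χ t p
    characters t (zero , s)     = ≡⇒≈ (≡.cong (λ l → η ^ l * mono (D ℕ.* l) t) (length-increment s))
    characters t (suc zero , s) = *-congˡ (≡⇒≈ (≡.cong (λ k → mono k t) (ℕₚ.*-suc D (length s))))
    split : P d η PS.≋ PS._⊕_ (gf₂ h size (λ s → η ^ length s)) (gf₂ h (λ s → D ℕ.+ size s) (λ s → η * η ^ length s))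
    layers : Graded (λ ((k , s) : Fin 2 × Subset) → size s ℕ.+ D ℕ.* wt s)
    layers = dominate (pullback add remove remove-add g) (ℕₚ.≤-reflexive ∘ weights)
    split t = S.trans
      (S.sym (reindex layers g {χ t} add remove remove-add (inj₁ ∘ add-remove) weights (characters t)))
      (S.trans (gf-fibres (Graded._≟_ g) (finite 2) layers (λ _ → h) (χ t)) (λ n → +-cong refl (+-identityʳ _)))
    left : gf₂ h size (λ s → η ^ length s) PS.≋ dilate 1 (P d η)
    left = gf₂-dilate {size = size} g h (λ s → η ^ length s)
    right : gf₂ h (λ s → D ℕ.+ size s) (λ s → η * η ^ length s) PS.≋ PS.conv (term₂ η D 0) (dilate 1 (P d η))
    right = S₂.trans (gf₂-monomial h η D (λ s → η ^ length s)) (S₂.*-cong (S₂.refl {term₂ η D 0}) left)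

  P-constant : ∀ d η → P d η 0 ≋ 𝟏
  P-constant d η = S.trans
    (S.sym (reindex unit (gradedMultiple d gradedSubset) {λ _ → 1#} (λ _ → []) (λ _ → tt) (λ _ → ≡.refl) only
      (λ _ → ℕₚ.*-zeroʳ (suc d)) (λ _ → trans (*-congˡ (≡⇒≈ (≡.cong (λ k → mono k 0) (ℕₚ.*-zeroʳ (suc d)))))
        (*-identityˡ 1#))))
    (S.trans (gf-unit 1#) (λ n → *-identityˡ _))
    where
    only : ∀ s → [] ≡ s ⊎ η ^ length s * mono (suc d ℕ.* length s) 0 ≈ 0#
    only []      = inj₁ ≡.refl
    only (g ∷ s) = inj₂ (zeroʳ _)

  -- As F has constant term 1, the coefficient of uˢ⁺¹ satisfies X = qˢ⁺¹ X + E with E determined by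
  -- earlier coefficients. Multiplication by qˢ⁺¹ refers only to lower exponents of q, so induction
  -- on that exponent determines X.
  functional-unique : ∀ {F X Y} → F 0 ≋ 𝟏 → X 0 ≋ Y 0 →
    X PS.≋ PS.conv F (dilate 1 X) → Y PS.≋ PS.conv F (dilate 1 Y) → X PS.≋ Y
  functional-unique {F} {X} {Y} F₀ X₀ fX fY s = upTo s s ℕₚ.≤-refl
    where
    module _ {s : ℕ} {A B E E′ : Series} (e : E ≋ E′)
      (fA : A ≋ (conv (mono (suc s)) A ⊕ E)) (fB : B ≋ (conv (mono (suc s)) B ⊕ E′)) where
      cancel : ∀ n → A ≋[ n ] B
      cancel zero zero k≤n = trans (fA 0) (trans (+-cong (trans (zeroˡ _) (sym (zeroˡ _))) (e 0)) (sym (fB 0)))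
      cancel (suc n) k k≤ with ℕₚ.m≤n⇒m<n∨m≡n k≤
      ... | inj₁ k<      = cancel n k (ℕ.s≤s⁻¹ k<)
      ... | inj₂ ≡.refl = trans (fA (suc n)) (trans (+-cong
          (trans (conv-mono-suc s A n) (trans (conv-cong[] n (λ _ _ → refl) (cancel n) n ℕₚ.≤-refl)
            (sym (conv-mono-suc s B n))))
          (e (suc n))) (sym (fB (suc n))))
    unfold : ∀ Z s → Z PS.≋ PS.conv F (dilate 1 Z) →
      Z (suc s) ≋ (conv (mono (suc s)) (Z (suc s)) ⊕ PS.conv (PS.tail F) (dilate 1 Z) s)
    unfold Z s fZ = S.trans (fZ (suc s)) (S.+-cong (S.trans (conv-cong F₀ S.refl) (S.trans (conv-identityˡ _)
      (conv-cong (λ k → ≡⇒≈ (≡.cong (λ m → mono m k) (ℕₚ.*-identityʳ (suc s)))) S.refl))) S.refl)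
    upTo : ∀ s k → k ℕ.≤ s → X k ≋ Y k
    upTo zero    zero k≤ = X₀
    upTo (suc s) k k≤ with ℕₚ.m≤n⇒m<n∨m≡n k≤
    ... | inj₁ k<     = upTo s k (ℕ.s≤s⁻¹ k<)
    ... | inj₂ ≡.refl = λ n → cancel
      (PS.conv-cong[] s (λ k _ → S.refl) (λ k k≤s → conv-cong S.refl (upTo s k k≤s)) s ℕₚ.≤-refl)
      (unfold X s fX) (unfold Y s fY) n n ℕₚ.≤-refl

  finiteProduct : ℕ → PS.Series
  finiteProduct zero    = PS.𝟏
  finiteProduct (suc N) = PS.conv (finiteProduct N) (factor 1# 1 N)

  P-factor : ∀ N → P 0 1# PS.≋ PS.conv (finiteProduct N) (dilate N (P 0 1#))
  P-factor zero = S₂.sym (S₂.trans (S₂.*-identityˡ (dilate 0 (P 0 1#)))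
    (λ s → S.trans (conv-cong (λ k → ≡⇒≈ (≡.cong (λ m → mono m k) (ℕₚ.*-zeroʳ s))) S.refl) (conv-identityˡ _)))
  P-factor (suc N) = S₂.trans (P-factor N)
    (S₂.trans (S₂.*-cong (S₂.refl {finiteProduct N}) step)
      (S₂.sym (S₂.*-assoc (finiteProduct N) (factor 1# 1 N) (dilate (suc N) (P 0 1#)))))
    where
    step : dilate N (P 0 1#) PS.≋ PS.conv (factor 1# 1 N) (dilate (suc N) (P 0 1#))
    step = S₂.trans (dilate-cong N (P-functional 0 1#))
      (S₂.trans (dilate-conv N (factor 1# 1 0) (dilate 1 (P 0 1#)))
        (S₂.*-cong
          (S₂.trans (dilate-1+ N (term₂ 1# 1 0)) (S₂.+-cong (S₂.refl {PS.𝟏})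
            (S₂.trans (dilate-term₂ N 1# 1 0) (λ s k → ≡⇒≈ (≡.cong (λ m → term₂ 1# 1 m s k)
              (≡.trans (ℕₚ.+-identityʳ (1 ℕ.* N)) (ℕₚ.*-identityˡ N)))))))
          (S₂.trans (dilate-dilate N 1 (P 0 1#)) (λ s k → ≡⇒≈ (≡.cong (λ m → dilate m (P 0 1#) s k) (ℕₚ.+-comm N 1))))))

  -- The remaining factors form the same product with u replaced by u qⁿ⁺¹; up to the exponent `n`
  -- of q that product is 1.
  P-truncate : ∀ n s → P 0 1# s ≋[ n ] finiteProduct (suc n) s
  P-truncate n s k k≤n = trans (P-factor (suc n) s k) (trans
    (PS.conv-congruence (λ X Y → X ≋[ n ] Y) (λ e f j l → +-cong (e j l) (f j l)) (conv-cong[] n) s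
      (λ _ _ _ _ → refl) (λ t _ → small t) k k≤n)
    (S₂.*-identityʳ (finiteProduct (suc n)) s k))
    where
    small : ∀ t → dilate (suc n) (P 0 1#) t ≋[ n ] PS.𝟏 t
    small zero    j j≤n = trans (conv-identityˡ _ j) (P-constant 0 1# j)
    small (suc t) j j≤n = conv-mono-below (suc t ℕ.* suc n) _ (ℕₚ.≤-trans (s≤s j≤n) (ℕₚ.m≤m+n (suc n) _))

-- Triples, 3 × 3 matrices and cube roots of unity

module Cubes where

  open import Data.Nat as ℕ using (ℕ)
  import Data.Nat.Solver as ℕ-Solver
  open import Data.Integer as ℤ using (ℤ)
  open import Data.Product using (_×_; _,_)
  open import Relation.Binary.PropositionalEquality as ≡ using (_≡_)
  open Grading

  Cube : Set → Set
  Cube A = A × A × A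

  cubeMap : {A B : Set} → (A → B) → Cube A → Cube B
  cubeMap f (a , b , c) = f a , f b , f c

  cubeSum : {A : Set} → (A → ℕ) → Cube A → ℕ
  cubeSum f (a , b , c) = f a ℕ.+ (f b ℕ.+ f c)

  total : Cube ℤ → ℤ
  total (a , b , c) = a ℤ.+ (b ℤ.+ c)

  cubeGraded : {A : Set} {w : A → ℕ} → Graded w → Graded (cubeSum w)
  cubeGraded g = g ⊗ (g ⊗ g)

  zipCube : {A B : Set} → Cube A × Cube B → Cube (A × B)
  zipCube ((a , b , c) , (x , y , z)) = (a , x) , (b , y) , (c , z)

  unzipCube : {A B : Set} → Cube (A × B) → Cube A × Cube B
  unzipCube ((a , x) , (b , y) , (c , z)) = (a , b , c) , (x , y , z)

  cubeSum-cong : ∀ {A : Set} {f g : A → ℕ} → (∀ a → f a ≡ g a) → ∀ c → cubeSum f c ≡ cubeSum g c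
  cubeSum-cong e (a , b , c) = ≡.cong₂ ℕ._+_ (e a) (≡.cong₂ ℕ._+_ (e b) (e c))

  cubeSum-+ : ∀ {A : Set} (f g h : A → ℕ) c →
    cubeSum (λ a → f a ℕ.+ (g a ℕ.+ h a)) c ≡ cubeSum f c ℕ.+ (cubeSum g c ℕ.+ cubeSum h c)
  cubeSum-+ f g h (a , b , c) = solveℕ 9
    (λ a b c x y z u v w → (a ⊹ (x ⊹ u)) ⊹ ((b ⊹ (y ⊹ v)) ⊹ (c ⊹ (z ⊹ w))) ≔ (a ⊹ (b ⊹ c)) ⊹
      ((x ⊹ (y ⊹ z)) ⊹ (u ⊹ (v ⊹ w))))
    ≡.refl (f a) (f b) (f c) (g a) (g b) (g c) (h a) (h b) (h c)
    where open ℕ-Solver.+-*-Solver using () renaming (solve to solveℕ; _:+_ to _⊹_; _:=_ to _≔_)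

-- Freedom from 3-torsion turns x = ω x into x = 0, which makes the twisted sums over the nontrivial
-- cosets vanish.
record CubeRoot (R : CommutativeRing 0ℓ 0ℓ) : Set where
  open CommutativeRing R
  field
    ω            : Carrier
    ω-root       : 1# + (ω + ω * ω) ≈ 0#
    torsion-free : ∀ x → x + (x + x) ≈ 0# → x ≈ 0#

-- Charges, characters of order three and the triple product

module Charges (R : CommutativeRing 0ℓ 0ℓ) (ζ : CubeRoot R) where

  open import Data.Nat as ℕ using (ℕ; zero; suc)
  import Data.Nat.Properties as ℕₚ
  import Data.Nat.Solver as ℕ-Solver
  open import Data.Integer as ℤ using (ℤ; +_; -[1+_]; _⊖_; 0ℤ)
  import Data.Integer.Properties as ℤₚ
  import Data.Integer.Solver as ℤ-Solver
  open import Data.List using (length)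
  open import Data.Product using (_×_; _,_; proj₁; proj₂)
  open import Data.Sum using (_⊎_; inj₁; inj₂)
  open import Relation.Nullary using (yes; no)
  open import Relation.Binary.PropositionalEquality as ≡ using (_≡_)
  open Grading
  open Maya
  open Cubes
  open Products R public
  open CubeRoot ζ public
  open import Algebra.Properties.Ring ring using (+-cancelʳ)
  open import Algebra.Properties.Semiring.Exp semiring using (^-homo-*)
  open import Algebra.Solver.Ring.NaturalCoefficients.Default commutativeSemiring using (solve; _:=_; _:+_; _:*_; con)
  open import Relation.Binary.Reasoning.Setoid setoid

  ω̄ : Carrier
  ω̄ = ω * ω

  ω-cube : ω * ω̄ ≈ 1#
  ω-cube = +-cancelʳ (ω + ω̄) _ _ (begin
    ω * ω̄ + (ω + ω̄)   ≈⟨ solve 1 (λ w → w :* (w :* w) :+ (w :+ w :* w) := w :* (con 1 :+ (w :+ w :* w))) refl ω ⟩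
    ω * (1# + (ω + ω̄)) ≈⟨ trans (*-congˡ ω-root) (zeroʳ ω) ⟩
    0#                 ≈⟨ sym ω-root ⟩
    1# + (ω + ω̄)      ∎)

  ω̄-square : ω̄ * ω̄ ≈ ω
  ω̄-square = trans (*-assoc ω ω ω̄) (trans (*-congˡ ω-cube) (*-identityʳ ω))

  ω-power : ℤ → Carrier
  ω-power (+ n)    = ω ^ n
  ω-power -[1+ n ] = ω̄ ^ suc n

  ω-power-⊖ : ∀ m n → ω-power (m ⊖ n) ≈ ω ^ m * ω̄ ^ n
  ω-power-⊖ zero    zero    = sym (*-identityˡ 1#)
  ω-power-⊖ zero    (suc n) = sym (*-identityˡ _)
  ω-power-⊖ (suc m) zero    = sym (*-identityʳ _)
  ω-power-⊖ (suc m) (suc n) = begin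
    ω-power (suc m ⊖ suc n)      ≈⟨ ≡⇒≈ (≡.cong ω-power (ℤₚ.[1+m]⊖[1+n]≡m⊖n m n)) ⟩
    ω-power (m ⊖ n)              ≈⟨ ω-power-⊖ m n ⟩
    ω ^ m * ω̄ ^ n                ≈⟨ sym (*-identityˡ _) ⟩
    1# * (ω ^ m * ω̄ ^ n)         ≈⟨ *-congʳ (sym ω-cube) ⟩
    (ω * ω̄) * (ω ^ m * ω̄ ^ n)
      ≈⟨ solve 4 (λ a b c d → (a :* b) :* (c :* d) := (a :* c) :* (b :* d)) refl ω ω̄ (ω ^ m) (ω̄ ^ n) ⟩
    ω ^ suc m * ω̄ ^ suc n        ∎

  ⊖-+ : ∀ a b c d → (a ⊖ b) ℤ.+ (c ⊖ d) ≡ (a ℕ.+ c) ⊖ (b ℕ.+ d)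
  ⊖-+ a b c d = ≡.trans (≡.cong₂ ℤ._+_ (≡.sym (ℤₚ.m-n≡m⊖n a b)) (≡.sym (ℤₚ.m-n≡m⊖n c d)))
    (≡.trans (solveℤ 4 (λ a b c d → (a :- b) ⊹ (c :- d) ≔ (a ⊹ c) :- (b ⊹ d)) ≡.refl (+ a) (+ b) (+ c) (+ d))
      (ℤₚ.m-n≡m⊖n (a ℕ.+ c) (b ℕ.+ d)))
    where open ℤ-Solver.+-*-Solver using (_:-_) renaming (solve to solveℤ; _:+_ to _⊹_; _:=_ to _≔_)

  positive negative : ℤ → ℕ
  positive (+ n)    = n
  positive -[1+ n ] = 0
  negative (+ n)    = 0
  negative -[1+ n ] = suc n

  positive-negative : ∀ i → positive i ⊖ negative i ≡ i
  positive-negative (+ n)    = ≡.refl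
  positive-negative -[1+ n ] = ≡.refl

  ω-power-+ : ∀ i j → ω-power (i ℤ.+ j) ≈ ω-power i * ω-power j
  ω-power-+ i j = begin
    ω-power (i ℤ.+ j)
      ≈⟨ ≡⇒≈ (≡.cong ω-power (≡.trans (≡.sym (≡.cong₂ ℤ._+_ (positive-negative i) (positive-negative j))) (⊖-+ a b c d))) ⟩
    ω-power ((a ℕ.+ c) ⊖ (b ℕ.+ d))
      ≈⟨ ω-power-⊖ (a ℕ.+ c) (b ℕ.+ d) ⟩
    ω ^ (a ℕ.+ c) * ω̄ ^ (b ℕ.+ d)
      ≈⟨ *-cong (^-homo-* ω a c) (^-homo-* ω̄ b d) ⟩
    (ω ^ a * ω ^ c) * (ω̄ ^ b * ω̄ ^ d)
      ≈⟨ solve 4 (λ a b c d → (a :* c) :* (b :* d) := (a :* b) :* (c :* d)) refl _ _ _ _ ⟩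
    (ω ^ a * ω̄ ^ b) * (ω ^ c * ω̄ ^ d)
      ≈⟨ sym (*-cong (ω-power-⊖ a b) (ω-power-⊖ c d)) ⟩
    ω-power (a ⊖ b) * ω-power (c ⊖ d)
      ≈⟨ ≡⇒≈ (≡.cong₂ (λ x y → ω-power x * ω-power y) (positive-negative i) (positive-negative j)) ⟩
    ω-power i * ω-power j ∎
    where
    a = positive i
    b = negative i
    c = positive j
    d = negative j

  cube : Series → Series
  cube X = conv X (conv X X)

  cube₂ : PS.Series → PS.Series
  cube₂ X = PS.conv X (PS.conv X X)

  gf-cube : ∀ {A : Set} {w : A → ℕ} (g : Graded w) (χ₁ χ₂ χ₃ : A → Carrier) →
    gf (cubeGraded g) (λ (a , b , c) → χ₁ a * (χ₂ b * χ₃ c)) ≋ conv (gf g χ₁) (conv (gf g χ₂) (gf g χ₃))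
  gf-cube g χ₁ χ₂ χ₃ = S.trans (gf-⊗ g (g ⊗ g) χ₁ (λ (b , c) → χ₂ b * χ₃ c)) (conv-cong S.refl (gf-⊗ g g χ₂ χ₃))

  gf₂-cube : ∀ {A : Set} {w : A → ℕ} (g : Graded w) (size : A → ℕ) (χ₁ χ₂ χ₃ : A → Carrier) →
    gf₂ (cubeGraded g) (cubeSum size) (λ (a , b , c) → χ₁ a * (χ₂ b * χ₃ c)) PS.≋
    PS.conv (gf₂ g size χ₁) (PS.conv (gf₂ g size χ₂) (gf₂ g size χ₃))
  gf₂-cube g size χ₁ χ₂ χ₃ = S₂.trans (gf₂-⊗ g (g ⊗ g) size (λ (b , c) → size b ℕ.+ size c) χ₁ (λ (b , c) → χ₂ b * χ₃ c))
    (S₂.*-cong (S₂.refl {gf₂ g size χ₁}) (gf₂-⊗ g g size size χ₂ χ₃))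

  -- A bijection of `L` with `I` times the part of `Q` on which `kernel` is 1. Encoding that part by
  -- an indicator keeps `Q` a plain index set and turns it into a character of a generating
  -- function.
  record Splitting {L I Q : Set} (wL : L → ℕ) (wI : I → ℕ) (wQ : Q → ℕ) : Set where
    field
      split       : L → I × Q
      merge       : I × Q → L
      merge-split : ∀ l → merge (split l) ≡ l
      kernel      : Q → Carrier
      split-merge : ∀ p → split (merge p) ≡ p ⊎ kernel (proj₂ p) ≈ 0#
      kernel-split : ∀ l → kernel (proj₂ (split l)) ≈ 1#
      weights     : ∀ l → wI (proj₁ (split l)) ℕ.+ wQ (proj₂ (split l)) ≡ wL l

  open Splitting

  gf-splitting : ∀ {L I Q : Set} {wL : L → ℕ} {wI : I → ℕ} {wQ : Q → ℕ} (σ : Splitting wL wI wQ)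
    (gL : Graded wL) (gI : Graded wI) (gQ : Graded wQ) (χ : I → Carrier) →
    gf gL (λ l → χ (proj₁ (split σ l))) ≋ conv (gf gI χ) (gf gQ (kernel σ))
  gf-splitting σ gL gI gQ χ = S.trans
    (reindex gL (gI ⊗ gQ) (split σ) (merge σ) (merge-split σ) inverse (weights σ)
      (λ l → trans (*-congˡ (kernel-split σ l)) (*-identityʳ _)))
    (gf-⊗ gI gQ χ (kernel σ))
    where
    inverse : ∀ p → split σ (merge σ p) ≡ p ⊎ χ (proj₁ p) * kernel σ (proj₂ p) ≈ 0#
    inverse p with split-merge σ p
    ... | inj₁ e = inj₁ e
    ... | inj₂ z = inj₂ (trans (*-congˡ z) (zeroʳ _))

  cubeSplitting : ∀ {L I Q : Set} {wL : L → ℕ} {wI : I → ℕ} {wQ : Q → ℕ} →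
    Splitting wL wI wQ → Splitting (cubeSum wL) (cubeSum wI) (cubeSum wQ)
  cubeSplitting {wI = wI} {wQ} σ = record
    { split = λ (a , b , c) → (proj₁ (split σ a) , proj₁ (split σ b) , proj₁ (split σ c))
                            , (proj₂ (split σ a) , proj₂ (split σ b) , proj₂ (split σ c))
    ; merge = λ ((a , b , c) , (x , y , z)) → merge σ (a , x) , merge σ (b , y) , merge σ (c , z)
    ; merge-split = λ (a , b , c) → ≡.cong₂ _,_ (merge-split σ a) (≡.cong₂ _,_ (merge-split σ b) (merge-split σ c))
    ; kernel = λ (x , y , z) → kernel σ x * (kernel σ y * kernel σ z)
    ; split-merge = inverse
    ; kernel-split = λ (a , b , c) → trans (*-cong (kernel-split σ a)
        (trans (*-cong (kernel-split σ b) (kernel-split σ c)) (*-identityˡ 1#))) (*-identityˡ 1#)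
    ; weights = λ (a , b , c) → ≡.trans
        (interchange (wI (proj₁ (split σ a))) (wI (proj₁ (split σ b))) (wI (proj₁ (split σ c)))
                     (wQ (proj₂ (split σ a))) (wQ (proj₂ (split σ b))) (wQ (proj₂ (split σ c))))
        (≡.cong₂ ℕ._+_ (weights σ a) (≡.cong₂ ℕ._+_ (weights σ b) (weights σ c)))
    }
    where
    interchange : ∀ a b c x y z → (a ℕ.+ (b ℕ.+ c)) ℕ.+ (x ℕ.+ (y ℕ.+ z)) ≡ (a ℕ.+ x) ℕ.+ ((b ℕ.+ y) ℕ.+ (c ℕ.+ z))
    interchange = solveℕ 6 (λ a b c x y z → (a ⊹ (b ⊹ c)) ⊹ (x ⊹ (y ⊹ z)) ≔ (a ⊹ x) ⊹ ((b ⊹ y) ⊹ (c ⊹ z))) ≡.refl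
      where open ℕ-Solver.+-*-Solver using () renaming (solve to solveℕ; _:+_ to _⊹_; _:=_ to _≔_)
    inverse : ∀ p → _ ≡ p ⊎ _
    inverse ((a , b , c) , (x , y , z)) with split-merge σ (a , x) | split-merge σ (b , y) | split-merge σ (c , z)
    ... | inj₁ e | inj₁ f | inj₁ g = inj₁ (≡.cong₂ _,_
      (≡.cong₂ _,_ (≡.cong proj₁ e) (≡.cong₂ _,_ (≡.cong proj₁ f) (≡.cong proj₁ g)))
      (≡.cong₂ _,_ (≡.cong proj₂ e) (≡.cong₂ _,_ (≡.cong proj₂ f) (≡.cong proj₂ g))))
    ... | inj₂ v | _      | _      = inj₂ (trans (*-congʳ v) (zeroˡ _))
    ... | inj₁ _ | inj₂ v | _      = inj₂ (trans (*-congˡ (trans (*-congʳ v) (zeroˡ _))) (zeroʳ _))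
    ... | inj₁ _ | inj₁ _ | inj₂ v = inj₂ (trans (*-congˡ (trans (*-congˡ v) (zeroʳ _))) (zeroʳ _))

  neutral : Maya → Carrier
  neutral m = ind (charge m ℤₚ.≟ 0ℤ)

  -- Jacobi's triple product: the charge contributes the theta series and the neutral diagrams form
  -- the factor G that is independent of z.
  mayaSplitting : Splitting energy T energy
  mayaSplitting = record
    { split        = λ m → charge m , normalise m
    ; merge        = λ (i , m) → shiftBy i m
    ; merge-split  = λ m → shiftBy-inverse (charge m) m
    ; kernel       = neutral
    ; split-merge  = inverse
    ; kernel-split = λ m → ind-yes (charge (normalise m) ℤₚ.≟ 0ℤ) (normalise-charge m)
    ; weights      = normalise-energy
    }
    where
    inverse : ∀ ((i , m) : ℤ × Maya) → (charge (shiftBy i m) , normalise (shiftBy i m)) ≡ (i , m) ⊎ neutral m ≈ 0#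
    inverse (i , m) with charge m ℤₚ.≟ 0ℤ
    ... | yes c = inj₁ (normalise-shiftBy i m c)
    ... | no _  = inj₂ refl

  -- partitions d = ∏ 1 / (1 - qᵈⁿ), with d shifted by one.
  partitions : ℕ → Series
  partitions d = gf (gradedMultiple d gradedMaya) neutral

  gf-neutral : gf gradedMaya neutral ≋ partitions 0
  gf-neutral = gf-graded gradedMaya (gradedMultiple 0 gradedMaya) (λ m → ℕₚ.*-identityˡ (energy m)) (λ _ → refl)

  gf-neutral³ : gf (cubeGraded gradedMaya) (kernel (cubeSplitting mayaSplitting)) ≋ cube (partitions 0)
  gf-neutral³ = S.trans (gf-cube gradedMaya neutral neutral neutral)
    (conv-cong gf-neutral (conv-cong gf-neutral gf-neutral))

  gf-neutral⁹ : gf (cubeGraded (cubeGraded gradedMaya)) (kernel (cubeSplitting (cubeSplitting mayaSplitting))) ≋ cube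
    (cube (partitions 0))
  gf-neutral⁹ = S.trans (gf-cube (cubeGraded gradedMaya) _ _ _)
    (conv-cong gf-neutral³ (conv-cong gf-neutral³ gf-neutral³))

  ⊖-zero : ∀ {m n} → m ⊖ n ≡ 0ℤ → m ≡ n
  ⊖-zero e = ⊖-injective e

  ind-⊖ : ∀ {i} m n → i ≡ m ⊖ n → ind (i ℤₚ.≟ 0ℤ) ≈ ind (m ℕ.≟ n)
  ind-⊖ m n ≡.refl = ind-cong (m ⊖ n ℤₚ.≟ 0ℤ) (m ℕ.≟ n) ⊖-zero (λ { ≡.refl → ℤₚ.n⊖n≡0 m })

  1^ : ∀ n → 1# ^ n ≈ 1#
  1^ zero    = refl
  1^ (suc n) = trans (*-identityˡ _) (1^ n)

  -- A diagram is neutral when its two subsets have equal size, which is the condition imposed by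
  -- `⋆`. The common factor `suc d` of both sizes does not affect it.
  partitions-⋆ : ∀ d → partitions d ≋ (P d 1# ⋆ P d 1#)
  partitions-⋆ d = S.trans
    (gf-graded (gradedMultiple d gradedMaya) k weight character)
    (gf-⋆ g g (λ s → suc d ℕ.* length s) (λ s → suc d ℕ.* length s) (λ s → 1# ^ length s) (λ s → 1# ^ length s) k)
    where
    g = gradedMultiple d gradedSubset
    k : Graded (λ ((s , t) : Maya) → suc d ℕ.* length s ℕ.+ (suc d ℕ.* wt s ℕ.+ suc d ℕ.* wt t))
    k = dominate (g ⊗ g) (λ (s , t) → ℕₚ.m≤n+m _ (suc d ℕ.* length s))
    weight : ∀ ((s , t) : Maya) → suc d ℕ.* length s ℕ.+ (suc d ℕ.* wt s ℕ.+ suc d ℕ.* wt t) ≡ suc d ℕ.* energy (s , t)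
    weight (s , t) = solveℕ 4 (λ d l a b → d ⊛ l ⊹ (d ⊛ a ⊹ d ⊛ b) ≔ d ⊛ (l ⊹ (a ⊹ b))) ≡.refl (suc d) (length s) (wt s)
      (wt t)
      where open ℕ-Solver.+-*-Solver using () renaming (solve to solveℕ; _:+_ to _⊹_; _:*_ to _⊛_; _:=_ to _≔_)
    character : ∀ ((s , t) : Maya) →
      1# ^ length s * 1# ^ length t * ind (suc d ℕ.* length s ℕ.≟ suc d ℕ.* length t) ≈ neutral (s , t)
    character (s , t) = trans (*-cong (trans (*-cong (1^ (length s)) (1^ (length t))) (*-identityˡ 1#))
        (ind-cong (suc d ℕ.* length s ℕ.≟ suc d ℕ.* length t) (length s ℕ.≟ length t)
          (ℕₚ.*-cancelˡ-≡ (length s) (length t) (suc d)) (≡.cong (suc d ℕ.*_))))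
      (trans (*-identityˡ _) (sym (ind-⊖ (length s) (length t) ≡.refl)))

  total-⊖ : ∀ {A : Set} (f : A → ℤ) (p n : A → ℕ) → (∀ a → f a ≡ p a ⊖ n a) →
    ∀ c → total (cubeMap f c) ≡ cubeSum p c ⊖ cubeSum n c
  total-⊖ f p n e (a , b , c) = ≡.trans (≡.cong₂ ℤ._+_ (e a) (≡.cong₂ ℤ._+_ (e b) (e c)))
    (≡.trans (≡.cong (λ k → (p a ⊖ n a) ℤ.+ k) (⊖-+ (p b) (n b) (p c) (n c)))
      (⊖-+ (p a) (n a) (p b ℕ.+ p c) (n b ℕ.+ n c)))

  -- The twist 1, ω, ω² of three variables, restricted to total charge zero.
  twisted : Cube ℤ → Carrier
  twisted (a , b , c) = ind (total (a , b , c) ℤₚ.≟ 0ℤ) * (ω-power b * (ω-power c * ω-power c))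

  subsets : Graded (λ s → 1 ℕ.* wt s)
  subsets = gradedMultiple 0 gradedSubset

  size₁ : Subset → ℕ
  size₁ s = 1 ℕ.* length s

  power : Carrier → Subset → Carrier
  power η s = η ^ length s

  mayaWeight : ∀ ((s , t) : Maya) → energy (s , t) ≡ size₁ s ℕ.+ (1 ℕ.* wt s ℕ.+ 1 ℕ.* wt t)
  mayaWeight (s , t) = ≡.sym (≡.cong₂ ℕ._+_ (ℕₚ.*-identityˡ (length s))
    (≡.cong₂ ℕ._+_ (ℕₚ.*-identityˡ (wt s)) (ℕₚ.*-identityˡ (wt t))))

  mayaCharge : ∀ ((s , t) : Maya) → charge (s , t) ≡ size₁ s ⊖ size₁ t
  mayaCharge (s , t) = ≡.sym (≡.cong₂ _⊖_ (ℕₚ.*-identityˡ (length s)) (ℕₚ.*-identityˡ (length t)))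

  -- The infinite products are never multiplied out factor by factor: both sides solve X(u) = (1 +
  -- u³) X(u q) with constant term 1.
  twisted-product : PS.conv (P 0 1#) (PS.conv (P 0 ω) (P 0 ω̄)) PS.≋ P 2 1#
  twisted-product = functional-unique {F = factor 1# 3 0}
    (λ { zero → trans (+-congˡ (zero₃ 0)) (+-identityʳ _) ; (suc n) → trans (+-congˡ (zero₃ (suc n))) (+-identityʳ _) })
    (S.trans (conv-cong (P-constant 0 1#) (S.trans (conv-cong (P-constant 0 ω) (P-constant 0 ω̄)) (conv-identityˡ 𝟏)))
      (S.trans (conv-identityˡ 𝟏) (S.sym (P-constant 2 1#))))
    functional (P-functional 2 1#)
    where
    zero₃ : ∀ n → term₂ 1# 3 0 0 n ≈ 0#
    zero₃ n = trans (*-congʳ (zeroʳ 1#)) (zeroˡ _)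
    open import Algebra.Solver.Ring.NaturalCoefficients.Default S₂.commutativeSemiring
      using () renaming (solve to solve₂; _:=_ to _≔_; _:*_ to _⊛_; _:+_ to _⊹_; con to con₂)
    Q = PS.conv (P 0 1#) (PS.conv (P 0 ω) (P 0 ω̄))
    t : Carrier → ℕ → PS.Series
    t x a = term₂ x a 0
    sum-t : ∀ a x y z → x + (y + z) ≈ 0# → S₂._+_ (t x a) (S₂._+_ (t y a) (t z a)) PS.≋ PS.𝟎
    sum-t a x y z e s n = trans
      (solve 5 (λ x y z m k → x :* m :* k :+ (y :* m :* k :+ z :* m :* k) := (x :+ (y :+ z)) :* (m :* k)) refl x y z
        (mono a s) (mono 0 n))
      (trans (*-congʳ e) (zeroˡ _))
    t-cong : ∀ a {x y} → x ≈ y → t x a PS.≋ t y a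
    t-cong a e s n = *-congʳ (*-congʳ e)
    -- The first two elementary symmetric functions of 1, ω, ω² vanish and the third is 1.
    factors : PS.conv (factor 1# 1 0) (PS.conv (factor ω 1 0) (factor ω̄ 1 0)) PS.≋ factor 1# 3 0
    factors = S₂.trans
      (solve₂ 4 (λ o a b c → (o ⊹ a) ⊛ ((o ⊹ b) ⊛ (o ⊹ c)) ≔
          o ⊛ (o ⊛ o) ⊹ ((o ⊛ o) ⊛ (a ⊹ (b ⊹ c)) ⊹ (o ⊛ (a ⊛ b ⊹ (a ⊛ c ⊹ b ⊛ c)) ⊹ a ⊛ (b ⊛ c))))
        S₂.refl PS.𝟏 (t 1# 1) (t ω 1) (t ω̄ 1))
      (S₂.trans (S₂.+-cong {PS.𝟏 ⊙ (PS.𝟏 ⊙ PS.𝟏)} {PS.𝟏} (S₂.trans (S₂.*-identityˡ (PS.𝟏 ⊙ PS.𝟏)) (S₂.*-identityˡ PS.𝟏))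
        (S₂.+-cong
          (S₂.trans (S₂.*-cong (S₂.refl {PS.𝟏 ⊙ PS.𝟏}) (sum-t 1 1# ω ω̄ ω-root)) (S₂.zeroʳ (PS.𝟏 ⊙ PS.𝟏)))
          (S₂.+-cong
            (S₂.trans (S₂.*-identityˡ _) (S₂.trans
              (S₂.+-cong (term₂-conv 1# ω 1 1 0 0) (S₂.+-cong (term₂-conv 1# ω̄ 1 1 0 0) (term₂-conv ω ω̄ 1 1 0 0)))
              (sum-t 2 (1# * ω) (1# * ω̄) (ω * ω̄) (trans
                (+-cong (*-identityˡ ω) (+-cong (*-identityˡ ω̄) ω-cube))
                (trans (solve 3 (λ a b c → a :+ (b :+ c) := c :+ (a :+ b)) refl ω ω̄ 1#) ω-root)))))
            (S₂.trans (S₂.*-cong (S₂.refl {t 1# 1}) (term₂-conv ω ω̄ 1 1 0 0))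
              (S₂.trans (term₂-conv 1# (ω * ω̄) 1 2 0 0) (t-cong 3 (trans (*-identityˡ _) ω-cube)))))))
        (S₂.+-cong {PS.𝟏} {PS.𝟏} S₂.refl (S₂.trans (S₂.+-identityˡ _) (S₂.+-identityˡ _))))
      where
      _⊙_ = PS.conv
    functional : Q PS.≋ PS.conv (factor 1# 3 0) (dilate 1 Q)
    functional = S₂.trans
      (S₂.*-cong (P-functional 0 1#) (S₂.*-cong (P-functional 0 ω) (P-functional 0 ω̄)))
      (S₂.trans (solve₂ 6 (λ a b c x y z → (a ⊛ x) ⊛ ((b ⊛ y) ⊛ (c ⊛ z)) ≔ (a ⊛ (b ⊛ c)) ⊛ (x ⊛ (y ⊛ z))) S₂.refl
          (factor 1# 1 0) (factor ω 1 0) (factor ω̄ 1 0) (dilate 1 (P 0 1#)) (dilate 1 (P 0 ω)) (dilate 1 (P 0 ω̄)))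
        (S₂.*-cong factors (S₂.sym (S₂.trans (dilate-conv 1 (P 0 1#) (PS.conv (P 0 ω) (P 0 ω̄)))
          (S₂.*-cong (S₂.refl {dilate 1 (P 0 1#)}) (dilate-conv 1 (P 0 ω) (P 0 ω̄)))))))

  -- b(q) / E(q)³ = 1 / E(q³) with E(q) = ∏ (1 - qⁿ); it comes from (1 + u)(1 + ω u)(1 + ω² u) = 1 + u³.
  twisted-partitions : conv (gf (cubeGraded gradedℤ) twisted) (cube (partitions 0)) ≋ partitions 2
  twisted-partitions = S.trans (S.sym (S.trans
      (gf-splitting (cubeSplitting mayaSplitting) (cubeGraded gradedMaya) (cubeGraded gradedℤ) (cubeGraded gradedMaya)
        twisted)
      (conv-cong S.refl gf-neutral³)))
    (S.trans (S.sym (reindex k (cubeGraded gradedMaya) zipCube unzipCube (λ _ → ≡.refl) (λ _ → inj₁ ≡.refl) weight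
      character))
      (S.trans (gf-⋆ (cubeGraded subsets) (cubeGraded subsets) (cubeSum size₁) (cubeSum size₁) χ₁ χ₂ k)
        (S.trans (λ n → ⋆-cong[] n (λ s j _ → product₁ s j) (λ s j _ → product₂ s j)) (S.sym (partitions-⋆ 2)))))
    where
    -- The third charge enters with ω² = ω̄, and the second subset of a diagram counts negatively,
    -- so its characters are inverted. Up to order both triples are 1, ω, ω̄.
    χ₁ χ₂ : Cube Subset → Carrier
    χ₁ (a , b , c) = power 1# a * (power ω b * power ω̄ c)
    χ₂ (a , b , c) = power 1# a * (power ω̄ b * power ω c)
    k : Graded (λ ((s , t) : Cube Subset × Cube Subset) →
      cubeSum size₁ s ℕ.+ (cubeSum (λ x → 1 ℕ.* wt x) s ℕ.+ cubeSum (λ x → 1 ℕ.* wt x) t))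
    k = dominate (cubeGraded subsets ⊗ cubeGraded subsets) (λ (s , t) → ℕₚ.m≤n+m _ (cubeSum size₁ s))
    product₁ : gf₂ (cubeGraded subsets) (cubeSum size₁) χ₁ PS.≋ P 2 1#
    product₁ = S₂.trans (gf₂-cube subsets size₁ (power 1#) (power ω) (power ω̄)) twisted-product
    product₂ : gf₂ (cubeGraded subsets) (cubeSum size₁) χ₂ PS.≋ P 2 1#
    product₂ = S₂.trans (gf₂-cube subsets size₁ (power 1#) (power ω̄) (power ω))
      (S₂.trans (S₂.*-cong (S₂.refl {P 0 1#}) (S₂.*-comm (P 0 ω̄) (P 0 ω))) twisted-product)
    weight : ∀ ((s , t) : Cube Subset × Cube Subset) → cubeSum energy (zipCube (s , t)) ≡
      cubeSum size₁ s ℕ.+ (cubeSum (λ x → 1 ℕ.* wt x) s ℕ.+ cubeSum (λ x → 1 ℕ.* wt x) t)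
    weight p = ≡.trans (cubeSum-cong mayaWeight (zipCube p))
      (cubeSum-+ (λ (s , t) → size₁ s) (λ (s , t) → 1 ℕ.* wt s) (λ (s , t) → 1 ℕ.* wt t) (zipCube p))
    character : ∀ ((s , t) : Cube Subset × Cube Subset) → twisted (cubeMap charge (zipCube (s , t))) ≈
      χ₁ s * χ₂ t * ind (cubeSum size₁ s ℕ.≟ cubeSum size₁ t)
    character ((s₁ , s₂ , s₃) , (t₁ , t₂ , t₃)) = begin
      ind (total (cubeMap charge m) ℤₚ.≟ 0ℤ) *
        (ω-power (charge (s₂ , t₂)) * (ω-power (charge (s₃ , t₃)) * ω-power (charge (s₃ , t₃))))
        ≈⟨ *-cong (ind-⊖ (cubeSum size₁ (s₁ , s₂ , s₃)) (cubeSum size₁ (t₁ , t₂ , t₃))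
             (total-⊖ charge (λ (s , t) → size₁ s) (λ (s , t) → size₁ t) mayaCharge m))
           (*-cong (ω-power-⊖ (length s₂) (length t₂))
             (*-cong (ω-power-⊖ (length s₃) (length t₃)) (ω-power-⊖ (length s₃) (length t₃)))) ⟩
      i * (power ω s₂ * power ω̄ t₂ * (power ω s₃ * power ω̄ t₃ * (power ω s₃ * power ω̄ t₃)))
        ≈⟨ solve 7 (λ i a b c d e f → i :* (a :* b :* (c :* d :* (e :* f))) := a :* (c :* e) :* (b :* (d :* f)) :* i)
          refl i _ _ _ _ _ _ ⟩
      power ω s₂ * (power ω s₃ * power ω s₃) * (power ω̄ t₂ * (power ω̄ t₃ * power ω̄ t₃)) * i
        ≈⟨ *-congʳ (*-cong (*-congˡ (square-power refl (length s₃))) (*-congˡ (square-power ω̄-square (length t₃)))) ⟩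
      power ω s₂ * power ω̄ s₃ * (power ω̄ t₂ * power ω t₃) * i
        ≈⟨ *-congʳ (*-cong (add-one s₁) (add-one t₁)) ⟩
      χ₁ (s₁ , s₂ , s₃) * χ₂ (t₁ , t₂ , t₃) * i ∎
      where
      m = zipCube ((s₁ , s₂ , s₃) , (t₁ , t₂ , t₃))
      i = ind (cubeSum size₁ (s₁ , s₂ , s₃) ℕ.≟ cubeSum size₁ (t₁ , t₂ , t₃))
      square-power : ∀ {x y} → x * x ≈ y → ∀ n → x ^ n * x ^ n ≈ y ^ n
      square-power e zero    = *-identityˡ 1#
      square-power e (suc n) = trans (solve 2 (λ x p → (x :* p) :* (x :* p) := (x :* x) :* (p :* p)) refl _ _)
        (*-cong e (square-power e n))
      add-one : ∀ s {x} → x ≈ power 1# s * x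
      add-one s = sym (trans (*-congʳ (1^ (length s))) (*-identityˡ _))

  balanced : Cube (Cube ℤ) → Carrier
  balanced x = ind (total (cubeMap total x) ℤₚ.≟ 0ℤ)

  -- Nine diagrams of total charge zero are counted twice: by their charges and neutral parts, and
  -- by their first and second subsets, whose sizes must agree in total.
  balanced-partitions : conv (gf (cubeGraded (cubeGraded gradedℤ)) balanced) (cube (cube (partitions 0))) ≋
    (cube₂ (cube₂ (P 0 1#)) ⋆ cube₂ (cube₂ (P 0 1#)))
  balanced-partitions = S.trans (S.sym (S.trans
      (gf-splitting (cubeSplitting (cubeSplitting mayaSplitting)) (cubeGraded (cubeGraded gradedMaya))
        (cubeGraded (cubeGraded gradedℤ)) (cubeGraded (cubeGraded gradedMaya)) balanced)
      (conv-cong S.refl gf-neutral⁹)))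
    (S.trans (S.sym (reindex k (cubeGraded (cubeGraded gradedMaya)) (λ p → cubeMap zipCube (zipCube p))
        (λ m → unzipCube (cubeMap unzipCube m)) (λ _ → ≡.refl) (λ _ → inj₁ ≡.refl) weight character))
      (S.trans (gf-⋆ subsets⁹ subsets⁹ size₉ size₉ χ χ k)
        (λ n → ⋆-cong[] n (λ s j _ → product s j) (λ s j _ → product s j))))
    where
    subsets⁹ = cubeGraded (cubeGraded subsets)
    size₉ = cubeSum (cubeSum size₁)
    χ₃ : Cube Subset → Carrier
    χ₃ (a , b , c) = power 1# a * (power 1# b * power 1# c)
    χ : Cube (Cube Subset) → Carrier
    χ (a , b , c) = χ₃ a * (χ₃ b * χ₃ c)
    wt₉ : Cube (Cube Subset) → ℕ
    wt₉ = cubeSum (cubeSum (λ x → 1 ℕ.* wt x))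
    k : Graded (λ ((s , t) : Cube (Cube Subset) × Cube (Cube Subset)) → size₉ s ℕ.+ (wt₉ s ℕ.+ wt₉ t))
    k = dominate (subsets⁹ ⊗ subsets⁹) (λ (s , t) → ℕₚ.m≤n+m _ (size₉ s))
    product₃ : gf₂ (cubeGraded subsets) (cubeSum size₁) χ₃ PS.≋ cube₂ (P 0 1#)
    product₃ = gf₂-cube subsets size₁ (power 1#) (power 1#) (power 1#)
    product : gf₂ subsets⁹ size₉ χ PS.≋ cube₂ (cube₂ (P 0 1#))
    product = S₂.trans (gf₂-cube (cubeGraded subsets) (cubeSum size₁) χ₃ χ₃ χ₃)
      (S₂.*-cong product₃ (S₂.*-cong product₃ product₃))
    weight : ∀ ((s , t) : Cube (Cube Subset) × Cube (Cube Subset)) →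
      cubeSum (cubeSum energy) (cubeMap zipCube (zipCube (s , t))) ≡ size₉ s ℕ.+ (wt₉ s ℕ.+ wt₉ t)
    weight p = ≡.trans (cubeSum-cong
        (λ c → ≡.trans (cubeSum-cong mayaWeight c)
          (cubeSum-+ (λ (s , t) → size₁ s) (λ (s , t) → 1 ℕ.* wt s) (λ (s , t) → 1 ℕ.* wt t) c))
        (cubeMap zipCube (zipCube p)))
      (cubeSum-+ (λ (s , t) → cubeSum size₁ s) (λ (s , t) → cubeSum (λ x → 1 ℕ.* wt x) s)
        (λ (s , t) → cubeSum (λ x → 1 ℕ.* wt x) t) (zipCube p))
    χ₃-one : ∀ s → χ₃ s ≈ 1#
    χ₃-one (a , b , c) = trans (*-cong (1^ (length a))
      (trans (*-cong (1^ (length b)) (1^ (length c))) (*-identityˡ 1#))) (*-identityˡ 1#)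
    χ-one : ∀ s → χ s ≈ 1#
    χ-one (a , b , c) = trans (*-cong (χ₃-one a) (trans (*-cong (χ₃-one b) (χ₃-one c)) (*-identityˡ 1#))) (*-identityˡ 1#)
    character : ∀ ((s , t) : Cube (Cube Subset) × Cube (Cube Subset)) →
      balanced (cubeMap (cubeMap charge) (cubeMap zipCube (zipCube (s , t)))) ≈ χ s * χ t * ind (size₉ s ℕ.≟ size₉ t)
    character (s , t) = trans
      (ind-⊖ (size₉ s) (size₉ t) (total-⊖ (λ c → total (cubeMap charge (zipCube c)))
        (λ (s , t) → cubeSum size₁ s) (λ (s , t) → cubeSum size₁ t)
        (λ c → total-⊖ charge (λ (s , t) → size₁ s) (λ (s , t) → size₁ t) mayaCharge (zipCube c)) (zipCube (s , t))))
      (sym (trans (*-congʳ (trans (*-cong (χ-one s) (χ-one t)) (*-identityˡ 1#))) (*-identityˡ _)))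

-- The hexagonal lattice, its cosets and the rows of ℤ³

module Hexagonal where

  open import Data.Nat as ℕ using (ℕ; zero; suc; z≤n; s≤s)
  import Data.Nat.Properties as ℕₚ
  open import Data.Nat.Divisibility using (_∣_; _∣?_; divides)
  open import Data.Integer as ℤ using (ℤ; +_; -[1+_])
  import Data.Integer.Properties as ℤₚ
  open import Data.Integer.DivMod using (_/ℕ_; n%ℕd<d; a≡a%ℕn+[a/ℕn]*n)
  open import Data.Integer.Solver using (module +-*-Solver)
  open import Data.Fin using (Fin; zero; suc; toℕ; fromℕ<)
  open import Data.Fin.Properties using (toℕ-fromℕ<)
  open import Data.Product using (_×_; _,_; proj₁; proj₂)
  open import Relation.Nullary using (contradiction)
  open import Relation.Nullary.Decidable using (from-no)
  open import Relation.Binary.PropositionalEquality as ≡ using (_≡_; _≢_; refl; sym; trans; cong; cong₂)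
  open Grading
  open Maya using (T; T-double; gradedℤ)
  open Cubes
  open +-*-Solver
  open ≡.≡-Reasoning

  three∤ : ∀ k → k ≢ 0 → k ℕ.< 3 → ∀ d → + k ≢ + 3 ℤ.* d
  three∤ k k≢0 k<3 d e with divides {3} {k} ℤ.∣ d ∣ (trans (cong ℤ.∣_∣ e) (trans (ℤₚ.abs-* (+ 3) d) (ℕₚ.*-comm 3 ℤ.∣ d ∣)))
  three∤ 0 k≢0 k<3 d e | _ = k≢0 refl
  three∤ 1 k≢0 k<3 d e | p = from-no (3 ∣? 1) p
  three∤ 2 k≢0 k<3 d e | p = from-no (3 ∣? 2) p
  three∤ (suc (suc (suc _))) k≢0 (s≤s (s≤s (s≤s ()))) d e | _

  compose₃ : Fin 3 × ℤ → ℤ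
  compose₃ (r , d) = + toℕ r ℤ.+ + 3 ℤ.* d

  divMod₃ : ℤ → Fin 3 × ℤ
  divMod₃ i = fromℕ< (n%ℕd<d i 3) , i /ℕ 3

  compose₃-divMod₃ : ∀ i → compose₃ (divMod₃ i) ≡ i
  compose₃-divMod₃ i = trans (cong₂ (λ a b → + a ℤ.+ b) (toℕ-fromℕ< (n%ℕd<d i 3)) (ℤₚ.*-comm (+ 3) (i /ℕ 3)))
    (sym (a≡a%ℕn+[a/ℕn]*n i 3))

  compose₃-injective : ∀ p p′ → compose₃ p ≡ compose₃ p′ → p ≡ p′
  compose₃-injective (r , d) (r′ , d′) = go r r′
    where
    same : ∀ x → + x ℤ.+ + 3 ℤ.* d ≡ + x ℤ.+ + 3 ℤ.* d′ → d ≡ d′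
    same x e = ℤₚ.*-cancelˡ-≡ (+ 3) d d′ (begin
      + 3 ℤ.* d                              ≡⟨ solve 2 (λ x d → con (+ 3) :* d := (x :+ con (+ 3) :* d) :- x) refl
        (+ x) d ⟩
      (+ x ℤ.+ + 3 ℤ.* d) ℤ.- + x            ≡⟨ cong (ℤ._- + x) e ⟩
      (+ x ℤ.+ + 3 ℤ.* d′) ℤ.- + x           ≡⟨ solve 2 (λ x d → (x :+ con (+ 3) :* d) :- x := con (+ 3) :* d) refl
        (+ x) d′ ⟩
      + 3 ℤ.* d′                             ∎)
    differ : ∀ x k d d′ → k ≢ 0 → k ℕ.< 3 → (+ x ℤ.+ + 3 ℤ.* d) ≢ + (x ℕ.+ k) ℤ.+ + 3 ℤ.* d′
    differ x k d d′ k≢0 k<3 e = three∤ k k≢0 k<3 (d ℤ.- d′) (begin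
      + k
        ≡⟨ solve 3 (λ x k d → k := ((x :+ k) :+ con (+ 3) :* d) :- (x :+ con (+ 3) :* d)) refl (+ x) (+ k) d′ ⟩
      (+ (x ℕ.+ k) ℤ.+ + 3 ℤ.* d′) ℤ.- (+ x ℤ.+ + 3 ℤ.* d′)
        ≡⟨ cong (ℤ._- (+ x ℤ.+ + 3 ℤ.* d′)) (sym e) ⟩
      (+ x ℤ.+ + 3 ℤ.* d) ℤ.- (+ x ℤ.+ + 3 ℤ.* d′)
        ≡⟨ solve 3 (λ x d e → (x :+ con (+ 3) :* d) :- (x :+ con (+ 3) :* e) := con (+ 3) :* (d :- e)) refl (+ x) d d′ ⟩
      + 3 ℤ.* (d ℤ.- d′) ∎)
    go : ∀ r r′ → compose₃ (r , d) ≡ compose₃ (r′ , d′) → (r , d) ≡ (r′ , d′)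
    go zero             zero             e = cong (zero ,_) (same 0 e)
    go (suc zero)       (suc zero)       e = cong (suc zero ,_) (same 1 e)
    go (suc (suc zero)) (suc (suc zero)) e = cong (suc (suc zero) ,_) (same 2 e)
    go zero             (suc zero)       e = contradiction e (differ 0 1 d d′ (λ ()) (s≤s (s≤s z≤n)))
    go zero             (suc (suc zero)) e = contradiction e (differ 0 2 d d′ (λ ()) (s≤s (s≤s (s≤s z≤n))))
    go (suc zero)       (suc (suc zero)) e = contradiction e (differ 1 1 d d′ (λ ()) (s≤s (s≤s z≤n)))
    go (suc zero)       zero             e = contradiction (sym e) (differ 0 1 d′ d (λ ()) (s≤s (s≤s z≤n)))
    go (suc (suc zero)) zero             e = contradiction (sym e) (differ 0 2 d′ d (λ ()) (s≤s (s≤s (s≤s z≤n))))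
    go (suc (suc zero)) (suc zero)       e = contradiction (sym e) (differ 1 1 d′ d (λ ()) (s≤s (s≤s z≤n)))

  divMod₃-unique : ∀ p {i} → i ≡ compose₃ p → divMod₃ i ≡ p
  divMod₃-unique p {i} e = compose₃-injective (divMod₃ i) p (trans (compose₃-divMod₃ i) e)

  -- cubeSum T x = (∑ xᵢ² + ∑ xᵢ) / 2, so doubling turns equations between weights into polynomial identities.
  doubled : Cube ℤ → ℤ
  doubled (x , y , z) = (x ℤ.* x ℤ.+ x) ℤ.+ ((y ℤ.* y ℤ.+ y) ℤ.+ (z ℤ.* z ℤ.+ z))

  weight : Cube ℤ → ℕ
  weight = cubeSum T

  weight-double : ∀ v → + 2 ℤ.* + weight v ≡ doubled v
  weight-double (x , y , z) = trans (ℤₚ.*-distribˡ-+ (+ 2) (+ T x) (+ (T y ℕ.+ T z)))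
    (cong₂ ℤ._+_ (T-double x) (trans (ℤₚ.*-distribˡ-+ (+ 2) (+ T y) (+ T z)) (cong₂ ℤ._+_ (T-double y) (T-double z))))

  halve : ∀ {m n} → + 2 ℤ.* + m ≡ + 2 ℤ.* + n → m ≡ n
  halve {m} {n} e = ℤₚ.+-injective (ℤₚ.*-cancelˡ-≡ (+ 2) (+ m) (+ n) e)

  +-double : ∀ m n {x y} → + 2 ℤ.* + m ≡ x → + 2 ℤ.* + n ≡ y → + 2 ℤ.* + (m ℕ.+ n) ≡ x ℤ.+ y
  +-double m n e f = trans (ℤₚ.*-distribˡ-+ (+ 2) (+ m) (+ n)) (cong₂ ℤ._+_ e f)

  affine-double : ∀ c k v → + 2 ℤ.* + (c ℕ.+ k ℕ.* weight v) ≡ + (2 ℕ.* c) ℤ.+ + k ℤ.* doubled v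
  affine-double c k v = +-double c (k ℕ.* weight v) (sym (ℤₚ.pos-* 2 c)) (begin
    + 2 ℤ.* + (k ℕ.* weight v)       ≡⟨ cong (λ m → + 2 ℤ.* m) (ℤₚ.pos-* k (weight v)) ⟩
    + 2 ℤ.* (+ k ℤ.* + weight v)     ≡⟨ solve 2 (λ k w → con (+ 2) :* (k :* w) := k :* (con (+ 2) :* w)) refl (+ k)
      (+ weight v) ⟩
    + k ℤ.* (+ 2 ℤ.* + weight v)     ≡⟨ cong (λ m → + k ℤ.* m) (weight-double v) ⟩
    + k ℤ.* doubled v                ∎)

  weight-affine : ∀ u c k v → doubled u ≡ + (2 ℕ.* c) ℤ.+ + k ℤ.* doubled v → weight u ≡ c ℕ.+ k ℕ.* weight v
  weight-affine u c k v e = halve (trans (weight-double u) (trans e (sym (affine-double c k v))))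

  weight-cong : ∀ u v → doubled u ≡ doubled v → weight u ≡ weight v
  weight-cong u v e = halve (trans (weight-double u) (trans e (sym (weight-double v))))

  weight-sum : ∀ u v w → doubled u ≡ doubled v ℤ.+ doubled w → weight u ≡ weight v ℕ.+ weight w
  weight-sum u v w e = halve (trans (weight-double u)
    (trans e (sym (+-double (weight v) (weight w) (weight-double v) (weight-double w)))))

  weight-sum₃ : ∀ u v w c k z → doubled u ℤ.+ (doubled v ℤ.+ doubled w) ≡ + (2 ℕ.* c) ℤ.+ + k ℤ.* doubled z →
    weight u ℕ.+ (weight v ℕ.+ weight w) ≡ c ℕ.+ k ℕ.* weight z
  weight-sum₃ u v w c k z e = halve (trans
    (+-double (weight u) (weight v ℕ.+ weight w) (weight-double u)
    (+-double (weight v) (weight w) (weight-double v) (weight-double w)))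
    (trans e (sym (affine-double c k z))))

  ℤ² : Set
  ℤ² = ℤ × ℤ

  -- The point of ℤ³ with coordinate sum -r and given last two coordinates.
  embed : ℕ → ℤ² → Cube ℤ
  embed r (x , y) = ℤ.- (+ r ℤ.+ (x ℤ.+ y)) , x , y

  coset : ℕ → ℤ² → ℕ
  coset r p = weight (embed r p)

  gradedCoset : ∀ r → Graded (coset r)
  gradedCoset r = dominate (gradedℤ ⊗ gradedℤ) (λ (x , y) → ℕₚ.m≤n+m _ (T (ℤ.- (+ r ℤ.+ (x ℤ.+ y)))))

  -- The cyclic permutation of the three coordinates of `embed r`, expressed in the last two.
  rotate : ℕ → ℤ² → ℤ²
  rotate r (x , y) = y , ℤ.- (+ r ℤ.+ (x ℤ.+ y))

  unrotate : ℕ → ℤ² → ℤ²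
  unrotate r (x , y) = ℤ.- (+ r ℤ.+ (x ℤ.+ y)) , x

  unrotate-rotate : ∀ r p → unrotate r (rotate r p) ≡ p
  unrotate-rotate r (x , y) = cong (_, y)
    (solve 3 (λ r x y → :- (r :+ (y :+ (:- (r :+ (x :+ y))))) := x) refl (+ r) x y)

  rotate-unrotate : ∀ r p → rotate r (unrotate r p) ≡ p
  rotate-unrotate r (x , y) = cong (x ,_)
    (solve 3 (λ r x y → :- (r :+ ((:- (r :+ (x :+ y))) :+ x)) := y) refl (+ r) x y)

  private
    d : ∀ {n} → Polynomial n → Polynomial n
    d x = x :* x :+ x
    dd : ∀ {n} → Polynomial n × Polynomial n × Polynomial n → Polynomial n
    dd (x , y , z) = d x :+ (d y :+ d z)
    emb : ∀ {n} → Polynomial n → Polynomial n × Polynomial n → Polynomial n × Polynomial n × Polynomial n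
    emb r (x , y) = :- (r :+ (x :+ y)) , x , y
    # : ∀ {n} → ℤ → Polynomial n
    # k = con k

  coset-rotate : ∀ r p → coset r (rotate r p) ≡ coset r p
  coset-rotate r (x , y) = weight-cong (embed r (rotate r (x , y))) (embed r (x , y))
    (solve 3 (λ r x y → dd (emb r (y , :- (r :+ (x :+ y)))) := dd (emb r (x , y))) refl (+ r) x y)

  -- The map x ↦ -1 - x on all three coordinates preserves `T` and turns the coordinate sum -1 into
  -- -2.
  reflect : ℤ² → ℤ²
  reflect (x , y) = -[1+ 0 ] ℤ.- x , -[1+ 0 ] ℤ.- y

  reflect-involutive : ∀ p → reflect (reflect p) ≡ p
  reflect-involutive (x , y) = cong₂ _,_ (flip x) (flip y)
    where
    flip : ∀ x → -[1+ 0 ] ℤ.- (-[1+ 0 ] ℤ.- x) ≡ x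
    flip = solve 1 (λ x → con -[1+ 0 ] :- (con -[1+ 0 ] :- x) := x) refl

  coset-reflect : ∀ p → coset 2 (reflect p) ≡ coset 1 p
  coset-reflect (x , y) = weight-cong (embed 2 (reflect (x , y))) (embed 1 (x , y))
    (solve 2 (λ x y → dd (emb (# (+ 2)) (# -[1+ 0 ] :- x , # -[1+ 0 ] :- y)) := dd (emb (# (+ 1)) (x , y))) refl x y)

  -- The k-th class of the points (x , y) modulo 3, according to x - y = 3 s + k.
  class : Fin 3 × ℤ² → ℤ²
  class (k , (p , s)) = p ℤ.+ + 2 ℤ.* s ℤ.+ + toℕ k , p ℤ.- s

  unclassAt : ℤ → Fin 3 × ℤ → Fin 3 × ℤ²
  unclassAt y (k , s) = k , (y ℤ.+ s , s)

  unclass : ℤ² → Fin 3 × ℤ²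
  unclass (x , y) = unclassAt y (divMod₃ (x ℤ.- y))

  unclass-class : ∀ q → unclass (class q) ≡ q
  unclass-class (k , (p , s)) = trans
    (cong (unclassAt (p ℤ.- s)) (divMod₃-unique (k , s)
      (solve 3 (λ p s k → (p :+ con (+ 2) :* s :+ k) :- (p :- s) := k :+ con (+ 3) :* s) refl p s (+ toℕ k))))
    (cong (λ x → k , (x , s)) (solve 2 (λ p s → (p :- s) :+ s := p) refl p s))

  class-unclass : ∀ q → class (unclass q) ≡ q
  class-unclass (x , y) = at (divMod₃ (x ℤ.- y)) (compose₃-divMod₃ (x ℤ.- y))
    where
    at : ∀ p → compose₃ p ≡ x ℤ.- y → class (unclassAt y p) ≡ (x , y)
    at (k , s) e = cong₂ _,_
      (trans (solve 3 (λ y s k → (y :+ s) :+ con (+ 2) :* s :+ k := (k :+ con (+ 3) :* s) :+ y) refl y s (+ toℕ k))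
        (trans (cong (ℤ._+ y) e) (solve 2 (λ x y → (x :- y) :+ y := x) refl x y)))
      (solve 2 (λ y s → (y :+ s) :- s := y) refl y s)

  class-weight : ∀ r → Fin 3 → ℤ² → ℕ
  class-weight r k q = coset r (class (k , q))

  gradedClasses : ∀ r → Graded (λ (k , q) → class-weight r k q)
  gradedClasses r = pullback class unclass unclass-class (gradedCoset r)

  gradedClass : ∀ r k → Graded (class-weight r k)
  gradedClass r k = pullback (λ q → class (k , q)) (λ p → proj₂ (unclass p))
    (λ q → cong proj₂ (unclass-class (k , q))) (gradedCoset r)

  private
    cl : ∀ {n} → ℤ → Polynomial n × Polynomial n → Polynomial n × Polynomial n
    cl k (p , s) = p :+ con (+ 2) :* s :+ con k , p :- s

  -- The points with x ≡ y modulo 3 form a copy of the hexagonal lattice enlarged by √3, hence the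
  -- factor 3. The other two classes are enlarged copies of the cosets of sum -1 and -2, and 1 is
  -- their least weight.
  class₀-weight : ∀ q → class-weight 0 zero q ≡ 0 ℕ.+ 3 ℕ.* coset 0 q
  class₀-weight (p , s) = weight-affine (embed 0 (class (zero , (p , s)))) 0 3 (embed 0 (p , s))
    (solve 2 (λ p s → dd (emb (# (+ 0)) (cl (+ 0) (p , s))) := # (+ 0) :+ # (+ 3) :* dd (emb (# (+ 0)) (p , s))) refl p s)

  class₁-weight : ∀ q → class-weight 0 (suc zero) q ≡ 1 ℕ.+ 3 ℕ.* coset 1 q
  class₁-weight (p , s) = weight-affine (embed 0 (class (suc zero , (p , s)))) 1 3 (embed 1 (p , s))
    (solve 2 (λ p s → dd (emb (# (+ 0)) (cl (+ 1) (p , s))) := # (+ 2) :+ # (+ 3) :* dd (emb (# (+ 1)) (p , s))) refl p s)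

  class₂-weight : ∀ q → class-weight 0 (suc (suc zero)) q ≡ 1 ℕ.+ 3 ℕ.* coset 2 q
  class₂-weight (p , s) = weight-affine (embed 0 (class (suc (suc zero) , (p , s)))) 1 3 (embed 2 (p , s))
    (solve 2 (λ p s → dd (emb (# (+ 0)) (cl (+ 2) (p , s))) := # (+ 2) :+ # (+ 3) :* dd (emb (# (+ 2)) (p , s))) refl p s)

  -- On the coset of sum -1 the rotation of coordinates raises x - y by 1 modulo 3 and so permutes
  -- the three classes. These maps are that rotation and its inverse in the coordinates (p , s);
  -- they explain why c is three times an integral series.
  class-0→1 class-1→0 class-2→1 class-1→2 : ℤ² → ℤ²
  class-0→1 (p , s) = ℤ.- (+ 1 ℤ.+ (p ℤ.+ s)) , p
  class-1→0 (p , s) = s , ℤ.- (+ 1 ℤ.+ (p ℤ.+ s))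
  class-2→1 (p , s) = s , ℤ.- (+ 2 ℤ.+ (p ℤ.+ s))
  class-1→2 (p , s) = ℤ.- (+ 2 ℤ.+ (p ℤ.+ s)) , p

  class-0→1-weight : ∀ q → class-weight 1 (suc zero) (class-0→1 q) ≡ class-weight 1 zero q
  class-0→1-weight (p , s) = weight-cong (embed 1 (class (suc zero , class-0→1 (p , s)))) (embed 1 (class (zero , (p , s))))
    (solve 2 (λ p s → dd (emb (# (+ 1)) (cl (+ 1) (:- (# (+ 1) :+ (p :+ s)) , p))) := dd
      (emb (# (+ 1)) (cl (+ 0) (p , s)))) refl p s)

  class-2→1-weight : ∀ q → class-weight 1 (suc zero) (class-2→1 q) ≡ class-weight 1 (suc (suc zero)) q
  class-2→1-weight (p , s) = weight-cong (embed 1 (class (suc zero , class-2→1 (p , s))))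
    (embed 1 (class (suc (suc zero) , (p , s))))
    (solve 2 (λ p s → dd (emb (# (+ 1)) (cl (+ 1) (s , :- (# (+ 2) :+ (p :+ s))))) := dd
      (emb (# (+ 1)) (cl (+ 2) (p , s)))) refl p s)

  class-0→1-inverse : ∀ q → class-1→0 (class-0→1 q) ≡ q
  class-0→1-inverse (p , s) = cong (p ,_) (solve 2 (λ p s → :- (con (+ 1) :+ ((:- (con (+ 1) :+ (p :+ s))) :+ p)) := s)
    refl p s)

  class-1→0-inverse : ∀ q → class-0→1 (class-1→0 q) ≡ q
  class-1→0-inverse (p , s) = cong (_, s) (solve 2 (λ p s → :- (con (+ 1) :+ (s :+ (:- (con (+ 1) :+ (p :+ s))))) := p)
    refl p s)

  class-2→1-inverse : ∀ q → class-1→2 (class-2→1 q) ≡ q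
  class-2→1-inverse (p , s) = cong (_, s) (solve 2 (λ p s → :- (con (+ 2) :+ (s :+ (:- (con (+ 2) :+ (p :+ s))))) := p)
    refl p s)

  class-1→2-inverse : ∀ q → class-2→1 (class-1→2 q) ≡ q
  class-1→2-inverse (p , s) = cong (p ,_) (solve 2 (λ p s → :- (con (+ 2) :+ ((:- (con (+ 2) :+ (p :+ s))) :+ p)) := s)
    refl p s)

  -- Every x ∈ ℤ³ is t (1,1,1) + y, where y has coordinate sum -r with r ∈ {0,1,2}.
  row : Fin 3 × (ℤ × ℤ²) → Cube ℤ
  row (r , (t , p)) = cubeMap (λ k → t ℤ.+ k) (embed (toℕ r) p)

  unrowAt : ℤ² → Fin 3 × ℤ → Fin 3 × (ℤ × ℤ²)
  unrowAt (y , z) (r , d) = r , (ℤ.- d , (y ℤ.+ d , z ℤ.+ d))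

  unrow : Cube ℤ → Fin 3 × (ℤ × ℤ²)
  unrow (x , y , z) = unrowAt (y , z) (divMod₃ (ℤ.- total (x , y , z)))

  row-total : ∀ q → total (row q) ≡ + 3 ℤ.* proj₁ (proj₂ q) ℤ.- + toℕ (proj₁ q)
  row-total (r , (t , (x , y))) = solve 4 (λ r t x y →
    (t :+ (:- (r :+ (x :+ y)))) :+ ((t :+ x) :+ (t :+ y)) := con (+ 3) :* t :- r) refl (+ toℕ r) t x y

  unrow-row : ∀ q → unrow (row q) ≡ q
  unrow-row (r , (t , (x , y))) = trans
    (cong (unrowAt (t ℤ.+ x , t ℤ.+ y)) (divMod₃-unique (r , ℤ.- t) (trans (cong ℤ.-_ (row-total (r , (t , (x , y)))))
      (solve 2 (λ r t → :- (con (+ 3) :* t :- r) := r :+ con (+ 3) :* (:- t)) refl (+ toℕ r) t))))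
    (cong₂ (λ a b → r , (a , b)) (ℤₚ.neg-involutive t) (cong₂ _,_ (cancel x) (cancel y)))
    where
    cancel : ∀ x → (t ℤ.+ x) ℤ.+ (ℤ.- t) ≡ x
    cancel x = solve 2 (λ t x → (t :+ x) :+ (:- t) := x) refl t x

  row-unrow : ∀ v → row (unrow v) ≡ v
  row-unrow (x , y , z) = at (divMod₃ (ℤ.- total (x , y , z))) (compose₃-divMod₃ (ℤ.- total (x , y , z)))
    where
    cancel : ∀ d y → (ℤ.- d) ℤ.+ (y ℤ.+ d) ≡ y
    cancel = solve 2 (λ d y → (:- d) :+ (y :+ d) := y) refl
    at : ∀ p → compose₃ p ≡ ℤ.- total (x , y , z) → row (unrowAt (y , z) p) ≡ (x , y , z)
    at (r , d) e = cong₂ _,_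
      (trans (solve 4 (λ r d y z → (:- d) :+ (:- (r :+ ((y :+ d) :+ (z :+ d)))) := :-
        ((r :+ con (+ 3) :* d) :+ (y :+ z))) refl (+ toℕ r) d y z)
        (trans (cong (λ k → ℤ.- (k ℤ.+ (y ℤ.+ z))) e)
          (solve 3 (λ x y z → :- ((:- (x :+ (y :+ z))) :+ (y :+ z)) := x) refl x y z)))
      (cong₂ _,_ (cancel d y) (cancel d z))

  -- If y has coordinate sum -r, the part of the weight of t (1,1,1) + y depending on t is (3 t² +
  -- (3 - 2 r) t) / 2. Lowering r coordinates of (t,t,t) by one gives a point with exactly this
  -- weight.
  axis : Fin 3 → ℤ → Cube ℤ
  axis zero             t = t , t , t
  axis (suc zero)       t = t ℤ.- + 1 , t , t
  axis (suc (suc zero)) t = t ℤ.- + 1 , t ℤ.- + 1 , t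

  axisWeight : Fin 3 → ℤ → ℕ
  axisWeight r t = weight (axis r t)

  gradedAxis : ∀ r → Graded (axisWeight r)
  gradedAxis r = dominate gradedℤ (last r)
    where
    last : ∀ r t → T t ℕ.≤ axisWeight r t
    last zero             t = ℕₚ.≤-trans (ℕₚ.m≤n+m (T t) (T t)) (ℕₚ.m≤n+m _ (T t))
    last (suc zero)       t = ℕₚ.≤-trans (ℕₚ.m≤n+m (T t) (T t)) (ℕₚ.m≤n+m _ (T (t ℤ.- + 1)))
    last (suc (suc zero)) t = ℕₚ.≤-trans (ℕₚ.m≤n+m (T t) (T (t ℤ.- + 1))) (ℕₚ.m≤n+m _ (T (t ℤ.- + 1)))

  row-weight : ∀ ((r , (t , p)) : Fin 3 × (ℤ × ℤ²)) → weight (row (r , (t , p))) ≡ axisWeight r t ℕ.+ coset (toℕ r) p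
  row-weight (r , (t , (x , y))) = weight-sum (row (r , (t , (x , y)))) (axis r t) (embed (toℕ r) (x , y)) (identity r)
    where
    lhs : Polynomial 3 → Polynomial 3 → Polynomial 3 → Polynomial 3 → Polynomial 3
    lhs r t x y = dd (t :+ (:- (r :+ (x :+ y))) , t :+ x , t :+ y)
    identity : ∀ r → doubled (row (r , (t , (x , y)))) ≡ doubled (axis r t) ℤ.+ doubled (embed (toℕ r) (x , y))
    identity zero = solve 3 (λ t x y → lhs (# (+ 0)) t x y := dd (t , t , t) :+ dd (emb (# (+ 0)) (x , y))) refl t x y
    identity (suc zero) = solve 3 (λ t x y → lhs (# (+ 1)) t x y := dd (t :- # (+ 1) , t , t) :+ dd
      (emb (# (+ 1)) (x , y))) refl t x y
    identity (suc (suc zero)) = solve 3 (λ t x y → lhs (# (+ 2)) t x y :=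
      dd (t :- # (+ 1) , t :- # (+ 1) , t) :+ dd (emb (# (+ 2)) (x , y))) refl t x y

  axisWeights : Cube (Fin 3) → Cube ℤ → ℕ
  axisWeights (r₁ , r₂ , r₃) (t₁ , t₂ , t₃) = axisWeight r₁ t₁ ℕ.+ (axisWeight r₂ t₂ ℕ.+ axisWeight r₃ t₃)

  raise : Cube ℤ → Cube ℤ
  raise = cubeMap (λ k → k ℤ.+ + 1)

  -- When the row totals cancel, the sum of the three parameters is fixed, so they run through a
  -- hexagonal coset again. Equal residues make the three axis forms equal, and the weight becomes a
  -- constant plus three times that of the coset.
  axis-000 : ∀ p → axisWeights (zero , zero , zero) (embed 0 p) ≡ 3 ℕ.* coset 0 p
  axis-000 (x , y) = weight-sum₃ (axis zero (ℤ.- (+ 0 ℤ.+ (x ℤ.+ y)))) (axis zero x) (axis zero y) 0 3 (embed 0 (x , y))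
    (solve 2 (λ x y → let z = :- (# (+ 0) :+ (x :+ y)) in
      dd (z , z , z) :+ (dd (x , x , x) :+ dd (y , y , y)) := # (+ 0) :+ # (+ 3) :* dd (emb (# (+ 0)) (x , y))) refl x y)

  axis-111 : ∀ p → axisWeights (suc zero , suc zero , suc zero) (raise (embed 2 p)) ≡ 2 ℕ.+ 3 ℕ.* coset 2 p
  axis-111 (x , y) = weight-sum₃ (axis (suc zero) (ℤ.- (+ 2 ℤ.+ (x ℤ.+ y)) ℤ.+ + 1)) (axis (suc zero) (x ℤ.+ + 1))
    (axis (suc zero) (y ℤ.+ + 1)) 2 3 (embed 2 (x , y))
    (solve 2 (λ x y → let z = :- (# (+ 2) :+ (x :+ y))
                          a = λ t → dd (t :+ # (+ 1) :- # (+ 1) , t :+ # (+ 1) , t :+ # (+ 1)) in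
      a z :+ (a x :+ a y) := # (+ 4) :+ # (+ 3) :* dd (emb (# (+ 2)) (x , y))) refl x y)

  axis-222 : ∀ p → axisWeights (suc (suc zero) , suc (suc zero) , suc (suc zero)) (raise (embed 1 p)) ≡ 2 ℕ.+ 3 ℕ.*
    coset 1 p
  axis-222 (x , y) = weight-sum₃ (axis (suc (suc zero)) (ℤ.- (+ 1 ℤ.+ (x ℤ.+ y)) ℤ.+ + 1))
    (axis (suc (suc zero)) (x ℤ.+ + 1)) (axis (suc (suc zero)) (y ℤ.+ + 1))
    2 3 (embed 1 (x , y))
    (solve 2 (λ x y → let z = :- (# (+ 1) :+ (x :+ y))
                          a = λ t → dd (t :+ # (+ 1) :- # (+ 1) , t :+ # (+ 1) :- # (+ 1) , t :+ # (+ 1)) in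
      a z :+ (a x :+ a y) := # (+ 4) :+ # (+ 3) :* dd (emb (# (+ 1)) (x , y))) refl x y)

  midpoint : ℤ² → Cube ℤ
  midpoint (p , s) = ℤ.- (+ 1 ℤ.+ (p ℤ.+ s)) , p ℤ.+ + 1 , s ℤ.+ + 1

  -- With distinct residues the linear terms of the axes differ, and the parameters match one
  -- residue class of the coset of sum -1 instead of an enlarged coset. This is how a third of c
  -- enters.
  axis-012 : ∀ q → axisWeights (zero , suc zero , suc (suc zero)) (midpoint q) ≡ 1 ℕ.+ class-weight 1 (suc zero) q
  axis-012 (p , s) = trans
    (weight-sum₃ (axis zero (ℤ.- (+ 1 ℤ.+ (p ℤ.+ s)))) (axis (suc zero) (p ℤ.+ + 1)) (axis (suc (suc zero)) (s ℤ.+ + 1))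
      1 1 (embed 1 (class (suc zero , (p , s))))
      (solve 2 (λ p s → let z = :- (# (+ 1) :+ (p :+ s)); p′ = p :+ # (+ 1); s′ = s :+ # (+ 1) in
        dd (z , z , z) :+ (dd (p′ :- # (+ 1) , p′ , p′) :+ dd (s′ :- # (+ 1) , s′ :- # (+ 1) , s′))
          := # (+ 2) :+ # (+ 1) :* dd (emb (# (+ 1)) (cl (+ 1) (p , s)))) refl p s))
    (cong suc (ℕₚ.*-identityˡ (class-weight 1 (suc zero) (p , s))))

-- The cubic theta functions

module Lattice (R : CommutativeRing 0ℓ 0ℓ) (ζ : CubeRoot R) where

  open import Data.Nat as ℕ using (ℕ; zero; suc)
  open import Data.Integer as ℤ using (ℤ; +_; 0ℤ)
  import Data.Integer.Properties as ℤₚ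
  import Data.Integer.Solver as ℤ-Solver
  open import Data.Fin using (zero; suc; toℕ)
  open import Data.Fin.Patterns using (0F; 1F; 2F)
  open import Data.Product using (_,_; proj₂)
  open import Data.Product.Properties using (≡-dec)
  open import Data.Sum using (_⊎_; inj₁; inj₂)
  open import Function using (_∘_)
  open import Relation.Nullary using (yes; no)
  open import Relation.Binary.PropositionalEquality as ≡ using (_≡_)
  open Grading
  open Maya using (T; gradedℤ)
  open Cubes
  open Hexagonal
  open Charges R ζ public
  import Algebra.Solver.Ring.NaturalCoefficients.Default as NaturalSolver
  open NaturalSolver commutativeSemiring
    using () renaming (solve to solveᴿ; _:=_ to _:=ᴿ_; _:+_ to _:+ᴿ_; _:*_ to _:*ᴿ_; con to conᴿ)
  open NaturalSolver S.commutativeSemiring using (solve; _:=_; _:+_; _:*_; con)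

  one : ∀ {I : Set} → I → Carrier
  one _ = 1#

  scalar : Carrier → Series
  scalar x = term x 0

  scalar-1 : scalar 1# ≋ 𝟏
  scalar-1 n = *-identityˡ _

  scalar-cong : ∀ {x y} → x ≈ y → scalar x ≋ scalar y
  scalar-cong e n = *-congʳ e

  scalar-* : ∀ x y → conv (scalar x) (scalar y) ≋ scalar (x * y)
  scalar-* x y = conv-term x y 0 0

  gf-const : ∀ {I : Set} {w : I → ℕ} (g : Graded w) x → gf g (λ _ → x) ≋ conv (scalar x) (gf g one)
  gf-const g x n = trans (gf-cong g (λ _ → sym (*-identityʳ x)) n) (trans (gf-scale g x one n)
    (sym (trans (conv-scaleˡ x 𝟏 (gf g one) n) (*-congˡ (conv-identityˡ (gf g one) n)))))

  -- coset-series r = ∑ q^(∑ T xᵢ) over x ∈ ℤ³ with coordinate sum -r; the second version has q³ for q.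
  coset-series coset-series³ : ℕ → Series
  coset-series r = gf (gradedCoset r) one
  coset-series³ r = gf (gradedMultiple 2 (gradedCoset r)) one

  reflect-series : coset-series 2 ≋ coset-series 1
  reflect-series = S.sym (reindex (gradedCoset 1) (gradedCoset 2) reflect reflect reflect-involutive
    (inj₁ ∘ reflect-involutive) coset-reflect (λ _ → refl))

  reflect-series³ : coset-series³ 2 ≋ coset-series³ 1
  reflect-series³ = S.sym (reindex (gradedMultiple 2 (gradedCoset 1)) (gradedMultiple 2 (gradedCoset 2))
    reflect reflect reflect-involutive (inj₁ ∘ reflect-involutive) (≡.cong (3 ℕ.*_) ∘ coset-reflect) (λ _ → refl))

  -- In the notation of Borwein and Borwein: a(q), a(q³), c(q³), b(q), and q^(-1/3) c(q), q^(-1/3) c(q) / 3.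
  a A C b c₀ W : Series
  a  = coset-series 0
  A  = coset-series³ 0
  C  = conv (mono 1) (coset-series³ 1)
  b  = gf (gradedCoset 0) (λ (x , y) → ω-power x * (ω-power y * ω-power y))
  c₀ = coset-series 1
  W  = gf (gradedClass 1 1F) one

  class-sum : ∀ r χ → gf (gradedCoset r) χ ≋
    (gf (gradedClass r 0F) (λ q → χ (class (0F , q))) ⊕
    (gf (gradedClass r 1F) (λ q → χ (class (1F , q))) ⊕ gf (gradedClass r 2F) (λ q → χ (class (2F , q)))))
  class-sum r χ = S.trans
    (S.sym (reindex (gradedClasses r) (gradedCoset r) class unclass unclass-class (inj₁ ∘ class-unclass) (λ _ → ≡.refl)
      (λ _ → refl)))
    (S.trans (gf-fibres (≡-dec ℤₚ._≟_ ℤₚ._≟_) (finite 3) (gradedClasses r) (gradedClass r) (χ ∘ class))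
      (S.+-cong S.refl (S.+-cong S.refl (S.+-identityʳ _))))

  ω-power-cube : ∀ i → ω-power i * (ω-power i * ω-power i) ≈ 1#
  ω-power-cube i = trans (*-cong e (*-cong e e)) (trans
    (solveᴿ 2 (λ p n → (p :*ᴿ n) :*ᴿ ((p :*ᴿ n) :*ᴿ (p :*ᴿ n)) :=ᴿ (p :*ᴿ (p :*ᴿ p)) :*ᴿ (n :*ᴿ (n :*ᴿ n))) refl _ _)
    (trans (*-cong (cubes ω-cube (positive i)) (cubes ω̄-cube (negative i))) (*-identityˡ 1#)))
    where
    e = trans (sym (≡⇒≈ (≡.cong ω-power (positive-negative i)))) (ω-power-⊖ (positive i) (negative i))
    ω̄-cube : ω̄ * (ω̄ * ω̄) ≈ 1#
    ω̄-cube = trans (*-congˡ ω̄-square) (trans (*-comm ω̄ ω) ω-cube)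
    cubes : ∀ {x} → x * (x * x) ≈ 1# → ∀ n → x ^ n * (x ^ n * x ^ n) ≈ 1#
    cubes e zero    = trans (*-identityˡ _) (*-identityˡ 1#)
    cubes e (suc n) = trans
      (solveᴿ 2 (λ x p → (x :*ᴿ p) :*ᴿ ((x :*ᴿ p) :*ᴿ (x :*ᴿ p)) :=ᴿ (x :*ᴿ (x :*ᴿ x)) :*ᴿ (p :*ᴿ (p :*ᴿ p))) refl _ _)
      (trans (*-cong e (cubes e n)) (*-identityˡ 1#))

  ω-power-3* : ∀ i → ω-power (+ 3 ℤ.* i) ≈ 1#
  ω-power-3* i = trans (≡⇒≈ (≡.cong ω-power (solveℤ 1 (λ i → k (+ 3) ⊛ i ≔ i ⊹ (i ⊹ i)) ≡.refl i)))
    (trans (ω-power-+ i (i ℤ.+ i)) (trans (*-congˡ (ω-power-+ i i)) (ω-power-cube i)))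
    where open ℤ-Solver.+-*-Solver using () renaming (solve to solveℤ; _:+_ to _⊹_; _:*_ to _⊛_; _:=_ to _≔_; con to k)

  ω-weighted : ∀ x y → ω-power x * (ω-power y * ω-power y) ≈ ω-power (x ℤ.+ (y ℤ.+ y))
  ω-weighted x y = sym (trans (ω-power-+ x (y ℤ.+ y)) (*-congˡ (ω-power-+ y y)))

  ω-mod₃ : ∀ {i} j k → i ≡ j ℤ.+ + 3 ℤ.* k → ω-power i ≈ ω-power j
  ω-mod₃ j k ≡.refl = trans (ω-power-+ j (+ 3 ℤ.* k)) (trans (*-congˡ (ω-power-3* k)) (*-identityʳ _))

  private
    class-series : ∀ k c → (∀ q → class-weight 0 k q ≡ c ℕ.+ 3 ℕ.* coset (toℕ k) q) →
      gf (gradedClass 0 k) one ≋ conv (mono c) (coset-series³ (toℕ k))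
    class-series k c weights = gf-shift (gradedMultiple 2 (gradedCoset (toℕ k))) (gradedClass 0 k) c weights (λ _ → refl)

  class₀-series : gf (gradedClass 0 0F) one ≋ A
  class₀-series = S.trans (class-series 0F 0 class₀-weight) (conv-identityˡ A)

  class₁-series : gf (gradedClass 0 1F) one ≋ C
  class₁-series = class-series 1F 1 class₁-weight

  class₂-series : gf (gradedClass 0 2F) one ≋ C
  class₂-series = S.trans (class-series 2F 1 class₂-weight) (conv-cong S.refl reflect-series³)

  a-split : a ≋ (A ⊕ (C ⊕ C))
  a-split = S.trans (class-sum 0 one) (S.+-cong class₀-series (S.+-cong class₁-series class₂-series))

  ω-scalar ω̄-scalar : Series
  ω-scalar = scalar ω
  ω̄-scalar = scalar ω̄

  scalar-root : (𝟏 ⊕ (ω-scalar ⊕ ω̄-scalar)) ≋ 𝟎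
  scalar-root n = trans (+-congʳ (sym (scalar-1 n)))
    (trans (solveᴿ 4 (λ o w v m → o :*ᴿ m :+ᴿ (w :*ᴿ m :+ᴿ v :*ᴿ m) :=ᴿ (o :+ᴿ (w :+ᴿ v)) :*ᴿ m) refl 1# ω ω̄ (𝟏 n))
      (trans (*-congʳ ω-root) (zeroˡ _)))

  -- Because x + 2 y ≡ x - y modulo 3, the character equals ωᵏ on class k. The classes contribute A,
  -- ω C and ω² C, and ω + ω² = -1.
  b-split : (b ⊕ C) ≋ A
  b-split = S.trans (S.+-congʳ {C} (S.trans (class-sum 0 τ) (S.+-cong
      (S.trans (twist 0F) (S.trans (S.*-cong scalar-1 class₀-series) (S.*-identityˡ A)))
      (S.+-cong
        (S.trans (twist 1F) (S.*-cong (scalar-cong (*-identityʳ ω)) class₁-series))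
        (S.trans (twist 2F) (S.*-cong (scalar-cong (*-congˡ (*-identityʳ ω))) class₂-series))))))
    (S.trans (solve 4 (λ A C o v → (A :+ (o :* C :+ v :* C)) :+ C := A :+ (con 1 :+ (o :+ v)) :* C) S.refl A C ω-scalar
      ω̄-scalar)
      (S.trans (S.+-congˡ {A} (S.trans (S.*-congʳ {C} scalar-root) (S.zeroˡ C))) (S.+-identityʳ A)))
    where
    τ : ℤ² → Carrier
    τ (x , y) = ω-power x * (ω-power y * ω-power y)
    value : ∀ k q → τ (class (k , q)) ≈ ω-power (+ toℕ k)
    value k (p , s) = trans (ω-weighted (p ℤ.+ + 2 ℤ.* s ℤ.+ + toℕ k) (p ℤ.- s)) (ω-mod₃ (+ toℕ k) p
      (solveℤ 3 (λ k p s → (p ⊹ c (+ 2) ⊛ s ⊹ k) ⊹ ((p ⊖ s) ⊹ (p ⊖ s)) ≔ k ⊹ c (+ 3) ⊛ p) ≡.refl (+ toℕ k) p s))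
      where open ℤ-Solver.+-*-Solver using ()
              renaming (solve to solveℤ; _:+_ to _⊹_; _:-_ to _⊖_; _:*_ to _⊛_; _:=_ to _≔_; con to c)
    twist : ∀ k → gf (gradedClass 0 k) (λ q → τ (class (k , q))) ≋ conv (scalar (ω-power (+ toℕ k)))
      (gf (gradedClass 0 k) one)
    twist k = S.trans (gf-cong (gradedClass 0 k) (value k)) (gf-const (gradedClass 0 k) (ω-power (+ toℕ k)))

  c₀-split : c₀ ≋ (W ⊕ (W ⊕ W))
  c₀-split = S.trans (class-sum 1 one) (S.+-cong
    (reindex (gradedClass 1 0F) (gradedClass 1 1F) class-0→1 class-1→0 class-0→1-inverse (inj₁ ∘ class-1→0-inverse)
      class-0→1-weight (λ _ → refl))
    (S.+-cong S.refl
    (reindex (gradedClass 1 2F) (gradedClass 1 1F) class-2→1 class-1→2 class-2→1-inverse (inj₁ ∘ class-1→2-inverse)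
      class-2→1-weight (λ _ → refl))))

  columnTwist : ℤ² → Carrier
  columnTwist (x , y) = ω-power x * (ω-power y * ω-power y)

  -- From x = ω x = ω² x follows 3 x = (1 + ω + ω²) x = 0.
  ω-fixed : ∀ {x} → x ≈ ω * x → x ≈ 0#
  ω-fixed {x} e = torsion-free x (trans (+-congˡ (+-cong e (trans e (*-congˡ e))))
    (trans (solveᴿ 2 (λ x w → x :+ᴿ (w :*ᴿ x :+ᴿ w :*ᴿ (w :*ᴿ x)) :=ᴿ (conᴿ 1 :+ᴿ (w :+ᴿ w :*ᴿ w)) :*ᴿ x) refl x ω)
      (trans (*-congʳ ω-root) (zeroˡ x))))

  -- Rotating the three coordinates multiplies the twist by ωʳ.
  twisted-eigen : ∀ r n → gf (gradedCoset r) columnTwist n ≈ ω-power (+ r) * gf (gradedCoset r) columnTwist n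
  twisted-eigen r n = trans
    (sym (reindex (gradedCoset r) (gradedCoset r) {λ p → ω-power (+ r) * columnTwist p} {columnTwist} (rotate r)
      (unrotate r)
      (unrotate-rotate r) (inj₁ ∘ rotate-unrotate r) (coset-rotate r) character n))
    (gf-scale (gradedCoset r) (ω-power (+ r)) columnTwist n)
    where
    open ℤ-Solver.+-*-Solver using ()
      renaming (solve to solveℤ; _:+_ to _⊹_; :-_ to ⊝_; _:*_ to _⊛_; _:=_ to _≔_; con to c)
    character : ∀ p → columnTwist (rotate r p) ≈ ω-power (+ r) * columnTwist p
    character (x , y) = trans (ω-weighted y z) (trans
      (ω-mod₃ (+ r ℤ.+ (x ℤ.+ (y ℤ.+ y))) (ℤ.- (+ r ℤ.+ (x ℤ.+ y)))
        (solveℤ 3 (λ r x y → y ⊹ ((⊝ (r ⊹ (x ⊹ y))) ⊹ (⊝ (r ⊹ (x ⊹ y)))) ≔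
          (r ⊹ (x ⊹ (y ⊹ y))) ⊹ c (+ 3) ⊛ (⊝ (r ⊹ (x ⊹ y)))) ≡.refl (+ r) x y))
      (trans (ω-power-+ (+ r) (x ℤ.+ (y ℤ.+ y))) (*-congˡ (sym (ω-weighted x y)))))
      where z = ℤ.- (+ r ℤ.+ (x ℤ.+ y))

  twisted-1 : gf (gradedCoset 1) columnTwist ≋ 𝟎
  twisted-1 n = ω-fixed (trans (twisted-eigen 1 n) (*-congʳ (*-identityʳ ω)))

  twisted-2 : gf (gradedCoset 2) columnTwist ≋ 𝟎
  -- The eigenvalue is ω² here; applying the relation twice gives ω⁴ = ω.
  twisted-2 n = ω-fixed (trans e (trans (*-congˡ e) (trans (sym (*-assoc ω̄ ω̄ _)) (*-congʳ ω̄-square))))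
    where e = trans (twisted-eigen 2 n) (*-congʳ (*-congˡ (*-identityʳ ω)))

  gf-twisted : gf (cubeGraded gradedℤ) twisted ≋ b
  gf-twisted = S.sym (reindex (gradedCoset 0) (cubeGraded gradedℤ) (embed 0) proj₂ (λ _ → ≡.refl) inverse (λ _ → ≡.refl)
    (λ (x , y) → trans (*-congʳ (ind-yes (total (embed 0 (x , y)) ℤₚ.≟ 0ℤ) (balance x y))) (*-identityˡ _)))
    where
    open ℤ-Solver.+-*-Solver using ()
      renaming (solve to solveℤ; _:+_ to _⊹_; _:-_ to _⊖_; :-_ to ⊝_; _:*_ to _⊛_; _:=_ to _≔_; con to c)
    balance : ∀ x y → total (embed 0 (x , y)) ≡ 0ℤ
    balance = solveℤ 2 (λ x y → (⊝ (c (+ 0) ⊹ (x ⊹ y))) ⊹ (x ⊹ y) ≔ c 0ℤ) ≡.refl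
    inverse : ∀ v → embed 0 (proj₂ v) ≡ v ⊎ twisted v ≈ 0#
    inverse (x , y , z) with total (x , y , z) ℤₚ.≟ 0ℤ
    ... | no _  = inj₂ (zeroˡ _)
    ... | yes e = inj₁ (≡.cong (_, y , z) (≡.trans
      (solveℤ 3 (λ x y z → ⊝ (c (+ 0) ⊹ (y ⊹ z)) ≔ x ⊖ (x ⊹ (y ⊹ z))) ≡.refl x y z)
      (≡.trans (≡.cong (λ k → x ℤ.- k) e) (solveℤ 1 (λ x → x ⊖ c 0ℤ ≔ x) ≡.refl x))))

-- Splitting the lattice A₈ by the rows of a matrix

module Decomposition (R : CommutativeRing 0ℓ 0ℓ) (ζ : CubeRoot R) where

  open import Data.Nat as ℕ using (ℕ)
  import Data.Nat.Properties as ℕₚ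
  import Data.Nat.Solver as ℕ-Solver
  open import Data.Integer as ℤ using (ℤ; +_; 0ℤ)
  import Data.Integer.Properties as ℤₚ
  import Data.Integer.Solver as ℤ-Solver
  open import Data.Fin using (Fin; toℕ)
  open import Data.Fin.Patterns using (0F; 1F; 2F)
  open import Data.List using (List)
  open import Data.Product using (_×_; _,_; proj₁; proj₂)
  open import Data.Product.Properties using (≡-dec)
  open import Data.Sum using (_⊎_; inj₁; inj₂)
  open import Function using (_∘_)
  open import Relation.Nullary using (yes; no)
  open import Relation.Binary.PropositionalEquality as ≡ using (_≡_; _≢_)
  open Grading
  open Maya using (T; gradedℤ)
  open Cubes
  open Hexagonal
  open Lattice R ζ public
  import Algebra.Solver.Ring.NaturalCoefficients.Default as NaturalSolver
  open NaturalSolver commutativeSemiring using () renaming (solve to solveᴿ; _:=_ to _:=ᴿ_; _:*_ to _:*ᴿ_)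
  open NaturalSolver S.commutativeSemiring using (solve; _:=_; _:+_; _:*_; con)
  open ℤ-Solver.+-*-Solver
    using () renaming (solve to solveℤ; _:+_ to _⊹_; _:-_ to _⊖_; :-_ to ⊝_; _:*_ to _⊛_; _:=_ to _≔_; con to c)

  Residues : Set
  Residues = Cube (Fin 3)

  residueSum : Residues → ℕ
  residueSum = cubeSum toℕ

  rowTotals : Residues → Cube ℤ → Cube ℤ
  rowTotals (r₁ , r₂ , r₃) (t₁ , t₂ , t₃) = + 3 ℤ.* t₁ ℤ.- + toℕ r₁ , + 3 ℤ.* t₂ ℤ.- + toℕ r₂ , + 3 ℤ.* t₃ ℤ.- + toℕ r₃

  axisBalanced : Residues → Cube ℤ → Carrier
  axisBalanced r t = ind (total (rowTotals r t) ℤₚ.≟ 0ℤ)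

  gradedAxes : ∀ r → Graded (axisWeights r)
  gradedAxes (r₁ , r₂ , r₃) = gradedAxis r₁ ⊗ (gradedAxis r₂ ⊗ gradedAxis r₃)

  B : Residues → Series
  B r = gf (gradedAxes r) (axisBalanced r)

  total-rowTotals : ∀ r t → total (rowTotals r t) ≡ + 3 ℤ.* total t ℤ.- + residueSum r
  total-rowTotals (r₁ , r₂ , r₃) (t₁ , t₂ , t₃) = solveℤ 6 (λ r s u x y z →
    (c (+ 3) ⊛ x ⊖ r) ⊹ ((c (+ 3) ⊛ y ⊖ s) ⊹ (c (+ 3) ⊛ z ⊖ u)) ≔ c (+ 3) ⊛ (x ⊹ (y ⊹ z)) ⊖ (r ⊹ (s ⊹ u))) ≡.refl
    (+ toℕ r₁) (+ toℕ r₂) (+ toℕ r₃) t₁ t₂ t₃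

  balanced-residues : ∀ r t → total (rowTotals r t) ≡ 0ℤ → + residueSum r ≡ + 3 ℤ.* total t
  balanced-residues r t e = ≡.sym (ℤₚ.i-j≡0⇒i≡j (+ 3 ℤ.* total t) (+ residueSum r)
    (≡.trans (≡.sym (total-rowTotals r t)) e))

  -- The row totals are 3 tᵢ - rᵢ, so they can cancel only if three divides the sum of the residues.
  B-vanish : ∀ r → proj₁ (divMod₃ (+ residueSum r)) ≢ 0F → B r ≋ 𝟎
  B-vanish r n = gf-zero (gradedAxes r) (λ t → ind-no (total (rowTotals r t) ℤₚ.≟ 0ℤ)
    (λ e → n (≡.cong proj₁ (divMod₃-unique (0F , total t)
      (≡.trans (balanced-residues r t e) (≡.sym (ℤₚ.+-identityˡ (+ 3 ℤ.* total t))))))))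

  -- Balance forces the parameters to have the total `k`, a third of the residue sum. The map `φ`
  -- parametrises that plane, and the indicator vanishes off it.
  B-value : ∀ r k (φ : ℤ² → Cube ℤ) (ψ : Cube ℤ → ℤ²) → + residueSum r ≡ + 3 ℤ.* k →
    (∀ p → ψ (φ p) ≡ p) → (∀ p → total (φ p) ≡ k) → (∀ t → total t ≡ k → φ (ψ t) ≡ t) →
    ∀ {w} (g : Graded w) d → (∀ p → axisWeights r (φ p) ≡ d ℕ.+ w p) → B r ≋ conv (mono d) (gf g one)
  B-value r k φ ψ sum ψφ onto φψ g d weights = S.trans
    (S.sym (reindex (pullback φ ψ ψφ (gradedAxes r)) (gradedAxes r) φ ψ ψφ inverse (λ _ → ≡.refl) character))
    (gf-shift g (pullback φ ψ ψφ (gradedAxes r)) d weights (λ _ → refl))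
    where
    inverse : ∀ t → φ (ψ t) ≡ t ⊎ axisBalanced r t ≈ 0#
    inverse t with total (rowTotals r t) ℤₚ.≟ 0ℤ
    ... | no _  = inj₂ refl
    ... | yes e = inj₁ (φψ t (ℤₚ.*-cancelˡ-≡ (+ 3) (total t) k (≡.trans (≡.sym (balanced-residues r t e)) sum)))
    character : ∀ p → axisBalanced r (φ p) ≈ 1#
    character p = ind-yes (total (rowTotals r (φ p)) ℤₚ.≟ 0ℤ) (≡.trans (total-rowTotals r (φ p))
      (ℤₚ.i≡j⇒i-j≡0 (≡.trans (≡.cong (λ t → + 3 ℤ.* t) (onto p)) (≡.sym sum))))

  lower : Cube ℤ → ℤ²
  lower (_ , y , z) = y ℤ.- + 1 , z ℤ.- + 1

  private
    lower-raise : ∀ x y → (x ℤ.+ + 1 ℤ.- + 1 , y ℤ.+ + 1 ℤ.- + 1) ≡ (x , y)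
    lower-raise x y = ≡.cong₂ _,_ (cancel x) (cancel y)
      where
      cancel : ∀ x → x ℤ.+ + 1 ℤ.- + 1 ≡ x
      cancel = solveℤ 1 (λ x → x ⊹ c (+ 1) ⊖ c (+ 1) ≔ x) ≡.refl
    cancel′ : ∀ x → x ℤ.- + 1 ℤ.+ + 1 ≡ x
    cancel′ = solveℤ 1 (λ x → x ⊖ c (+ 1) ⊹ c (+ 1) ≔ x) ≡.refl

  B-000 : B (0F , 0F , 0F) ≋ A
  B-000 = S.trans (B-value (0F , 0F , 0F) 0ℤ (embed 0) proj₂ ≡.refl (λ _ → ≡.refl)
      (λ (x , y) → solveℤ 2 (λ x y → (⊝ (c (+ 0) ⊹ (x ⊹ y))) ⊹ (x ⊹ y) ≔ c 0ℤ) ≡.refl x y)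
      (λ (x , y , z) e → ≡.cong (_, y , z) (≡.trans
        (solveℤ 3 (λ x y z → ⊝ (c (+ 0) ⊹ (y ⊹ z)) ≔ x ⊖ (x ⊹ (y ⊹ z))) ≡.refl x y z)
        (≡.trans (≡.cong (λ k → x ℤ.- k) e) (solveℤ 1 (λ x → x ⊖ c 0ℤ ≔ x) ≡.refl x))))
      (gradedMultiple 2 (gradedCoset 0)) 0 axis-000)
    (conv-identityˡ A)

  B-111 : B (1F , 1F , 1F) ≋ conv (mono 2) (coset-series³ 2)
  B-111 = B-value (1F , 1F , 1F) (+ 1) (raise ∘ embed 2) lower ≡.refl (λ (x , y) → lower-raise x y)
    (λ (x , y) → solveℤ 2 (λ x y → ((⊝ (c (+ 2) ⊹ (x ⊹ y))) ⊹ c (+ 1)) ⊹ ((x ⊹ c (+ 1)) ⊹ (y ⊹ c (+ 1))) ≔ c (+ 1))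
      ≡.refl x y)
    (λ (x , y , z) e → ≡.cong₂ _,_ (≡.trans
      (solveℤ 3 (λ x y z → (⊝ (c (+ 2) ⊹ ((y ⊖ c (+ 1)) ⊹ (z ⊖ c (+ 1))))) ⊹ c (+ 1) ≔ x ⊹ (c (+ 1) ⊖ (x ⊹ (y ⊹ z))))
        ≡.refl x y z)
      (≡.trans (≡.cong (λ k → x ℤ.+ (+ 1 ℤ.- k)) e) (ℤₚ.+-identityʳ x))) (≡.cong₂ _,_ (cancel′ y) (cancel′ z)))
    (gradedMultiple 2 (gradedCoset 2)) 2 axis-111

  B-222 : B (2F , 2F , 2F) ≋ conv (mono 2) (coset-series³ 1)
  B-222 = B-value (2F , 2F , 2F) (+ 2) (raise ∘ embed 1) lower ≡.refl (λ (x , y) → lower-raise x y)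
    (λ (x , y) → solveℤ 2 (λ x y → ((⊝ (c (+ 1) ⊹ (x ⊹ y))) ⊹ c (+ 1)) ⊹ ((x ⊹ c (+ 1)) ⊹ (y ⊹ c (+ 1))) ≔ c (+ 2))
      ≡.refl x y)
    (λ (x , y , z) e → ≡.cong₂ _,_ (≡.trans
      (solveℤ 3 (λ x y z → (⊝ (c (+ 1) ⊹ ((y ⊖ c (+ 1)) ⊹ (z ⊖ c (+ 1))))) ⊹ c (+ 1) ≔ x ⊹ (c (+ 2) ⊖ (x ⊹ (y ⊹ z))))
        ≡.refl x y z)
      (≡.trans (≡.cong (λ k → x ℤ.+ (+ 2 ℤ.- k)) e) (ℤₚ.+-identityʳ x))) (≡.cong₂ _,_ (cancel′ y) (cancel′ z)))
    (gradedMultiple 2 (gradedCoset 1)) 2 axis-222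

  Bₘ : Series
  Bₘ = conv (mono 1) W

  B-012 : B (0F , 1F , 2F) ≋ Bₘ
  B-012 = B-value (0F , 1F , 2F) (+ 1) midpoint lower ≡.refl (λ (x , y) → lower-raise x y)
    (λ (x , y) → solveℤ 2 (λ x y → (⊝ (c (+ 1) ⊹ (x ⊹ y))) ⊹ ((x ⊹ c (+ 1)) ⊹ (y ⊹ c (+ 1))) ≔ c (+ 1)) ≡.refl x y)
    (λ (x , y , z) e → ≡.cong₂ _,_ (≡.trans
      (solveℤ 3 (λ x y z → ⊝ (c (+ 1) ⊹ ((y ⊖ c (+ 1)) ⊹ (z ⊖ c (+ 1)))) ≔ x ⊹ (c (+ 1) ⊖ (x ⊹ (y ⊹ z)))) ≡.refl x y z)
      (≡.trans (≡.cong (λ k → x ℤ.+ (+ 1 ℤ.- k)) e) (ℤₚ.+-identityʳ x))) (≡.cong₂ _,_ (cancel′ y) (cancel′ z)))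
    (gradedClass 1 1F) 1 axis-012

  private
    ℕ-swap : ∀ x y z → y ℕ.+ (x ℕ.+ z) ≡ x ℕ.+ (y ℕ.+ z)
    ℕ-swap = solveℕ 3 (λ x y z → y ⊞ (x ⊞ z) ≔′ x ⊞ (y ⊞ z)) ≡.refl
      where open ℕ-Solver.+-*-Solver using () renaming (solve to solveℕ; _:+_ to _⊞_; _:=_ to _≔′_)
    ℤ-swap : ∀ x y z → y ℤ.+ (x ℤ.+ z) ≡ x ℤ.+ (y ℤ.+ z)
    ℤ-swap = solveℤ 3 (λ x y z → y ⊹ (x ⊹ z) ≔ x ⊹ (y ⊹ z)) ≡.refl

  B-swap₁₂ : ∀ r s u → B (s , r , u) ≋ B (r , s , u)
  B-swap₁₂ r s u = reindex (gradedAxes (s , r , u)) (gradedAxes (r , s , u)) flip flip (λ _ → ≡.refl) (λ _ → inj₁ ≡.refl)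
    (λ (x , y , z) → ℕ-swap (axisWeight s x) (axisWeight r y) (axisWeight u z))
    (λ (x , y , z) → ≡⇒≈ (≡.cong (λ t → ind (t ℤₚ.≟ 0ℤ))
      (ℤ-swap (+ 3 ℤ.* x ℤ.- + toℕ s) (+ 3 ℤ.* y ℤ.- + toℕ r) (+ 3 ℤ.* z ℤ.- + toℕ u))))
    where
    flip : Cube ℤ → Cube ℤ
    flip (x , y , z) = y , x , z

  B-swap₂₃ : ∀ r s u → B (r , u , s) ≋ B (r , s , u)
  B-swap₂₃ r s u = reindex (gradedAxes (r , u , s)) (gradedAxes (r , s , u)) flip flip (λ _ → ≡.refl) (λ _ → inj₁ ≡.refl)
    (λ (x , y , z) → ≡.cong (axisWeight r x ℕ.+_) (ℕₚ.+-comm (axisWeight s z) (axisWeight u y)))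
    (λ (x , y , z) → ≡⇒≈ (≡.cong (λ t → ind ((+ 3 ℤ.* x ℤ.- + toℕ r) ℤ.+ t ℤₚ.≟ 0ℤ))
      (ℤₚ.+-comm (+ 3 ℤ.* z ℤ.- + toℕ s) (+ 3 ℤ.* y ℤ.- + toℕ u))))
    where
    flip : Cube ℤ → Cube ℤ
    flip (x , y , z) = x , z , y

  B-021 : B (0F , 2F , 1F) ≋ Bₘ
  B-021 = S.trans (B-swap₂₃ 0F 1F 2F) B-012

  B-102 : B (1F , 0F , 2F) ≋ Bₘ
  B-102 = S.trans (B-swap₁₂ 0F 1F 2F) B-012

  B-120 : B (1F , 2F , 0F) ≋ Bₘ
  B-120 = S.trans (B-swap₂₃ 1F 0F 2F) B-102

  B-201 : B (2F , 0F , 1F) ≋ Bₘ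
  B-201 = S.trans (B-swap₁₂ 0F 2F 1F) B-021

  B-210 : B (2F , 1F , 0F) ≋ Bₘ
  B-210 = S.trans (B-swap₁₂ 1F 2F 0F) B-120

  residues : List Residues
  residues = Graded.cover (cubeGraded (finite 3)) 0

  D : Series
  D = conv (mono 1) C

  D-value : ∀ r → coset-series³ r ≋ coset-series³ 1 → conv (mono 2) (coset-series³ r) ≋ D
  D-value r e = S.trans (conv-cong (S.sym (conv-mono 1 1)) e) (S.*-assoc (mono 1) (mono 1) (coset-series³ 1))

  -- Among the 27 residue triples only the three constant ones and the six permutations of (0,1,2)
  -- have a sum divisible by three. By symmetry the permutations share one axis series, and (1,1,1)
  -- and (2,2,2) share another by reflection.
  collapse : ∀ (Z : Residues → Series) → PS.∑ residues (λ r → conv (B r) (Z r)) ≋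
    (conv A (Z (0F , 0F , 0F)) ⊕ (conv Bₘ ((Z (0F , 1F , 2F) ⊕ (Z (0F , 2F , 1F) ⊕ Z (1F , 0F , 2F)))
      ⊕ (Z (1F , 2F , 0F) ⊕ (Z (2F , 0F , 1F) ⊕ Z (2F , 1F , 0F)))) ⊕ conv D (Z (1F , 1F , 1F) ⊕ Z (2F , 2F , 2F))))
  collapse Z = S.trans (PS.∑-cong residues {λ r → conv (B r) (Z r)} {h} same)
    -- The zeros are the eighteen vanishing triples, in the order in which `residues` lists all 27,
    -- and the end of the sum.
    (solve 12 (λ a b d p q r s t u v w z → let o = con 0 in
      a :* p :+ (o :+ (o :+ (o :+ (o :+ (b :* q :+ (o :+ (b :* r :+ (o :+
      (o :+ (o :+ (b :* s :+ (o :+ (d :* t :+ (o :+ (b :* u :+ (o :+ (o :+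
      (o :+ (b :* v :+ (o :+ (b :* w :+ (o :+ (o :+ (o :+ (o :+ (d :* z :+ o))))))))))))))))))))))))))
      := a :* p :+ (b :* ((q :+ (r :+ s)) :+ (u :+ (v :+ w))) :+ d :* (t :+ z)))
      S.refl A Bₘ D (Z (0F , 0F , 0F)) (Z (0F , 1F , 2F)) (Z (0F , 2F , 1F)) (Z (1F , 0F , 2F)) (Z (1F , 1F , 1F))
        (Z (1F , 2F , 0F)) (Z (2F , 0F , 1F)) (Z (2F , 1F , 0F)) (Z (2F , 2F , 2F)))
    where
    h : Residues → Series
    h (0F , 0F , 0F) = conv A (Z (0F , 0F , 0F))
    h (0F , 1F , 2F) = conv Bₘ (Z (0F , 1F , 2F))
    h (0F , 2F , 1F) = conv Bₘ (Z (0F , 2F , 1F))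
    h (1F , 0F , 2F) = conv Bₘ (Z (1F , 0F , 2F))
    h (1F , 1F , 1F) = conv D (Z (1F , 1F , 1F))
    h (1F , 2F , 0F) = conv Bₘ (Z (1F , 2F , 0F))
    h (2F , 0F , 1F) = conv Bₘ (Z (2F , 0F , 1F))
    h (2F , 1F , 0F) = conv Bₘ (Z (2F , 1F , 0F))
    h (2F , 2F , 2F) = conv D (Z (2F , 2F , 2F))
    h _              = 𝟎
    vanish : ∀ r → proj₁ (divMod₃ (+ residueSum r)) ≢ 0F → conv (B r) (Z r) ≋ 𝟎
    vanish r n = S.trans (S.*-congʳ {Z r} (B-vanish r n)) (S.zeroˡ (Z r))
    same : ∀ r → conv (B r) (Z r) ≋ h r
    same (0F , 0F , 0F) = S.*-congʳ {Z (0F , 0F , 0F)} B-000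
    same (0F , 1F , 2F) = S.*-congʳ {Z (0F , 1F , 2F)} B-012
    same (0F , 2F , 1F) = S.*-congʳ {Z (0F , 2F , 1F)} B-021
    same (1F , 0F , 2F) = S.*-congʳ {Z (1F , 0F , 2F)} B-102
    same (1F , 1F , 1F) = S.*-congʳ {Z (1F , 1F , 1F)} (S.trans B-111 (D-value 2 reflect-series³))
    same (1F , 2F , 0F) = S.*-congʳ {Z (1F , 2F , 0F)} B-120
    same (2F , 0F , 1F) = S.*-congʳ {Z (2F , 0F , 1F)} B-201
    same (2F , 1F , 0F) = S.*-congʳ {Z (2F , 1F , 0F)} B-210
    same (2F , 2F , 2F) = S.*-congʳ {Z (2F , 2F , 2F)} (S.trans B-222 (D-value 1 S.refl))
    same r@(0F , 0F , 1F) = vanish r (λ ())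
    same r@(0F , 0F , 2F) = vanish r (λ ())
    same r@(0F , 1F , 0F) = vanish r (λ ())
    same r@(0F , 1F , 1F) = vanish r (λ ())
    same r@(0F , 2F , 0F) = vanish r (λ ())
    same r@(0F , 2F , 2F) = vanish r (λ ())
    same r@(1F , 0F , 0F) = vanish r (λ ())
    same r@(1F , 0F , 1F) = vanish r (λ ())
    same r@(1F , 1F , 0F) = vanish r (λ ())
    same r@(1F , 1F , 2F) = vanish r (λ ())
    same r@(1F , 2F , 1F) = vanish r (λ ())
    same r@(1F , 2F , 2F) = vanish r (λ ())
    same r@(2F , 0F , 0F) = vanish r (λ ())
    same r@(2F , 0F , 2F) = vanish r (λ ())
    same r@(2F , 1F , 1F) = vanish r (λ ())
    same r@(2F , 1F , 2F) = vanish r (λ ())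
    same r@(2F , 2F , 0F) = vanish r (λ ())
    same r@(2F , 2F , 1F) = vanish r (λ ())

  gradedℤ⁹ : Graded (cubeSum (cubeSum T))
  gradedℤ⁹ = cubeGraded (cubeGraded gradedℤ)

  module _ (χ₁ χ₂ χ₃ : Cube ℤ → Carrier) (ψ₁ ψ₂ ψ₃ : Fin 3 → ℤ² → Carrier)
    (inv₁ : ∀ r t p → χ₁ (row (r , (t , p))) ≈ ψ₁ r p)
    (inv₂ : ∀ r t p → χ₂ (row (r , (t , p))) ≈ ψ₂ r p)
    (inv₃ : ∀ r t p → χ₃ (row (r , (t , p))) ≈ ψ₃ r p) where

    -- The hypotheses make each row character invariant under translation by (1,1,1). The parameters
    -- t then enter only through the balance condition and separate off as `B`, leaving one
    -- hexagonal coset for each row.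
    decompose : gf gradedℤ⁹ (λ (x , y , z) → balanced (x , y , z) * (χ₁ x * (χ₂ y * χ₃ z))) ≋
      PS.∑ residues (λ (r , s , u) → conv (B (r , s , u))
        (conv (gf (gradedCoset (toℕ r)) (ψ₁ r)) (conv (gf (gradedCoset (toℕ s)) (ψ₂ s)) (gf (gradedCoset (toℕ u)) (ψ₃ u)))))
    decompose = S.trans
      (S.sym (reindex fibred gradedℤ⁹ rows unrows unrows-rows (inj₁ ∘ rows-unrows) weights character))
      (S.trans (gf-fibres (≡-dec cube≟ℤ cube≟ℤ²) (cubeGraded (finite 3)) fibred fibre _)
        (PS.∑-cong residues factorise))
      where
      Index : Set
      Index = Cube ℤ × Cube ℤ²
      cube≟ℤ = Graded._≟_ (cubeGraded gradedℤ)
      cube≟ℤ² = Graded._≟_ (cubeGraded (gradedCoset 0))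
      rows : Residues × Index → Cube (Cube ℤ)
      rows ((r , s , u) , ((t₁ , t₂ , t₃) , (p₁ , p₂ , p₃))) = row (r , (t₁ , p₁)) , row (s , (t₂ , p₂)) , row
        (u , (t₃ , p₃))
      assemble : Cube (Fin 3 × (ℤ × ℤ²)) → Residues × Index
      assemble ((r , (t₁ , p₁)) , (s , (t₂ , p₂)) , (u , (t₃ , p₃))) = (r , s , u) , ((t₁ , t₂ , t₃) , (p₁ , p₂ , p₃))
      unrows : Cube (Cube ℤ) → Residues × Index
      unrows v = assemble (cubeMap unrow v)
      unrows-rows : ∀ q → unrows (rows q) ≡ q
      unrows-rows ((r , s , u) , ((t₁ , t₂ , t₃) , (p₁ , p₂ , p₃))) = ≡.cong assemble
        (≡.cong₂ _,_ (unrow-row (r , (t₁ , p₁))) (≡.cong₂ _,_ (unrow-row (s , (t₂ , p₂))) (unrow-row (u , (t₃ , p₃)))))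
      rows-unrows : ∀ v → rows (unrows v) ≡ v
      rows-unrows (x , y , z) = ≡.cong₂ _,_ (row-unrow x) (≡.cong₂ _,_ (row-unrow y) (row-unrow z))
      fibreWeight : Residues × Index → ℕ
      fibreWeight ((r , s , u) , (t , (p₁ , p₂ , p₃))) =
        axisWeights (r , s , u) t ℕ.+ (coset (toℕ r) p₁ ℕ.+ (coset (toℕ s) p₂ ℕ.+ coset (toℕ u) p₃))
      weights : ∀ q → cubeSum (cubeSum T) (rows q) ≡ fibreWeight q
      weights ((r , s , u) , ((t₁ , t₂ , t₃) , (p₁ , p₂ , p₃))) = ≡.trans
        (≡.cong₂ ℕ._+_ (row-weight (r , (t₁ , p₁)))
          (≡.cong₂ ℕ._+_ (row-weight (s , (t₂ , p₂))) (row-weight (u , (t₃ , p₃)))))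
        (solveℕ 6 (λ a b c x y z → (a ⊞ x) ⊞ ((b ⊞ y) ⊞ (c ⊞ z)) ≔′ (a ⊞ (b ⊞ c)) ⊞ (x ⊞ (y ⊞ z))) ≡.refl
          (axisWeight r t₁) (axisWeight s t₂) (axisWeight u t₃) (coset (toℕ r) p₁) (coset (toℕ s) p₂) (coset (toℕ u) p₃))
        where open ℕ-Solver.+-*-Solver using () renaming (solve to solveℕ; _:+_ to _⊞_; _:=_ to _≔′_)
      fibred : Graded fibreWeight
      fibred = dominate (pullback rows unrows unrows-rows gradedℤ⁹) (ℕₚ.≤-reflexive ∘ weights)
      cosets : ∀ ((r , s , u) : Residues) → Graded (λ ((p₁ , p₂ , p₃) : Cube ℤ²) →
        coset (toℕ r) p₁ ℕ.+ (coset (toℕ s) p₂ ℕ.+ coset (toℕ u) p₃))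
      cosets (r , s , u) = gradedCoset (toℕ r) ⊗ (gradedCoset (toℕ s) ⊗ gradedCoset (toℕ u))
      fibre : ∀ r → Graded (λ i → fibreWeight (r , i))
      fibre r = gradedAxes r ⊗ cosets r
      χ : Residues × Index → Carrier
      χ ((r , s , u) , (t , (p₁ , p₂ , p₃))) = axisBalanced (r , s , u) t * (ψ₁ r p₁ * (ψ₂ s p₂ * ψ₃ u p₃))
      character : ∀ q → balanced (rows q) * (χ₁ (proj₁ (rows q)) *
        (χ₂ (proj₁ (proj₂ (rows q))) * χ₃ (proj₂ (proj₂ (rows q))))) ≈ χ q
      character ((r , s , u) , ((t₁ , t₂ , t₃) , (p₁ , p₂ , p₃))) = *-cong
        (≡⇒≈ (≡.cong (λ k → ind (k ℤₚ.≟ 0ℤ)) (≡.cong₂ ℤ._+_ (row-total (r , (t₁ , p₁)))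
          (≡.cong₂ ℤ._+_ (row-total (s , (t₂ , p₂))) (row-total (u , (t₃ , p₃)))))))
        (*-cong (inv₁ r t₁ p₁) (*-cong (inv₂ s t₂ p₂) (inv₃ u t₃ p₃)))
      factorise : ∀ r → gf (fibre r) (λ i → χ (r , i)) ≋ _
      factorise (r , s , u) = S.trans
        (gf-⊗ (gradedAxes (r , s , u)) (cosets (r , s , u)) (axisBalanced (r , s , u))
          (λ (p₁ , p₂ , p₃) → ψ₁ r p₁ * (ψ₂ s p₂ * ψ₃ u p₃)))
        (conv-cong S.refl (S.trans
          (gf-⊗ (gradedCoset (toℕ r)) (gradedCoset (toℕ s) ⊗ gradedCoset (toℕ u)) (ψ₁ r) (λ (p₂ , p₃) → ψ₂ s p₂ * ψ₃ u p₃))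
          (conv-cong S.refl (gf-⊗ (gradedCoset (toℕ s)) (gradedCoset (toℕ u)) (ψ₂ s) (ψ₃ u)))))

  V : Series
  V = conv a (conv c₀ c₀)

  private
    cosetSeries : Fin 3 → Series
    cosetSeries 0F = a
    cosetSeries 1F = c₀
    cosetSeries 2F = c₀

    untwistedSeries : ∀ r → gf (gradedCoset (toℕ r)) one ≋ cosetSeries r
    untwistedSeries 0F = S.refl
    untwistedSeries 1F = S.refl
    untwistedSeries 2F = reflect-series

    scaledSeries : ∀ r x → gf (gradedCoset (toℕ r)) (λ _ → x) ≋ conv (scalar x) (cosetSeries r)
    scaledSeries r x = S.trans (gf-const (gradedCoset (toℕ r)) x) (conv-cong S.refl (untwistedSeries r))

  -- The sum of six ones counts the permutations of (0,1,2), each contributing a c₀²; the two copies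
  -- of c₀³ belong to the residues (1,1,1) and (2,2,2).
  theta : gf gradedℤ⁹ balanced ≋ (conv A (cube a) ⊕
    (conv Bₘ (conv (𝟏 ⊕ (𝟏 ⊕ (𝟏 ⊕ (𝟏 ⊕ (𝟏 ⊕ 𝟏))))) V) ⊕ conv D (cube c₀ ⊕ cube c₀)))
  theta = S.trans (gf-cong gradedℤ⁹ (λ v → sym
    (trans (*-congˡ (trans (*-identityˡ _) (*-identityˡ 1#))) (*-identityʳ (balanced v)))))
    (S.trans (decompose one one one (λ _ → one) (λ _ → one) (λ _ → one) (λ _ _ _ → refl) (λ _ _ _ → refl) (λ _ _ _ → refl))
    (S.trans (PS.∑-cong residues (λ (r , s , u) → conv-cong (S.refl {B (r , s , u)})
      (conv-cong (untwistedSeries r) (conv-cong (untwistedSeries s) (untwistedSeries u)))))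
    (S.trans (collapse (λ (r , s , u) → conv (cosetSeries r) (conv (cosetSeries s) (cosetSeries u))))
      (solve 5 (λ A b d a c → let i = con 1 in
        A :* (a :* (a :* a)) :+ (b :* ((a :* (c :* c) :+ (a :* (c :* c) :+ c :* (a :* c))) :+
          (c :* (c :* a) :+ (c :* (a :* c) :+ c :* (c :* a))))
          :+ d :* (c :* (c :* c) :+ c :* (c :* c)))
        := A :* (a :* (a :* a)) :+ (b :* ((i :+ (i :+ (i :+ (i :+ (i :+ i))))) :* (a :* (c :* c))) :+ d :*
          (c :* (c :* c) :+ c :* (c :* c))))
        S.refl A Bₘ D a c₀))))

  column : Cube ℤ → Carrier
  column (x , y , z) = ω-power y * (ω-power z * ω-power z)

  column-row : ∀ r t p → column (row (r , (t , p))) ≈ columnTwist p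
  column-row r t (x , y) = trans (ω-weighted (t ℤ.+ x) (t ℤ.+ y)) (trans
    (ω-mod₃ (x ℤ.+ (y ℤ.+ y)) t (solveℤ 3 (λ t x y → (t ⊹ x) ⊹ ((t ⊹ y) ⊹ (t ⊹ y)) ≔ (x ⊹ (y ⊹ y)) ⊹ c (+ 3) ⊛ t) ≡.refl
      t x y))
    (sym (ω-weighted x y)))

  -- Restricted to a row, the twist is a character whose sum over the cosets of sum -1 and -2 is
  -- zero by rotation, so only the residues (0,0,0) survive.
  theta-columns : gf gradedℤ⁹ (λ (x , y , z) → balanced (x , y , z) * (column x * (column y * column z))) ≋ conv A (cube b)
  theta-columns = S.trans (decompose column column column (λ _ → columnTwist) (λ _ → columnTwist) (λ _ → columnTwist)
      column-row column-row column-row)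
    (S.trans (PS.∑-cong residues (λ (r , s , u) → conv-cong (S.refl {B (r , s , u)})
      (conv-cong (twistedSeries r) (conv-cong (twistedSeries s) (twistedSeries u)))))
    (S.trans (collapse (λ (r , s , u) → conv (Z r) (conv (Z s) (Z u))))
      (solve 4 (λ A m d b → let o = con 0 in
        A :* (b :* (b :* b)) :+ (m :* ((b :* (o :* o) :+ (b :* (o :* o) :+ o :* (b :* o))) :+
          (o :* (o :* b) :+ (o :* (b :* o) :+ o :* (o :* b))))
          :+ d :* (o :* (o :* o) :+ o :* (o :* o))) := A :* (b :* (b :* b))) S.refl A Bₘ D b)))
    where
    Z : Fin 3 → Series
    Z 0F = b
    Z 1F = 𝟎
    Z 2F = 𝟎
    twistedSeries : ∀ r → gf (gradedCoset (toℕ r)) columnTwist ≋ Z r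
    twistedSeries 0F = S.refl
    twistedSeries 1F = twisted-1
    twistedSeries 2F = twisted-2

  rowTwist : Cube ℤ → Carrier
  rowTwist (x , y , z) = ω-power x * (ω-power y * ω-power z)

  rowTwist-row : ∀ r t p → rowTwist (row (r , (t , p))) ≈ ω-power (ℤ.- + toℕ r)
  rowTwist-row r t p = trans (sym (trans (ω-power-+ x (y ℤ.+ z)) (*-congˡ (ω-power-+ y z))))
    (ω-mod₃ (ℤ.- + toℕ r) t (≡.trans (row-total (r , (t , p))) (ℤₚ.+-comm (+ 3 ℤ.* t) (ℤ.- + toℕ r))))
    where
    x = proj₁ (row (r , (t , p)))
    y = proj₁ (proj₂ (row (r , (t , p))))
    z = proj₂ (proj₂ (row (r , (t , p))))

  -- On a row with residue r the twist is the constant ω⁻ʳ, or its square in the third row. Over the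
  -- permutations of (0,1,2) these constants add up to -3, compensated by the three ones on the
  -- left; for (1,1,1) and (2,2,2) they multiply to 1.
  theta-rows : (gf gradedℤ⁹ (λ (x , y , z) → balanced (x , y , z) * (1# * (rowTwist y * (rowTwist z * rowTwist z))))
      ⊕ conv (𝟏 ⊕ (𝟏 ⊕ 𝟏)) (conv Bₘ V)) ≋ (conv A (cube a) ⊕ conv D (cube c₀ ⊕ cube c₀))
  theta-rows = S.trans (S.+-congʳ {conv (𝟏 ⊕ (𝟏 ⊕ 𝟏)) (conv Bₘ V)} (S.trans
      (decompose one rowTwist (λ v → rowTwist v * rowTwist v)
        (λ _ → one) (λ r _ → ω-power (ℤ.- + toℕ r)) (λ r _ → ω-power (ℤ.- + toℕ r) * ω-power (ℤ.- + toℕ r))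
        (λ _ _ _ → refl) rowTwist-row (λ r t p → *-cong (rowTwist-row r t p) (rowTwist-row r t p)))
      (S.trans (PS.∑-cong residues (λ (r , s , u) → conv-cong (S.refl {B (r , s , u)})
        (conv-cong (untwistedSeries r) (conv-cong (second s) (third u)))))
      (collapse (λ (r , s , u) → conv (cosetSeries r)
        (conv (conv (x₂ s) (cosetSeries s)) (conv (x₃ u) (cosetSeries u))))))))
    (S.trans (solve 7 (λ A m d a c o v → let i = con 1 in
        (A :* (a :* ((i :* a) :* (i :* a))) :+ (m :*
          ((a :* ((v :* c) :* (v :* c)) :+ (a :* ((o :* c) :* (o :* c)) :+ c :* ((i :* a) :* (v :* c))))
            :+ (c :* ((o :* c) :* (i :* a)) :+ (c :* ((i :* a) :* (o :* c)) :+ c :* ((v :* c) :* (i :* a)))))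
          :+ d :* (c :* ((v :* c) :* (o :* c)) :+ c :* ((o :* c) :* (v :* c))))) :+ (i :+ (i :+ i)) :*
            (m :* (a :* (c :* c)))
        := A :* (a :* (a :* a)) :+ (m :* (((i :+ (v :* v :+ o :* o)) :+ ((i :+ (o :+ v)) :+ (i :+ (o :+ v)))) :*
          (a :* (c :* c)))
          :+ d :* ((o :* v) :* (c :* (c :* c)) :+ (o :* v) :* (c :* (c :* c)))))
        S.refl A Bₘ D a c₀ ω-scalar ω̄-scalar)
      (S.+-congˡ {conv A (cube a)} (S.trans (S.+-cong
        (S.trans (S.*-congˡ {Bₘ} (S.trans (S.*-congʳ {V} zeros) (S.zeroˡ V))) (S.zeroʳ Bₘ))
        (S.*-congˡ {D} (S.+-cong unitary unitary))) (S.+-identityˡ (conv D (cube c₀ ⊕ cube c₀))))))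
    where
    o v : Series
    o = ω-scalar
    v = ω̄-scalar
    x₂ x₃ : Fin 3 → Series
    x₂ 0F = 𝟏
    x₂ 1F = v
    x₂ 2F = o
    x₃ 0F = 𝟏
    x₃ 1F = o
    x₃ 2F = v
    e₁ : ω-power (ℤ.- + 1) ≈ ω̄
    e₁ = *-identityʳ ω̄
    e₂ : ω-power (ℤ.- + 2) ≈ ω
    e₂ = trans (*-congˡ (*-identityʳ ω̄)) ω̄-square
    second : ∀ r → gf (gradedCoset (toℕ r)) (λ _ → ω-power (ℤ.- + toℕ r)) ≋ conv (x₂ r) (cosetSeries r)
    second r = S.trans (scaledSeries r (ω-power (ℤ.- + toℕ r))) (S.*-congʳ {cosetSeries r} (value r))
      where
      value : ∀ r → scalar (ω-power (ℤ.- + toℕ r)) ≋ x₂ r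
      value 0F = scalar-1
      value 1F = scalar-cong e₁
      value 2F = scalar-cong e₂
    third : ∀ r → gf (gradedCoset (toℕ r)) (λ _ → ω-power (ℤ.- + toℕ r) * ω-power (ℤ.- + toℕ r)) ≋ conv (x₃ r)
      (cosetSeries r)
    third r = S.trans (scaledSeries r (ω-power (ℤ.- + toℕ r) * ω-power (ℤ.- + toℕ r))) (S.*-congʳ {cosetSeries r} (value r))
      where
      value : ∀ r → scalar (ω-power (ℤ.- + toℕ r) * ω-power (ℤ.- + toℕ r)) ≋ x₃ r
      value 0F = S.trans (scalar-cong (*-identityˡ 1#)) scalar-1
      value 1F = scalar-cong (trans (*-cong e₁ e₁) ω̄-square)
      value 2F = scalar-cong (*-cong e₂ e₂)
    zeros : ((𝟏 ⊕ (conv v v ⊕ conv o o)) ⊕ ((𝟏 ⊕ (o ⊕ v)) ⊕ (𝟏 ⊕ (o ⊕ v)))) ≋ 𝟎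
    zeros = S.trans (S.+-cong
        (S.trans (S.+-congˡ {𝟏} (S.+-cong (S.trans (scalar-* ω̄ ω̄) (scalar-cong ω̄-square)) (scalar-* ω ω))) scalar-root)
        (S.trans (S.+-cong scalar-root scalar-root) (S.+-identityˡ 𝟎)))
      (S.+-identityˡ 𝟎)
    unitary : conv (conv o v) (cube c₀) ≋ cube c₀
    unitary = S.trans (S.*-congʳ {cube c₀} (S.trans (scalar-* ω ω̄) (S.trans (scalar-cong ω-cube) scalar-1)))
      (S.*-identityˡ (cube c₀))

  transpose : Cube (Cube ℤ) → Cube (Cube ℤ)
  transpose ((x₁ , x₂ , x₃) , (y₁ , y₂ , y₃) , (z₁ , z₂ , z₃)) = (x₁ , y₁ , z₁) , (x₂ , y₂ , z₂) , (x₃ , y₃ , z₃)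

  theta-transpose : gf gradedℤ⁹ (λ (x , y , z) → balanced (x , y , z) * (column x * (column y * column z))) ≋
    gf gradedℤ⁹ (λ (x , y , z) → balanced (x , y , z) * (1# * (rowTwist y * (rowTwist z * rowTwist z))))
  theta-transpose = reindex gradedℤ⁹ gradedℤ⁹ transpose transpose (λ _ → ≡.refl) (λ _ → inj₁ ≡.refl) weights character
    where
    weights : ∀ v → cubeSum (cubeSum T) (transpose v) ≡ cubeSum (cubeSum T) v
    weights ((x₁ , x₂ , x₃) , (y₁ , y₂ , y₃) , (z₁ , z₂ , z₃)) = solveℕ 9
      (λ a b c x y z u v w → (a ⊞ (x ⊞ u)) ⊞ ((b ⊞ (y ⊞ v)) ⊞ (c ⊞ (z ⊞ w))) ≔′ (a ⊞ (b ⊞ c)) ⊞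
        ((x ⊞ (y ⊞ z)) ⊞ (u ⊞ (v ⊞ w)))) ≡.refl
      (T x₁) (T x₂) (T x₃) (T y₁) (T y₂) (T y₃) (T z₁) (T z₂) (T z₃)
      where open ℕ-Solver.+-*-Solver using () renaming (solve to solveℕ; _:+_ to _⊞_; _:=_ to _≔′_)
    totals : ∀ v → total (cubeMap total (transpose v)) ≡ total (cubeMap total v)
    totals ((x₁ , x₂ , x₃) , (y₁ , y₂ , y₃) , (z₁ , z₂ , z₃)) = solveℤ 9
      (λ a b c x y z u v w → (a ⊹ (x ⊹ u)) ⊹ ((b ⊹ (y ⊹ v)) ⊹ (c ⊹ (z ⊹ w))) ≔ (a ⊹ (b ⊹ c)) ⊹
        ((x ⊹ (y ⊹ z)) ⊹ (u ⊹ (v ⊹ w)))) ≡.refl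
      x₁ x₂ x₃ y₁ y₂ y₃ z₁ z₂ z₃
    character : ∀ v → balanced (transpose v) * (1# * (rowTwist (proj₁ (proj₂ (transpose v)))
        * (rowTwist (proj₂ (proj₂ (transpose v))) * rowTwist (proj₂ (proj₂ (transpose v))))))
      ≈ balanced v * (column (proj₁ v) * (column (proj₁ (proj₂ v)) * column (proj₂ (proj₂ v))))
    character v@((x₁ , x₂ , x₃) , (y₁ , y₂ , y₃) , (z₁ , z₂ , z₃)) = *-cong
      (≡⇒≈ (≡.cong (λ k → ind (k ℤₚ.≟ 0ℤ)) (totals v)))
      (trans (*-identityˡ _) (solveᴿ 6 (λ b y v c z w →
        (b :*ᴿ (y :*ᴿ v)) :*ᴿ ((c :*ᴿ (z :*ᴿ w)) :*ᴿ (c :*ᴿ (z :*ᴿ w))) :=ᴿ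
        (b :*ᴿ (c :*ᴿ c)) :*ᴿ ((y :*ᴿ (z :*ᴿ z)) :*ᴿ (v :*ᴿ (w :*ᴿ w)))) refl
        (ω-power x₂) (ω-power y₂) (ω-power z₂) (ω-power x₃) (ω-power y₃) (ω-power z₃)))

  theta-twisted : (conv A (cube b) ⊕ conv (𝟏 ⊕ (𝟏 ⊕ 𝟏)) (conv Bₘ V)) ≋ (conv A (cube a) ⊕ conv D (cube c₀ ⊕ cube c₀))
  theta-twisted = S.trans (S.+-congʳ {conv (𝟏 ⊕ (𝟏 ⊕ 𝟏)) (conv Bₘ V)} (S.trans (S.sym theta-columns) theta-transpose))
    theta-rows

-- Listing the generalized Frobenius symbols with nine colors

module Enumeration where

  open import Defs
  open import Data.Nat as ℕ using (ℕ; zero; suc; s≤s)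
  import Data.Nat.Properties as ℕₚ
  open import Data.Nat.DivMod
    using (_/_; m%n<n; m≡m%n+[m/n]*n; [m+kn]%n≡m%n; m<n⇒m%n≡m; +-distrib-/-∣ʳ; m*n/n≡m; m<n⇒m/n≡0)
  open import Data.Nat.Divisibility using (n∣m*n)
  open import Data.Nat.ListAction using (sum)
  open import Data.Fin as Fin using (Fin; zero; suc; toℕ; fromℕ<)
  import Data.Fin.Properties as Finₚ
  open import Data.Unit using (⊤; tt)
  open import Data.Empty using (⊥)
  open import Data.List using (List; []; _∷_; _++_; map; length; lookup; filter; cartesianProduct)
  import Data.List.Properties as Listₚ
  open import Data.List.Membership.Propositional using (_∈_)
  open import Data.List.Membership.Propositional.Properties
    using (∈-++⁺ˡ; ∈-++⁺ʳ; ∈-++⁻; ∈-map⁺; ∈-map⁻; ∈-cartesianProduct⁺; ∈-cartesianProduct⁻; ∈-filter⁺; ∈-filter⁻;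
      ∈-lookup)
  import Data.List.Membership.DecPropositional as DecMembership
  open import Data.List.Relation.Unary.Any using (here; index)
  open import Data.List.Relation.Unary.Any.Properties using (lookup-index)
  open import Data.List.Relation.Unary.All as All using ([]; _∷_)
  open import Data.List.Relation.Unary.AllPairs using ([]; _∷_)
  open import Data.List.Relation.Unary.Linked using ([]; [-]; _∷_)
  open import Data.List.Relation.Unary.Unique.Propositional using (Unique)
  import Data.List.Relation.Unary.Unique.Propositional.Properties as Uniqueₚ
  open import Data.Product using (_×_; _,_; proj₁; proj₂)
  open import Data.Product.Properties using (≡-dec)
  open import Data.Sum using (inj₁; inj₂)
  open import Function using (mk↔ₛ′)
  open import Relation.Nullary using (Dec; contradiction; recompute; _×-dec_)
  open import Relation.Binary using (DecidableEquality; tri<; tri≈; tri>)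
  open import Relation.Binary.PropositionalEquality as ≡ using (_≡_; refl; sym; trans; cong; cong₂; subst)

  Row : Set
  Row = List (Colored 9)

  -- The order isomorphism of colored integers with ℕ: a strictly decreasing row becomes a finite
  -- set of natural numbers.
  code : Colored 9 → ℕ
  code (a , c) = toℕ c ℕ.+ a ℕ.* 9

  decode : ℕ → Colored 9
  decode m = m / 9 , fromℕ< (m%n<n m 9)

  code/9 : ∀ {r} a → r ℕ.< 9 → (r ℕ.+ a ℕ.* 9) / 9 ≡ a
  code/9 {r} a r<9 = trans (+-distrib-/-∣ʳ r (n∣m*n a)) (cong₂ ℕ._+_ (m<n⇒m/n≡0 r<9) (m*n/n≡m a 9))

  decode-code : ∀ x → decode (code x) ≡ x
  decode-code (a , c) = cong₂ _,_ (code/9 a (Finₚ.toℕ<n c))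
    (Finₚ.toℕ-injective (trans (Finₚ.toℕ-fromℕ< (m%n<n (code (a , c)) 9))
      (trans ([m+kn]%n≡m%n (toℕ c) a 9) (m<n⇒m%n≡m (Finₚ.toℕ<n c)))))

  code-decode : ∀ m → code (decode m) ≡ m
  code-decode m = trans (cong (ℕ._+ m / 9 ℕ.* 9) (Finₚ.toℕ-fromℕ< (m%n<n m 9))) (sym (m≡m%n+[m/n]*n m 9))

  ≺⇒code< : ∀ x y → x ≺ y → code x ℕ.< code y
  ≺⇒code< (a , c) (b , e) (inj₁ a<b) = ℕₚ.<-≤-trans (ℕₚ.+-monoˡ-< (a ℕ.* 9) (Finₚ.toℕ<n c))
    (ℕₚ.≤-trans (ℕₚ.*-monoˡ-≤ 9 a<b) (ℕₚ.m≤n+m (b ℕ.* 9) (toℕ e)))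
  ≺⇒code< (a , c) (a , e) (inj₂ (refl , c<e)) = ℕₚ.+-monoˡ-< (a ℕ.* 9) c<e

  code<⇒≺ : ∀ x y → code x ℕ.< code y → x ≺ y
  code<⇒≺ (a , c) (b , e) lt with ℕₚ.<-cmp a b
  ... | tri< a<b _ _    = inj₁ a<b
  ... | tri≈ _ refl _   = inj₂ (refl , ℕₚ.+-cancelʳ-< (a ℕ.* 9) (toℕ c) (toℕ e) lt)
  ... | tri> _ _ b<a    = contradiction lt (ℕₚ.<-asym (≺⇒code< (b , e) (a , c) (inj₁ b<a)))

  -- The power set recursion for rows with all codes below the bound: the largest admissible code is
  -- either absent or heads the row.
  rows : ℕ → List Row
  rows zero    = [] ∷ []
  rows (suc m) = rows m ++ map (decode m ∷_) (rows m)

  HeadBelow : ℕ → Row → Set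
  HeadBelow m []      = ⊤
  HeadBelow m (x ∷ _) = code x ℕ.< m

  headBelow-mono : ∀ {m n} r → m ℕ.≤ n → HeadBelow m r → HeadBelow n r
  headBelow-mono []      le h = tt
  headBelow-mono (x ∷ r) le h = ℕₚ.≤-trans h le

  []∈rows : ∀ m → [] ∈ rows m
  []∈rows zero    = here refl
  []∈rows (suc m) = ∈-++⁺ˡ ([]∈rows m)

  rows-complete : ∀ m r → StrictlyDecreasing r → HeadBelow m r → r ∈ rows m
  rows-complete m       []      dec h = []∈rows m
  rows-complete (suc m) (x ∷ r) dec h with ℕₚ.m≤n⇒m<n∨m≡n (ℕ.s≤s⁻¹ h)
  ... | inj₁ lt   = ∈-++⁺ˡ (rows-complete m (x ∷ r) dec lt)
  ... | inj₂ refl = ∈-++⁺ʳ (rows m) (subst (λ y → y ∷ r ∈ map (decode m ∷_) (rows m)) (decode-code x)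
    (∈-map⁺ (decode m ∷_) (rows-complete m r (proj₁ (tail dec)) (proj₂ (tail dec)))))
    where
    tail : ∀ {r} → StrictlyDecreasing (x ∷ r) → StrictlyDecreasing r × HeadBelow (code x) r
    tail [-]                = [] , tt
    tail {y ∷ _} (y≺x ∷ d) = d , ≺⇒code< y x y≺x

  rows-sound : ∀ m {r} → r ∈ rows m → StrictlyDecreasing r × HeadBelow m r
  rows-sound zero    (here refl) = [] , tt
  rows-sound (suc m) r∈ with ∈-++⁻ (rows m) r∈
  ... | inj₁ old = proj₁ (rows-sound m old) , headBelow-mono _ (ℕₚ.n≤1+n m) (proj₂ (rows-sound m old))
  ... | inj₂ new with ∈-map⁻ (decode m ∷_) new
  ...   | r′ , r′∈ , refl = cons r′ (rows-sound m r′∈) , s≤s (ℕₚ.≤-reflexive (code-decode m))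
    where
    cons : ∀ r → StrictlyDecreasing r × HeadBelow m r → StrictlyDecreasing (decode m ∷ r)
    cons []      _       = [-]
    cons (y ∷ r) (d , h) = code<⇒≺ y (decode m) (subst (code y ℕ.<_) (sym (code-decode m)) h) ∷ d

  rows-unique : ∀ m → Unique (rows m)
  rows-unique zero    = [] ∷ []
  rows-unique (suc m) = Uniqueₚ.++⁺ (rows-unique m) (Uniqueₚ.map⁺ Listₚ.∷-injectiveʳ (rows-unique m)) disjoint
    where
    disjoint : ∀ {r} → r ∈ rows m × r ∈ map (decode m ∷_) (rows m) → ⊥
    disjoint (old , new) with ∈-map⁻ (decode m ∷_) new
    ... | r′ , _ , refl = ℕₚ.<-irrefl (code-decode m) (proj₂ (rows-sound m old))

  size weightOf : Row → ℕ
  size = length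
  weightOf r = sum (map value r)

  -- A single entry has value at most `n`, and each value has nine colors, so 9 (n + 1) bounds every
  -- code in a row of a symbol of `n`.
  headBelow-weight : ∀ n r → weightOf r ℕ.≤ n → HeadBelow (suc n ℕ.* 9) r
  headBelow-weight n []            le = tt
  headBelow-weight n ((a , c) ∷ r) le = ℕₚ.<-≤-trans (ℕₚ.+-monoˡ-< (a ℕ.* 9) (Finₚ.toℕ<n c))
    (ℕₚ.*-monoˡ-≤ 9 (s≤s (ℕₚ.≤-trans (ℕₚ.m≤m+n a (weightOf r)) le)))

  IsSymbol : ℕ → Row × Row → Set
  IsSymbol n (t , b) = length t ≡ length b × length t ℕ.+ sum (map value t) ℕ.+ sum (map value b) ≡ n

  isSymbol? : ∀ n p → Dec (IsSymbol n p)
  isSymbol? n (t , b) = (length t ℕ.≟ length b) ×-dec (length t ℕ.+ sum (map value t) ℕ.+ sum (map value b) ℕ.≟ n)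

  rowPairs : ℕ → List (Row × Row)
  rowPairs n = cartesianProduct (rows (suc n ℕ.* 9)) (rows (suc n ℕ.* 9))

  symbols : ℕ → List (Row × Row)
  symbols n = filter (isSymbol? n) (rowPairs n)

  symbols-unique : ∀ n → Unique (symbols n)
  symbols-unique n = Uniqueₚ.filter⁺ (isSymbol? n)
    (Uniqueₚ.cartesianProduct⁺ (rows-unique (suc n ℕ.* 9)) (rows-unique (suc n ℕ.* 9)))

  symbols-complete : ∀ n t b → StrictlyDecreasing t → StrictlyDecreasing b → IsSymbol n (t , b) → (t , b) ∈ symbols n
  symbols-complete n t b dt db (l , w) = ∈-filter⁺ (isSymbol? n) (∈-cartesianProduct⁺
    (rows-complete _ t dt (headBelow-weight n t
      (ℕₚ.≤-trans (ℕₚ.≤-trans (ℕₚ.m≤n+m (weightOf t) (length t)) (ℕₚ.m≤m+n _ (weightOf b))) (ℕₚ.≤-reflexive w))))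
    (rows-complete _ b db (headBelow-weight n b (ℕₚ.≤-trans (ℕₚ.m≤n+m (weightOf b) _) (ℕₚ.≤-reflexive w))))) (l , w)

  symbols-sound : ∀ n {t b} → (t , b) ∈ symbols n → (StrictlyDecreasing t × StrictlyDecreasing b) × IsSymbol n (t , b)
  symbols-sound n p∈ with ∈-filter⁻ (isSymbol? n) {xs = rowPairs n} p∈
  ... | q∈ , s with ∈-cartesianProduct⁻ (rows (suc n ℕ.* 9)) (rows (suc n ℕ.* 9)) q∈
  ...   | t∈ , b∈ = (proj₁ (rows-sound (suc n ℕ.* 9) t∈) , proj₁ (rows-sound (suc n ℕ.* 9) b∈)) , s

  lookup-unique : ∀ {A : Set} {xs : List A} → Unique xs → ∀ i j → lookup xs i ≡ lookup xs j → i ≡ j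
  lookup-unique (n ∷ u) zero    zero    e = refl
  lookup-unique (n ∷ u) zero    (suc j) e = contradiction e (All.lookup n (∈-lookup j))
  lookup-unique (n ∷ u) (suc i) zero    e = contradiction (sym e) (All.lookup n (∈-lookup i))
  lookup-unique (n ∷ u) (suc i) (suc j) e = cong suc (lookup-unique u i j e)

  symbols-count : ∀ n → cφ≡ 9 n (length (symbols n))
  symbols-count n = mk↔ₛ′ to from to-from from-to
    where
    L = symbols n
    _≟_ : DecidableEquality (Row × Row)
    _≟_ = ≡-dec (Listₚ.≡-dec (≡-dec ℕ._≟_ Fin._≟_)) (Listₚ.≡-dec (≡-dec ℕ._≟_ Fin._≟_))
    open DecMembership _≟_ using (_∈?_)
    frobenius : ∀ p → .(p ∈ L) → CFrob 9 n
    frobenius (t , b) p∈ = frob t b (proj₁ (proj₁ (symbols-sound n p∈))) (proj₂ (proj₁ (symbols-sound n p∈)))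
      (proj₁ (proj₂ (symbols-sound n p∈))) (proj₂ (proj₂ (symbols-sound n p∈)))
    to : Fin (length L) → CFrob 9 n
    to i = frobenius (lookup L i) (∈-lookup i)
    member : ∀ (f : CFrob 9 n) → (CFrob.top f , CFrob.bottom f) ∈ L
    -- The four proofs are irrelevant, but membership in a list is decidable and can therefore be
    -- recomputed from them.
    member (frob t b dt db l w) = recompute ((t , b) ∈? L) (symbols-complete n t b dt db (l , w))
    from : CFrob 9 n → Fin (length L)
    from f = index (member f)
    frobenius-cong : ∀ {p q} .(p∈ : p ∈ L) .(q∈ : q ∈ L) → p ≡ q → frobenius p p∈ ≡ frobenius q q∈
    frobenius-cong _ _ refl = refl
    to-from : ∀ f → to (from f) ≡ f
    to-from f = frobenius-cong (∈-lookup (from f)) (member f) (sym (lookup-index (member f)))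
    from-to : ∀ i → from (to i) ≡ i
    from-to i = lookup-unique (symbols-unique n) (from (to i)) i (sym (lookup-index (member (to i))))

-- The number of symbols as a coefficient of Φ

module Counting (R : CommutativeRing 0ℓ 0ℓ) (ζ : CubeRoot R) where

  open import Data.Nat as ℕ using (ℕ; zero; suc)
  import Data.Nat.Properties as ℕₚ
  open import Data.Nat.DivMod using (_/_)
  open import Data.Unit using (tt)
  open import Data.List using (List; []; _∷_; map; length; filter)
  open import Data.Product using (_,_; proj₁; proj₂)
  open import Function using (_∘_)
  open import Relation.Nullary using (Dec; yes; no)
  open import Relation.Binary.PropositionalEquality as ≡ using (_≡_)
  open Grading
  open Enumeration
  import Algebra.Solver.Ring.NaturalCoefficients.Default as NaturalSolver
  open Decomposition R ζ public
  open import Algebra.Properties.Semiring.Mult semiring using () renaming (_×_ to _×ᴿ_) public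

  ∑-filter : ∀ {I : Set} {Q : I → Set} (Q? : ∀ i → Dec (Q i)) (L : List I) →
    ∑ L (λ i → ind (Q? i)) ≈ length (filter Q? L) ×ᴿ 1#
  ∑-filter Q? []      = refl
  ∑-filter Q? (i ∷ L) with Q? i
  ... | yes _ = +-congˡ (∑-filter Q? L)
  ... | no _  = trans (+-identityˡ _) (∑-filter Q? L)

  rowSeries : ℕ → PS.Series
  rowSeries m = ∑₂ (rows m) size weightOf one

  rowSeries-suc : ∀ m → rowSeries (suc m) PS.≋ PS.conv (factor 1# 1 (m / 9)) (rowSeries m)
  rowSeries-suc m = S₂.trans separate (S₂.sym (S₂.trans
    (S₂.distribʳ (rowSeries m) PS.𝟏 (term₂ 1# 1 (m / 9))) (S₂.+-cong (S₂.*-identityˡ (rowSeries m)) adjoin)))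
    where
    separate : rowSeries (suc m) PS.≋ PS._⊕_ (rowSeries m) (∑₂ (rows m) (suc ∘ size) (λ r → m / 9 ℕ.+ weightOf r) one)
    separate s n = trans (∑-++ (rows m) (map (decode m ∷_) (rows m)) _) (+-congˡ (∑-map (decode m ∷_) (rows m) _))
    adjoin : PS.conv (term₂ 1# 1 (m / 9)) (rowSeries m) PS.≋ ∑₂ (rows m) (suc ∘ size) (λ r → m / 9 ℕ.+ weightOf r) one
    adjoin = S₂.trans (S₂.*-congʳ {rowSeries m} (λ s n → sym (+-identityʳ _)))
      (S₂.trans (∑₂-conv (tt ∷ []) (rows m) (λ _ → 1) (λ _ → m / 9) size weightOf one one)
        (λ s n → trans (∑-cartesian (tt ∷ []) (rows m) _) (trans (+-identityʳ _)
          (∑-cong (rows m) (λ r → *-congʳ (*-congʳ (*-identityˡ 1#)))))))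

  -- The nine codes from 9 N to 9 N + 8 are the nine colors of the value N, and each of them brings
  -- a factor 1 + u qᴺ.
  rowSeries-layer : ∀ N → rowSeries (suc N ℕ.* 9) PS.≋ PS.conv (cube₂ (cube₂ (factor 1# 1 N))) (rowSeries (N ℕ.* 9))
  rowSeries-layer N = S₂.trans (step 8 ℕₚ.≤-refl (step 7 (s≤s-by 1) (step 6 (s≤s-by 2) (step 5 (s≤s-by 3) (step 4 (s≤s-by 4)
    (step 3 (s≤s-by 5) (step 2 (s≤s-by 6) (step 1 (s≤s-by 7) (step 0 (s≤s-by 8) (S₂.refl {rowSeries (N ℕ.* 9)}))))))))))
    (solve₂ 2 (λ f x → f ⊛ (f ⊛ (f ⊛ (f ⊛ (f ⊛ (f ⊛ (f ⊛ (f ⊛ (f ⊛ x)))))))) ≔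
      ((f ⊛ (f ⊛ f)) ⊛ ((f ⊛ (f ⊛ f)) ⊛ (f ⊛ (f ⊛ f)))) ⊛ x) S₂.refl f (rowSeries (N ℕ.* 9)))
    where
    open NaturalSolver S₂.commutativeSemiring using () renaming (solve to solve₂; _:=_ to _≔_; _:*_ to _⊛_)
    f = factor 1# 1 N
    s≤s-by : ∀ k {m} → m ℕ.≤ k ℕ.+ m
    s≤s-by k = ℕₚ.m≤n+m _ k
    step : ∀ j → suc j ℕ.≤ 9 → ∀ {X} → rowSeries (j ℕ.+ N ℕ.* 9) PS.≋ X → rowSeries (suc j ℕ.+ N ℕ.* 9) PS.≋ PS.conv f X
    step j j<9 e = S₂.trans (rowSeries-suc (j ℕ.+ N ℕ.* 9))
      (S₂.*-cong (λ s n → ≡⇒≈ (≡.cong (λ k → factor 1# 1 k s n) (code/9 N j<9))) e)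

  rowSeries-product : ∀ N → rowSeries (N ℕ.* 9) PS.≋ cube₂ (cube₂ (finiteProduct N))
  rowSeries-product zero = S₂.trans single (S₂.sym (S₂.trans (S₂.*-cong unity (S₂.*-cong unity unity)) unity))
    where
    unity : cube₂ PS.𝟏 PS.≋ PS.𝟏
    unity = S₂.trans (S₂.*-identityˡ (PS.conv PS.𝟏 PS.𝟏)) (S₂.*-identityˡ PS.𝟏)
    single : rowSeries 0 PS.≋ PS.𝟏
    single zero    n = trans (+-identityʳ _) (trans (*-congʳ (*-identityˡ 1#)) (*-identityˡ _))
    single (suc s) n = trans (+-identityʳ _) (trans (*-congʳ (zeroʳ 1#)) (zeroˡ _))
  rowSeries-product (suc N) = S₂.trans (rowSeries-layer N) (S₂.trans
    (S₂.*-congˡ {cube₂ (cube₂ f)} (rowSeries-product N))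
    (solve₂ 2 (λ f p → nine f ⊛ nine p ≔ nine (p ⊛ f)) S₂.refl f (finiteProduct N)))
    where
    open NaturalSolver S₂.commutativeSemiring using (Polynomial) renaming (solve to solve₂; _:=_ to _≔_; _:*_ to _⊛_)
    f = factor 1# 1 N
    nine : ∀ {n} → Polynomial n → Polynomial n
    nine f = (f ⊛ (f ⊛ f)) ⊛ ((f ⊛ (f ⊛ f)) ⊛ (f ⊛ (f ⊛ f)))

  PS-conv-cong[] : ∀ n {X X′ Y Y′} → (∀ s → X s ≋[ n ] X′ s) → (∀ s → Y s ≋[ n ] Y′ s) →
    ∀ s → PS.conv X Y s ≋[ n ] PS.conv X′ Y′ s
  PS-conv-cong[] n e f s = PS.conv-congruence (λ X Y → X ≋[ n ] Y) (λ e f k l → +-cong (e k l) (f k l)) (conv-cong[] n) s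
    (λ t _ → e t) (λ t _ → f t)

  cube₂-cong[] : ∀ n {X X′} → (∀ s → X s ≋[ n ] X′ s) → ∀ s → cube₂ X s ≋[ n ] cube₂ X′ s
  cube₂-cong[] n {X} {X′} e = PS-conv-cong[] n {X} {X′} {PS.conv X X} {PS.conv X′ X′} e
    (PS-conv-cong[] n {X} {X′} {X} {X′} e e)

  -- A symbol is a pair of rows of equal length, so the count is a `⋆` product. Replacing the
  -- bounded rows by the infinite products changes nothing up to exponent `n`.
  symbols-series : ∀ n → length (symbols n) ×ᴿ 1# ≈ conv (gf gradedℤ⁹ balanced) (cube (cube (partitions 0))) n
  symbols-series n = trans (sym (∑-filter (isSymbol? n) (rowPairs n)))
    (trans (∑-cong (rowPairs n) indicator)
    (trans (sym (∑₂-⋆ (rows N) (rows N) size weightOf size weightOf one one n))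
    (trans (⋆-cong[] n truncate truncate) (sym (balanced-partitions n)))))
    where
    N = suc n ℕ.* 9
    truncate : ∀ s → rowSeries N s ≋[ n ] cube₂ (cube₂ (P 0 1#)) s
    truncate s k k≤n = trans (rowSeries-product (suc n) s k)
      (cube₂-cong[] n {cube₂ (finiteProduct (suc n))} {cube₂ (P 0 1#)}
        (cube₂-cong[] n {finiteProduct (suc n)} {P 0 1#} (λ t j j≤n → sym (P-truncate n t j j≤n))) s k k≤n)
    indicator : ∀ p → ind (isSymbol? n p) ≈
      term (1# * 1# * ind (size (proj₁ p) ℕ.≟ size (proj₂ p)))
        (size (proj₁ p) ℕ.+ (weightOf (proj₁ p) ℕ.+ weightOf (proj₂ p))) n
    indicator (t , b) = sym (trans (*-congʳ (trans (*-congʳ (*-identityˡ 1#)) (*-identityˡ _))) both)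
      where
      assoc = ℕₚ.+-assoc (length t) (weightOf t) (weightOf b)
      both : ind (size t ℕ.≟ size b) * mono (size t ℕ.+ (weightOf t ℕ.+ weightOf b)) n ≈ ind (isSymbol? n (t , b))
      both with isSymbol? n (t , b)
      ... | yes (l , w) = trans (*-cong (ind-yes (size t ℕ.≟ size b) l)
        (trans (≡⇒≈ (≡.cong (λ k → mono k n) (≡.trans (≡.sym assoc) w))) (mono-diag n))) (*-identityˡ 1#)
      ... | no ns with size t ℕ.≟ size b
      ...   | no _  = zeroˡ _
      ...   | yes l = trans (*-identityˡ _) (mono-off (λ q → ns (l , ≡.trans assoc q)))

-- Polynomial identities between the theta functions

module Identities (K : CommutativeRing 0ℓ 0ℓ) where

  open import Data.Nat using (ℕ; zero; suc)
  open CommutativeRing K hiding (zero)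
  open import Relation.Binary.Reasoning.Setoid setoid
  open import Algebra.Properties.Ring ring using (+-cancelˡ; +-cancelʳ; -‿distribʳ-*)
  open import Algebra.Properties.AbelianGroup +-abelianGroup using (xyx⁻¹≈y)
  open import Algebra.Properties.Semiring.Mult.TCOptimised semiring using () renaming (_×_ to _×ₒ_)
  open import Algebra.Solver.Ring.NaturalCoefficients.Default commutativeSemiring

  infix 10 ♯_

  ♯_ : ℕ → Carrier
  ♯ n = n ×ₒ 1#

  triple : Carrier → Carrier
  triple x = x + (x + x)

  triple^ : ℕ → Carrier → Carrier
  triple^ zero    x = x
  triple^ (suc k) x = triple (triple^ k x)

  cubed : Carrier → Carrier
  cubed x = x * (x * x)

  triple-cong : ∀ {x y} → x ≈ y → triple x ≈ triple y
  triple-cong e = +-cong e (+-cong e e)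

  triple^-cong : ∀ k {x y} → x ≈ y → triple^ k x ≈ triple^ k y
  triple^-cong zero    e = e
  triple^-cong (suc k) e = triple-cong (triple^-cong k e)

  triple-+ : ∀ x y → triple (x + y) ≈ triple x + triple y
  triple-+ = solve 2 (λ x y → (x :+ y) :+ ((x :+ y) :+ (x :+ y)) := (x :+ (x :+ x)) :+ (y :+ (y :+ y))) refl

  triple-*ˡ : ∀ x y → triple x * y ≈ triple (x * y)
  triple-*ˡ = solve 2 (λ x y → (x :+ (x :+ x)) :* y := x :* y :+ (x :* y :+ x :* y)) refl

  triple^-+ : ∀ k x y → triple^ k (x + y) ≈ triple^ k x + triple^ k y
  triple^-+ zero    x y = refl
  triple^-+ (suc k) x y = trans (triple-cong (triple^-+ k x y)) (triple-+ (triple^ k x) (triple^ k y))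

  triple^-*ˡ : ∀ k x y → triple^ k x * y ≈ triple^ k (x * y)
  triple^-*ˡ zero    x y = refl
  triple^-*ˡ (suc k) x y = trans (triple-*ˡ (triple^ k x) y) (triple-cong (triple^-*ˡ k x y))

  triple^-zero : ∀ k {x} → x ≈ 0# → triple^ k x ≈ 0#
  triple^-zero zero    e = e
  triple^-zero (suc k) e = trans (+-cong z (+-cong z z)) (trans (+-identityˡ _) (+-identityˡ 0#))
    where z = triple^-zero k e

  private
    ∛ : ∀ {n} → Polynomial n → Polynomial n
    ∛ x = x :* (x :* x)
    tr : ∀ {n} → Polynomial n → Polynomial n
    tr x = x :+ (x :+ x)

  module _ {A C a b c q W : Carrier} (a-split : a ≈ A + (C + C)) (b-split : b + C ≈ A) (c-split : c ≈ triple W) where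

    -- In the application `q` is the size variable and `c` is c(q) without its factor q^(1/3), so
    -- that this is c(q)³, which has integral exponents.
    κ : Carrier
    κ = q * cubed c

    middle : (q * W) * (a * (c * c)) + ((q * W) * (a * (c * c)) + (q * W) * (a * (c * c))) ≈ a * κ
    middle = trans
      (solve 4 (λ q w a c → tr ((q :* w) :* (a :* (c :* c))) := (a :* (q :* (c :* c))) :* tr w) refl q W a c)
      (trans (*-congˡ (sym c-split)) (solve 3 (λ q a c → (a :* (q :* (c :* c))) :* c := a :* (q :* ∛ c)) refl q a c))

    theta-κ : A * cubed a + ((q * W) * ((1# + (1# + (1# + (1# + (1# + 1#))))) * (a * (c * c))) + (q * C) *
      (cubed c + cubed c))
      ≈ A * cubed a + (κ * (a + C) + κ * (a + C))
    theta-κ = +-congˡ (begin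
      (q * W) * ((1# + (1# + (1# + (1# + (1# + 1#))))) * (a * (c * c))) + (q * C) * (cubed c + cubed c)
        ≈⟨ solve 5 (λ q w a c d → let i = con 1; m = (q :* w) :* (a :* (c :* c)) in
             (q :* w) :* ((i :+ (i :+ (i :+ (i :+ (i :+ i))))) :* (a :* (c :* c))) :+ (q :* d) :* (∛ c :+ ∛ c)
             := (tr m :+ tr m) :+ (d :* (q :* ∛ c) :+ d :* (q :* ∛ c))) refl q W a c C ⟩
      (m₃ + m₃) + (C * κ + C * κ)
        ≈⟨ +-congʳ (+-cong middle middle) ⟩
      (a * κ + a * κ) + (C * κ + C * κ)
        ≈⟨ solve 3 (λ a d k → (a :* k :+ a :* k) :+ (d :* k :+ d :* k) := k :* (a :+ d) :+ k :* (a :+ d)) refl a C κ ⟩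
      κ * (a + C) + κ * (a + C) ∎)
      where m₃ = (q * W) * (a * (c * c)) + ((q * W) * (a * (c * c)) + (q * W) * (a * (c * c)))

    -- By `middle` three copies of the mixed term are a κ = (A + 2 C) κ. The part 2 C κ occurs on
    -- both sides and cancels; the rest has the common factor A.
    cubic-scaled : A * cubed b + (1# + (1# + 1#)) * ((q * W) * (a * (c * c))) ≈ A * cubed a + (q * C) *
      (cubed c + cubed c) →
      A * (cubed b + κ) ≈ A * cubed a
    cubic-scaled e = +-cancelʳ ((C + C) * κ) _ _ (begin
      A * (cubed b + κ) + (C + C) * κ
        ≈⟨ solve 4 (λ A B k d → A :* (B :+ k) :+ (d :+ d) :* k := A :* B :+ (A :+ (d :+ d)) :* k) refl A (cubed b) κ C ⟩
      A * cubed b + (A + (C + C)) * κ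
        ≈⟨ +-congˡ (trans (*-congʳ (sym a-split)) (sym middle)) ⟩
      A * cubed b + (m + (m + m))
        ≈⟨ +-congˡ (solve 1 (λ m → tr m := (con 1 :+ (con 1 :+ con 1)) :* m) refl m) ⟩
      A * cubed b + (1# + (1# + 1#)) * m
        ≈⟨ e ⟩
      A * cubed a + (q * C) * (cubed c + cubed c)
        ≈⟨ +-congˡ (solve 3 (λ q d c → (q :* d) :* (c :+ c) := (d :+ d) :* (q :* c)) refl q C (cubed c)) ⟩
      A * cubed a + (C + C) * κ ∎)
      where m = (q * W) * (a * (c * c))

    quadratic : Carrier
    quadratic = A * A + (A * C + C * C)

    private
      A≈ : A ≈ b + C
      A≈ = sym b-split
      quadratic≈ : quadratic ≈ (b + C) * (b + C) + ((b + C) * C + C * C)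
      quadratic≈ = +-cong (*-cong A≈ A≈) (+-congʳ (*-congʳ A≈))

    -- Here a = b + 3 C, and (b + 3 C)³ - b³ = 9 C (b² + 3 b C + 3 C²), whose last factor is
    -- `quadratic` written in b and C.
    κ-value : cubed b + κ ≈ cubed a → κ ≈ ♯ 9 * (C * quadratic)
    κ-value e = +-cancelˡ (cubed b) _ _ (trans e (begin
      cubed a                       ≈⟨ *-cong a≈ (*-cong a≈ a≈) ⟩
      cubed (b + C + (C + C))
        ≈⟨ solve 2 (λ b d → ∛ (b :+ d :+ (d :+ d)) :=
             ∛ b :+ con 9 :* (d :* ((b :+ d) :* (b :+ d) :+ ((b :+ d) :* d :+ d :* d)))) refl b C ⟩
      cubed b + ♯ 9 * (C * ((b + C) * (b + C) + ((b + C) * C + C * C)))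
        ≈⟨ +-congˡ (*-congˡ (*-congˡ (sym quadratic≈))) ⟩
      cubed b + ♯ 9 * (C * quadratic) ∎))
      where a≈ = trans a-split (+-congʳ A≈)

    difference-of-cubes : b * quadratic + cubed C ≈ cubed A
    difference-of-cubes = begin
      b * quadratic + cubed C        ≈⟨ +-congʳ (*-congˡ quadratic≈) ⟩
      b * ((b + C) * (b + C) + ((b + C) * C + C * C)) + cubed C
        ≈⟨ solve 2 (λ b d → b :* ((b :+ d) :* (b :+ d) :+ ((b :+ d) :* d :+ d :* d)) :+ ∛ d := ∛ (b :+ d)) refl b C ⟩
      cubed (b + C)                  ≈⟨ *-cong b-split (*-cong b-split b-split) ⟩
      cubed A                        ∎

  -- The form of degree ten, split by the degree in C modulo 3

  module Trisection (A C : Carrier) where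

    α γ Q : Carrier
    α = cubed A
    γ = cubed C
    Q = A * A + (A * C + C * C)

    -- The quartic form of Θ is A s₀ + C s₁ + A² C² s₂ and Q³ is r₀ + A² C r₁ + A C² r₂: terms are
    -- grouped by the degree in C modulo 3, with coefficients in α and γ.
    s₀ s₁ s₂ r₀ r₁ r₂ : Carrier
    s₀ = α + ♯ 80 * γ
    s₁ = ♯ 24 * α + ♯ 54 * γ
    s₂ = ♯ 84
    r₀ = α * α + (♯ 7 * (α * γ) + γ * γ)
    r₁ = ♯ 3 * (α + ♯ 2 * γ)
    r₂ = ♯ 3 * (♯ 2 * α + γ)

    N₀ M₁ M₂ : Carrier
    N₀ = A * (s₀ * r₀ + (γ * (s₁ * r₂) + (α * γ) * (s₂ * r₁)))
    M₁ = α * (α * α) + (♯ 36 * (α * (α * γ)) + (♯ 42 * (α * (γ * γ)) + ♯ 2 * (γ * (γ * γ))))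
    M₂ = ♯ 2 * (α * α) + (♯ 17 * (α * γ) + ♯ 8 * (γ * γ))

    quartic : A * cubed (A + (C + C)) + ((♯ 9 * (C * Q)) * (A + (C + C) + C) + (♯ 9 * (C * Q)) * (A + (C + C) + C))
      ≈ A * s₀ + (C * s₁ + ((A * A) * (C * C)) * s₂)
    quartic = solve 2 (λ A C →
      A :* ∛ (A :+ (C :+ C)) :+ ((con 9 :* (C :* (A :* A :+ (A :* C :+ C :* C)))) :* (A :+ (C :+ C) :+ C)
        :+ (con 9 :* (C :* (A :* A :+ (A :* C :+ C :* C)))) :* (A :+ (C :+ C) :+ C))
      := A :* (∛ A :+ con 80 :* ∛ C) :+ (C :* (con 24 :* ∛ A :+ con 54 :* ∛ C) :+ ((A :* A) :* (C :* C)) :* con 84))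
        refl A C

    sextic : cubed Q ≈ r₀ + (((A * A) * C) * r₁ + (A * (C * C)) * r₂)
    sextic = solve 2 (λ A C → ∛ (A :* A :+ (A :* C :+ C :* C)) :=
      (∛ A :* ∛ A :+ (con 7 :* (∛ A :* ∛ C) :+ ∛ C :* ∛ C))
        :+ (((A :* A) :* C) :* (con 3 :* (∛ A :+ con 2 :* ∛ C)) :+ (A :* (C :* C)) :* (con 3 :* (con 2 :* ∛ A :+ ∛ C))))
          refl A C

    product : (A * s₀ + (C * s₁ + ((A * A) * (C * C)) * s₂)) * (r₀ + (((A * A) * C) * r₁ + (A * (C * C)) * r₂)) ≈
      N₀ + (C * (α * (s₀ * r₁) + (s₁ * r₀ + (α * γ) * (s₂ * r₂))) + ((A * A) * (C * C)) * (s₀ * r₂ + (s₁ * r₁ + s₂ * r₀)))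
    product = solve 8 (λ A C s₀ s₁ s₂ r₀ r₁ r₂ →
      (A :* s₀ :+ (C :* s₁ :+ ((A :* A) :* (C :* C)) :* s₂)) :* (r₀ :+ (((A :* A) :* C) :* r₁ :+ (A :* (C :* C)) :* r₂)) :=
      A :* (s₀ :* r₀ :+ (∛ C :* (s₁ :* r₂) :+ (∛ A :* ∛ C) :* (s₂ :* r₁)))
        :+ (C :* (∛ A :* (s₀ :* r₁) :+ (s₁ :* r₀ :+ (∛ A :* ∛ C) :* (s₂ :* r₂)))
        :+ ((A :* A) :* (C :* C)) :* (s₀ :* r₂ :+ (s₁ :* r₁ :+ s₂ :* r₀)))) refl A C s₀ s₁ s₂ r₀ r₁ r₂

    -- All coefficients turn out to be divisible by 27; with one more 3 from the factor C = 3 c this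
    -- gives 81.
    residue₁ : α * (s₀ * r₁) + (s₁ * r₀ + (α * γ) * (s₂ * r₂)) ≈ triple^ 3 M₁
    residue₁ = solve 2 (λ x y →
      let s₀ = x :+ con 80 :* y; s₁ = con 24 :* x :+ con 54 :* y; s₂ = con 84
          r₀ = x :* x :+ (con 7 :* (x :* y) :+ y :* y); r₁ = con 3 :* (x :+ con 2 :* y); r₂ = con 3 :* (con 2 :* x :+ y) in
      x :* (s₀ :* r₁) :+ (s₁ :* r₀ :+ (x :* y) :* (s₂ :* r₂)) :=
      tr (tr (tr (x :* (x :* x) :+ (con 36 :* (x :* (x :* y)) :+
        (con 42 :* (x :* (y :* y)) :+ con 2 :* (y :* (y :* y)))))))) refl α γ

    -- All coefficients turn out to be divisible by 81; the accompanying factor C² = 9 c² raises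
    -- this to 729.
    residue₂ : s₀ * r₂ + (s₁ * r₁ + s₂ * r₀) ≈ triple^ 4 M₂
    residue₂ = solve 2 (λ x y →
      let s₀ = x :+ con 80 :* y; s₁ = con 24 :* x :+ con 54 :* y; s₂ = con 84
          r₀ = x :* x :+ (con 7 :* (x :* y) :+ y :* y); r₁ = con 3 :* (x :+ con 2 :* y); r₂ = con 3 :* (con 2 :* x :+ y) in
      s₀ :* r₂ :+ (s₁ :* r₁ :+ s₂ :* r₀) :=
      tr (tr (tr (tr (con 2 :* (x :* x) :+ (con 17 :* (x :* y) :+ con 8 :* (y :* y))))))) refl α γ

    module _ {c : Carrier} (C-triple : C ≈ triple c) where

      N₁ N₂ : Carrier
      N₁ = c * M₁
      N₂ = ((A * A) * (c * c)) * M₂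

      trisect : ∀ {a θ κ} → a ≈ A + (C + C) → κ ≈ ♯ 9 * (C * Q) → θ ≈ A * cubed a + (κ * (a + C) + κ * (a + C)) →
        θ * cubed Q ≈ N₀ + (triple^ 4 N₁ + triple^ 6 N₂)
      trisect {a} {θ} {κ} a≈ κ≈ θ≈ = begin
        θ * cubed Q
          ≈⟨ *-cong (trans θ≈ (trans (+-cong (*-congˡ (*-cong a≈ (*-cong a≈ a≈))) (+-cong k k)) quartic)) sextic ⟩
        (A * s₀ + (C * s₁ + ((A * A) * (C * C)) * s₂)) * (r₀ + (((A * A) * C) * r₁ + (A * (C * C)) * r₂))
          ≈⟨ product ⟩
        N₀ + (C * (α * (s₀ * r₁) + (s₁ * r₀ + (α * γ) * (s₂ * r₂))) + ((A * A) * (C * C)) * (s₀ * r₂ + (s₁ * r₁ + s₂ * r₀)))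
          ≈⟨ +-congˡ (+-cong (*-cong C-triple residue₁) (*-cong (*-congˡ (*-cong C-triple C-triple)) residue₂)) ⟩
        N₀ + (triple c * triple^ 3 M₁ + ((A * A) * (triple c * triple c)) * triple^ 4 M₂)
          ≈⟨ +-congˡ (+-cong
               (solve 2 (λ c m → tr c :* tr (tr (tr m)) := tr (tr (tr (tr (c :* m))))) refl c M₁)
               (solve 3 (λ p c m → (p :* (tr c :* tr c)) :* tr (tr (tr (tr m))) := tr
                 (tr (tr (tr (tr (tr ((p :* (c :* c)) :* m))))))) refl (A * A) c M₂)) ⟩
        N₀ + (triple^ 4 N₁ + triple^ 6 N₂) ∎
        where k = *-cong κ≈ (+-congʳ a≈)

      -- The quotient by nine of the deviation from A Z³. Here N₀ = A (α³ + γ M₀) with γ = 27 c³,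
      -- and replacing α by Z + γ costs only further multiples of γ.
      trisect-mod-9 : ∀ {Z} → Z + γ ≈ α → Carrier
      trisect-mod-9 {Z} e = (triple (cubed c)) * (A * (♯ 3 * (Z * Z) + (♯ 3 * (Z * γ) + γ * γ)) + A * M₀)
          + (triple^ 2 N₁ + triple^ 4 N₂)
        where
        M₀ = (♯ 7 * (α * α) + (α * γ + ♯ 80 * r₀)) + (s₁ * r₂ + α * (s₂ * r₁))

      trisect-mod-9-correct : ∀ {Z} (e : Z + γ ≈ α) → N₀ + (triple^ 4 N₁ + triple^ 6 N₂) ≈ A * cubed Z + triple^ 2
        (trisect-mod-9 e)
      trisect-mod-9-correct {Z} e = begin
        N₀ + (triple^ 4 N₁ + triple^ 6 N₂)
          ≈⟨ +-congʳ leading ⟩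
        (A * cubed α + γ * (A * M₀)) + (triple^ 4 N₁ + triple^ 6 N₂)
          ≈⟨ +-congʳ (+-congʳ (*-congˡ (*-cong (sym e) (*-cong (sym e) (sym e))))) ⟩
        (A * cubed (Z + γ) + γ * (A * M₀)) + (triple^ 4 N₁ + triple^ 6 N₂)
          ≈⟨ +-congʳ (solve 4 (λ A z g m → A :* ∛ (z :+ g) :+ g :* (A :* m) :=
               A :* ∛ z :+ g :* (A :* (con 3 :* (z :* z) :+ (con 3 :* (z :* g) :+ g :* g)) :+ A :* m)) refl A Z γ M₀) ⟩
        (A * cubed Z + γ * L) + (triple^ 4 N₁ + triple^ 6 N₂)
          ≈⟨ +-congʳ (+-congˡ (*-congʳ (trans (*-cong C-triple (*-cong C-triple C-triple))
               (solve 1 (λ c → tr c :* (tr c :* tr c) := tr (tr (tr (∛ c)))) refl c)))) ⟩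
        (A * cubed Z + triple (triple (triple (cubed c))) * L) + (triple^ 4 N₁ + triple^ 6 N₂)
          ≈⟨ solve 5 (λ y g l u v → (y :+ tr (tr g) :* l) :+ (tr (tr u) :+ tr (tr v)) := y :+ tr
            (tr (g :* l :+ (u :+ v)))) refl
               (A * cubed Z) (triple (cubed c)) L (triple^ 2 N₁) (triple^ 4 N₂) ⟩
        A * cubed Z + triple^ 2 (trisect-mod-9 e) ∎
        where
        M₀ = (♯ 7 * (α * α) + (α * γ + ♯ 80 * r₀)) + (s₁ * r₂ + α * (s₂ * r₁))
        L = A * (♯ 3 * (Z * Z) + (♯ 3 * (Z * γ) + γ * γ)) + A * M₀
        leading : N₀ ≈ A * cubed α + γ * (A * M₀)
        leading = solve 6 (λ A x y s r t → let r₀ = x :* x :+ (con 7 :* (x :* y) :+ y :* y) in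
          A :* ((x :+ con 80 :* y) :* r₀ :+ (y :* (s :* r) :+ (x :* y) :* t)) :=
          A :* ∛ x :+ y :* (A :* ((con 7 :* (x :* x) :+ (x :* y :+ con 80 :* r₀)) :+ (s :* r :+ x :* t)))) refl
          A α γ s₁ r₂ (s₂ * r₁)

      -- The mixed terms are 3 A C (A + C), and C = 3 c supplies the second factor 3. What remains,
      -- A³ + 2 C³, involves only exponents divisible by three.
      quadratic-mod-9 : ∀ {a} → a ≈ A + (C + C) → a * Q ≈ (α + (γ + γ)) + triple^ 2 ((A * c) * (A + C))
      quadratic-mod-9 {a} a≈ = begin
        a * Q                                             ≈⟨ *-congʳ a≈ ⟩
        (A + (C + C)) * Q
          ≈⟨ solve 2 (λ A C → (A :+ (C :+ C)) :* (A :* A :+ (A :* C :+ C :* C)) :=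
               (∛ A :+ (∛ C :+ ∛ C)) :+ tr ((A :* C) :* (A :+ C))) refl A C ⟩
        (α + (γ + γ)) + triple ((A * C) * (A + C))
          ≈⟨ +-congˡ (triple-cong (trans (*-congʳ (*-congˡ C-triple))
               (solve 3 (λ A c s → (A :* tr c) :* s := tr ((A :* c) :* s)) refl A c (A + C)))) ⟩
        (α + (γ + γ)) + triple^ 2 ((A * c) * (A + C)) ∎

  module _ {b H Q U : Carrier} (bH≈U : b * H ≈ U) where

    clear-denominators : ∀ θ → cubed (b * Q) * (θ * cubed H) ≈ (θ * cubed Q) * cubed U
    clear-denominators θ = trans
      (solve 4 (λ t b h q → ∛ (b :* q) :* (t :* ∛ h) := (t :* ∛ q) :* ∛ (b :* h)) refl θ b H Q)
      (*-congˡ (*-cong bH≈U (*-cong bH≈U bH≈U)))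

    clear-denominator : ∀ a → (b * Q) * (a * H) ≈ (a * Q) * U
    clear-denominator a = trans (solve 4 (λ a b h q → (b :* q) :* (a :* h) := (a :* q) :* (b :* h)) refl a b H Q)
      (*-congˡ bH≈U)

  distribute₃ : ∀ k l x y z w → (x + (triple^ k y + triple^ l z)) * w ≈ x * w + (triple^ k (y * w) + triple^ l (z * w))
  distribute₃ k l x y z w = trans (distribʳ w x _)
    (+-congˡ (trans (distribʳ w _ _) (+-cong (triple^-*ˡ k y w) (triple^-*ˡ l z w))))

  distribute₂ : ∀ k x y w → (x + triple^ k y) * w ≈ x * w + triple^ k (y * w)
  distribute₂ k x y w = trans (distribʳ w x _) (+-congˡ (triple^-*ˡ k y w))

  difference-multiple : ∀ {A Z U Φ E} k → cubed Z * Φ ≈ (A * cubed Z) * cubed U + triple^ k E →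
    cubed Z * (Φ + - (A * cubed U)) ≈ triple^ k E
  difference-multiple {A} {Z} {U} {Φ} {E} k e = begin
    cubed Z * (Φ + - (A * cubed U))               ≈⟨ distribˡ (cubed Z) Φ _ ⟩
    cubed Z * Φ + cubed Z * - (A * cubed U)       ≈⟨ +-cong e (sym (-‿distribʳ-* (cubed Z) (A * cubed U))) ⟩
    p + triple^ k E + - (cubed Z * (A * cubed U))
      ≈⟨ +-congˡ (-‿cong (solve 3 (λ z a u → z :* (a :* u) := (a :* z) :* u) refl (cubed Z) A (cubed U))) ⟩
    p + triple^ k E + - p                         ≈⟨ xyx⁻¹≈y p (triple^ k E) ⟩
    triple^ k E                                   ∎
    where p = (A * cubed Z) * cubed U

-- Supports modulo 3, cancellation and the congruences for Φ

module Congruences (R : CommutativeRing 0ℓ 0ℓ) (ζ : CubeRoot R) where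

  open import Data.Nat as ℕ using (ℕ; zero; suc)
  import Data.Nat.Properties as ℕₚ
  import Data.Nat.Solver as ℕ-Solver
  open import Data.Fin using (Fin; zero; suc; toℕ)
  open import Data.Fin.Patterns using (0F; 1F; 2F)
  import Data.Fin.Properties as Finₚ
  open import Data.List using (length)
  open import Data.Product using (_,_; proj₁; proj₂; ∃)
  open import Data.Sum using (_⊎_; inj₁; inj₂)
  open import Data.Unit using (⊤; tt)
  open import Relation.Nullary using (yes; no; contradiction)
  open import Relation.Binary.PropositionalEquality as ≡ using (_≡_; _≢_)
  open Grading
  open Maya using (Maya; gradedMaya; energy)
  open Cubes
  open Hexagonal
  open Enumeration using (symbols)
  open Counting R ζ public
  open import Algebra.Properties.Ring ring using (-1*x≈-x)
  import Algebra.Properties.Ring S.ring as SRing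
  import Algebra.Solver.Ring.NaturalCoefficients.Default as NaturalSolver

  module ID = Identities seriesRing
  open Identities R using (triple; triple^; triple-cong; triple^-cong; triple^-+; triple^-*ˡ; triple^-zero)
  open ID using (♯_; cubed) renaming (triple to tripleₛ; triple^ to tripleₛ^)
  open NaturalSolver S.commutativeSemiring using (solve; _:=_; _:+_; _:*_; con)

  next : Fin 3 → Fin 3
  next 0F = 1F
  next 1F = 2F
  next 2F = 0F

  _⊞_ : Fin 3 → Fin 3 → Fin 3
  0F ⊞ s = s
  1F ⊞ s = next s
  2F ⊞ s = next (next s)

  mod₃ : ℕ → Fin 3
  mod₃ zero    = 0F
  mod₃ (suc n) = next (mod₃ n)

  next-⊞ : ∀ r s → next r ⊞ s ≡ next (r ⊞ s)
  next-⊞ 0F s  = ≡.refl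
  next-⊞ 1F s  = ≡.refl
  next-⊞ 2F 0F = ≡.refl
  next-⊞ 2F 1F = ≡.refl
  next-⊞ 2F 2F = ≡.refl

  mod₃-+ : ∀ m n → mod₃ (m ℕ.+ n) ≡ mod₃ m ⊞ mod₃ n
  mod₃-+ zero    n = ≡.refl
  mod₃-+ (suc m) n = ≡.trans (≡.cong next (mod₃-+ m n)) (≡.sym (next-⊞ (mod₃ m) (mod₃ n)))

  mod₃-3* : ∀ n → mod₃ (3 ℕ.* n) ≡ 0F
  mod₃-3* n = ≡.trans (mod₃-+ n (n ℕ.+ (n ℕ.+ 0))) (≡.trans (≡.cong (mod₃ n ⊞_)
    (≡.trans (mod₃-+ n (n ℕ.+ 0)) (≡.cong (λ k → mod₃ n ⊞ mod₃ k) (ℕₚ.+-identityʳ n)))) (thrice (mod₃ n)))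
    where
    thrice : ∀ r → r ⊞ (r ⊞ r) ≡ 0F
    thrice 0F = ≡.refl
    thrice 1F = ≡.refl
    thrice 2F = ≡.refl

  mod₃-quotient : ∀ n → ∃ λ m → n ≡ toℕ (mod₃ n) ℕ.+ 3 ℕ.* m
  mod₃-quotient zero    = 0 , ≡.refl
  mod₃-quotient (suc n) with mod₃ n | mod₃-quotient n
  ... | 0F | m , e = m , ≡.cong suc e
  ... | 1F | m , e = m , ≡.cong suc e
  ... | 2F | m , e = suc m , ≡.trans (≡.cong suc e) (≡.sym (ℕₚ.*-suc 3 m))

  diagonal-closed : (J : Carrier → Set) → (∀ {x y} → J x → J y → J (x + y)) →
    ∀ n (f : ℕ → ℕ → Carrier) → (∀ i j → i ℕ.+ j ≡ n → J (f i j)) → J (diagonal f n)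
  diagonal-closed J J-+ zero    f e = e 0 0 ≡.refl
  diagonal-closed J J-+ (suc n) f e = J-+ (e 0 (suc n) ≡.refl)
    (diagonal-closed J J-+ n (λ i → f (suc i)) (λ i j p → e (suc i) j (≡.cong suc p)))

  Supported : Fin 3 → Series → Set
  Supported r X = ∀ n → mod₃ n ≢ r → X n ≈ 0#

  supported-≋ : ∀ {r X Y} → X ≋ Y → Supported r X → Supported r Y
  supported-≋ e s n ne = trans (sym (e n)) (s n ne)

  supported-+ : ∀ {r X Y} → Supported r X → Supported r Y → Supported r (X ⊕ Y)
  supported-+ s t n ne = trans (+-cong (s n ne) (t n ne)) (+-identityˡ 0#)

  supported-* : ∀ {r s X Y} → Supported r X → Supported s Y → Supported (r ⊞ s) (conv X Y)
  supported-* {r} {s} {X} {Y} sX sY n ne = diagonal-closed (_≈ 0#) (λ e f → trans (+-cong e f) (+-identityˡ 0#)) n _ zeros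
    where
    zeros : ∀ i j → i ℕ.+ j ≡ n → X i * Y j ≈ 0#
    zeros i j e with mod₃ i Finₚ.≟ r | mod₃ j Finₚ.≟ s
    ... | no ni | _      = trans (*-congʳ (sX i ni)) (zeroˡ _)
    ... | yes _ | no nj  = trans (*-congˡ (sY j nj)) (zeroʳ _)
    ... | yes p | yes q  = contradiction (≡.trans (≡.cong mod₃ (≡.sym e)) (≡.trans (mod₃-+ i j) (≡.cong₂ _⊞_ p q))) ne

  supported-cubed : ∀ {X} → Supported 0F X → Supported 0F (cubed X)
  supported-cubed s = supported-* {0F} {0F} s (supported-* {0F} {0F} s s)

  supported-mono : ∀ a → Supported (mod₃ a) (mono a)
  supported-mono a n ne = mono-off {a} {n} (λ e → ne (≡.cong mod₃ (≡.sym e)))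

  supported-♯ : ∀ n → Supported 0F (♯ n)
  supported-♯ zero          k ne = refl
  supported-♯ (suc zero)    k ne = supported-mono 0 k ne
  supported-♯ (suc (suc n)) = supported-+ {0F} (supported-♯ (suc n)) (supported-mono 0)

  supported-gf : ∀ {I : Set} {w : I → ℕ} (g : Graded w) χ → Supported 0F (gf (gradedMultiple 2 g) χ)
  supported-gf {w = w} g χ n ne = ∑-zero (Graded.cover (gradedMultiple 2 g) n)
    (λ i → term-off (χ i) {3 ℕ.* w i} {n} (λ e → ne (≡.trans (≡.cong mod₃ (≡.sym e)) (mod₃-3* (w i)))))

  gf-triple : ∀ {I : Set} {w w′ : I → ℕ} (g : Graded w) (h : Graded w′) → (∀ i → w′ i ≡ 3 ℕ.* w i) →
    ∀ χ n → gf h χ (3 ℕ.* n) ≈ gf g χ n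
  gf-triple {w = w} {w′} g h weights χ n = trans
    (gf-by h χ (Graded.unique g n) (λ i e → Graded.covers g (ℕₚ.≤-reflexive
      (ℕₚ.*-cancelˡ-≡ (w i) n 3 (≡.trans (≡.sym (weights i)) e)))))
    (∑-cong (Graded.cover g n) (λ i → *-congˡ (compare i)))
    where
    compare : ∀ i → mono (w′ i) (3 ℕ.* n) ≈ mono (w i) n
    compare i with w i ℕ.≟ n
    ... | yes ≡.refl = trans (≡⇒≈ (≡.cong (λ k → mono k (3 ℕ.* n)) (weights i)))
      (trans (mono-diag (3 ℕ.* n)) (sym (mono-diag n)))
    ... | no ne = trans (mono-off (λ e → ne (ℕₚ.*-cancelˡ-≡ (w i) n 3 (≡.trans (≡.sym (weights i)) e)))) (sym (mono-off ne))

  -- Cancelling a series is needed exactly, for a³ = b³ + c³, and modulo powers of 3; both are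
  -- instances of one argument modulo an ideal.
  record Ideal (J : Carrier → Set) : Set where
    field
      resp : ∀ {x y} → x ≈ y → J x → J y
      zero# : J 0#
      add  : ∀ {x y} → J x → J y → J (x + y)
      mul  : ∀ x {y} → J y → J (x * y)

  open Ideal

  zeroIdeal : Ideal (_≈ 0#)
  zeroIdeal = record
    { resp = λ e z → trans (sym e) z ; zero# = refl
    ; add = λ e f → trans (+-cong e f) (+-identityˡ 0#) ; mul = λ x e → trans (*-congˡ e) (zeroʳ x) }

  _⟨3^_⟩ : Carrier → ℕ → Set
  x ⟨3^ k ⟩ = ∃ λ y → x ≈ triple^ k y

  powerIdeal : ∀ k → Ideal (_⟨3^ k ⟩)
  powerIdeal k = record
    { resp = λ e (y , f) → y , trans (sym e) f
    ; zero# = 0# , sym (triple^-zero k refl)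
    ; add = λ (x , e) (y , f) → x + y , trans (+-cong e f) (sym (triple^-+ k x y))
    ; mul = λ x (y , e) → y * x , trans (*-comm x _) (trans (*-congʳ e) (triple^-*ˡ k y x)) }

  -- Since W has constant term 1, it can be cancelled from W X modulo J, on any set M of exponents that W respects.
  cancel : ∀ {J} → Ideal J → (M : ℕ → Set) → ∀ W X → W 0 ≈ 1# → (∀ i j → M (i ℕ.+ j) → M j ⊎ W i ≈ 0#) →
    (∀ n → M n → J (conv W X n)) → ∀ n → M n → J (X n)
  cancel {J} ideal M W X W₀ respects given n = upTo n n ℕₚ.≤-refl
    where
    upTo : ∀ N n → n ℕ.≤ N → M n → J (X n)
    upTo N       zero    n≤N mn = resp ideal (trans (*-congʳ W₀) (*-identityˡ _)) (given 0 mn)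
    upTo (suc N) (suc n) n≤N mn = resp ideal isolate (add ideal (given (suc n) mn) (mul ideal (- 1#) rest))
      where
      rest : J (conv (tail W) X n)
      rest = diagonal-closed J (add ideal) n _ summand
        where
        summand : ∀ i j → i ℕ.+ j ≡ n → J (tail W i * X j)
        summand i j e with respects (suc i) j (≡.subst M (≡.cong suc (≡.sym e)) mn)
        ... | inj₁ mj = mul ideal (tail W i) (upTo N j
          (ℕₚ.≤-trans (ℕₚ.≤-trans (ℕₚ.m≤n+m j i) (ℕₚ.≤-reflexive e)) (ℕ.s≤s⁻¹ n≤N)) mj)
        ... | inj₂ z  = resp ideal (sym (trans (*-congʳ z) (zeroˡ _))) (zero# ideal)
      isolate : conv W X (suc n) + - 1# * conv (tail W) X n ≈ X (suc n)
      isolate = trans (+-cong (+-congʳ (trans (*-congʳ W₀) (*-identityˡ _))) (-1*x≈-x _))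
        (trans (+-assoc _ _ _) (trans (+-congˡ (-‿inverseʳ _)) (+-identityʳ _)))

  -- With G = `partitions 0`, H is G³ and U is G(q³). Z is A³ - C³, kept as a product so that its
  -- factor b can be combined with H.
  H U Θ Φ Q Z : Series
  H = cube (partitions 0)
  U = partitions 2
  Θ = gf gradedℤ⁹ balanced
  Φ = conv Θ (cube H)
  Q = conv A A ⊕ (conv A C ⊕ conv C C)
  Z = conv b Q

  C₁ : Series
  C₁ = conv (mono 1) (gf (gradedMultiple 2 (gradedClass 1 1F)) one)

  -- X₃ and Y₃ are X and Y at q³: exponents divisible by three inherit the relation, and at the
  -- others both sides vanish. It carries c₀ = 3 W over to C.
  triple-dilated : ∀ {X Y X₃ Y₃} → Supported 0F X₃ → Supported 0F Y₃ →
    (∀ m → X₃ (3 ℕ.* m) ≈ X m) → (∀ m → Y₃ (3 ℕ.* m) ≈ Y m) → X ≋ tripleₛ Y → X₃ ≋ tripleₛ Y₃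
  triple-dilated {X} {Y} {X₃} {Y₃} sX sY eX eY e n with mod₃ n Finₚ.≟ 0F
  ... | no ne = trans (sX n ne) (sym (triple^-zero 1 (sY n ne)))
  ... | yes r with mod₃-quotient n
  ...   | m , p = trans (at X₃) (trans (eX m) (trans (e m) (sym (triple-cong (trans (at Y₃) (eY m))))))
    where
    at : ∀ V → V n ≈ V (3 ℕ.* m)
    at V = ≡⇒≈ (≡.cong V (≡.trans p (≡.cong (λ r → toℕ r ℕ.+ 3 ℕ.* m) r)))

  coset-triple : coset-series³ 1 ≋ tripleₛ (gf (gradedMultiple 2 (gradedClass 1 1F)) one)
  coset-triple = triple-dilated {c₀} {W} (supported-gf (gradedCoset 1) one) (supported-gf (gradedClass 1 1F) one)
    (gf-triple (gradedCoset 1) (gradedMultiple 2 (gradedCoset 1)) (λ _ → ≡.refl) one)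
    (gf-triple (gradedClass 1 1F) (gradedMultiple 2 (gradedClass 1 1F)) (λ _ → ≡.refl) one) c₀-split

  C-triple : C ≋ tripleₛ C₁
  C-triple = S.trans (conv-cong (S.refl {mono 1}) coset-triple)
    (solve 2 (λ q x → q :* (x :+ (x :+ x)) := q :* x :+ (q :* x :+ q :* x)) S.refl (mono 1)
      (gf (gradedMultiple 2 (gradedClass 1 1F)) one))

  A-constant : A 0 ≈ 1#
  -- The cover at 0 consists of the four pairs with entries 0 and -1, and only (0 , 0) has weight 0.
  A-constant = trans (+-cong (*-identityʳ 1#) (+-cong (zeroʳ 1#) (+-cong (zeroʳ 1#) (+-cong (zeroʳ 1#) refl))))
    (trans (+-congˡ (trans (+-identityˡ _) (trans (+-identityˡ _) (+-identityˡ _)))) (+-identityʳ 1#))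

  C-constant : C 0 ≈ 0#
  C-constant = zeroˡ _

  b-constant : b 0 ≈ 1#
  b-constant = trans (sym (trans (+-congˡ C-constant) (+-identityʳ (b 0)))) (trans (b-split 0) A-constant)

  Z-constant : Z 0 ≈ 1#
  Z-constant = trans (*-cong b-constant (trans
      (+-cong (*-cong A-constant A-constant) (+-cong (*-congˡ C-constant) (*-congˡ C-constant)))
      (trans (+-cong (*-identityˡ 1#) (trans (+-cong (zeroʳ _) (zeroʳ _)) (+-identityˡ 0#))) (+-identityʳ 1#))))
    (*-identityˡ 1#)

  Z³-constant : cubed Z 0 ≈ 1#
  Z³-constant = trans (*-cong Z-constant (*-cong Z-constant Z-constant)) (trans (*-identityˡ _) (*-identityˡ 1#))

  κ : Series
  κ = conv (mono 1) (cubed c₀)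

  -- Borwein and Borwein's a³ = b³ + c³.
  cubic-identity : (cubed b ⊕ κ) ≋ cubed a
  cubic-identity n = trans
    (sym (trans (+-assoc _ _ _) (trans (+-congˡ (-‿inverseˡ _)) (+-identityʳ _))))
    (trans (+-congʳ (vanish n tt)) (+-identityˡ _))
    where
    difference : Series
    difference k = (cubed b ⊕ κ) k + - cubed a k
    scaled : conv A (cubed b ⊕ κ) ≋ conv A (cubed a)
    scaled = ID.cubic-scaled a-split b-split c₀-split theta-twisted
    product : ∀ k → conv A difference k ≈ 0#
    product k = trans (conv-distribˡ A (cubed b ⊕ κ) (λ k → - cubed a k) k)
      (trans (+-congˡ (sym (SRing.-‿distribʳ-* A (cubed a) k))) (trans (+-congʳ (scaled k)) (-‿inverseʳ _)))
    vanish : ∀ k → ⊤ → difference k ≈ 0#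
    -- The factor A of the scaled identity cancels because its constant term is 1.
    vanish = cancel zeroIdeal (λ _ → ⊤) A difference A-constant (λ _ _ _ → inj₁ tt) (λ k _ → product k)

  module Tri = ID.Trisection A C

  α γ : Series
  α = cubed A
  γ = cubed C

  Z+γ : (Z ⊕ γ) ≋ α
  Z+γ = ID.difference-of-cubes {q = mono 1} a-split b-split c₀-split

  κ-value : κ ≋ conv (♯ 9) (conv C Q)
  κ-value = ID.κ-value {q = mono 1} a-split b-split c₀-split cubic-identity

  Θ-value : Θ ≋ (conv A (cubed a) ⊕ (conv κ (a ⊕ C) ⊕ conv κ (a ⊕ C)))
  Θ-value = S.trans theta (ID.theta-κ a-split b-split c₀-split)

  bH≋U : conv b H ≋ U
  bH≋U = S.trans (conv-cong (S.sym gf-twisted) S.refl) twisted-partitions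

  N₀ N₁ N₂ : Series
  N₀ = Tri.N₀
  N₁ = Tri.N₁ C-triple
  N₂ = Tri.N₂ C-triple

  Φ-trisected : conv (cubed Z) Φ ≋ (conv N₀ (cubed U) ⊕ (tripleₛ^ 4 (conv N₁ (cubed U)) ⊕ tripleₛ^ 6 (conv N₂ (cubed U))))
  Φ-trisected = S.trans (ID.clear-denominators bH≋U Θ) (S.trans
    (S.*-congʳ {cubed U} (Tri.trisect C-triple a-split κ-value Θ-value))
    (ID.distribute₃ 4 6 N₀ N₁ N₂ (cubed U)))

  supported-A : Supported 0F A
  supported-A = supported-gf (gradedCoset 0) one

  supported-U : Supported 0F U
  supported-U = supported-gf gradedMaya neutral

  supported-C₁ : Supported 1F C₁
  supported-C₁ = supported-* {1F} {0F} (supported-mono 1) (supported-gf (gradedClass 1 1F) one)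

  supported-triple : ∀ {r X} → Supported r X → Supported r (tripleₛ X)
  supported-triple {r} s = supported-+ {r} s (supported-+ {r} s s)

  supported-C : Supported 1F C
  supported-C = supported-≋ {1F} (S.sym C-triple) (supported-triple {1F} supported-C₁)

  _⟨+⟩_ : ∀ {X Y} → Supported 0F X → Supported 0F Y → Supported 0F (X ⊕ Y)
  _⟨+⟩_ = supported-+ {0F}

  _⟨*⟩_ : ∀ {X Y} → Supported 0F X → Supported 0F Y → Supported 0F (conv X Y)
  _⟨*⟩_ = supported-* {0F} {0F}

  supported-α : Supported 0F α
  supported-α = supported-cubed supported-A

  supported-γ : Supported 0F γ
  supported-γ = supported-* {1F} {2F} supported-C (supported-* {1F} {1F} supported-C supported-C)

  -- The factors b and Q mix the residues of exponents, but their product is α - γ, which does not.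
  supported-Z : Supported 0F Z
  supported-Z n ne = trans (sym (trans (+-congˡ (supported-γ n ne)) (+-identityʳ (Z n)))) (trans (Z+γ n) (supported-α n ne))

  supported-N₀ : Supported 0F N₀
  supported-N₀ = supported-A ⟨*⟩ ((s₀ ⟨*⟩ r₀) ⟨+⟩
    ((supported-γ ⟨*⟩ (s₁ ⟨*⟩ r₂)) ⟨+⟩ ((supported-α ⟨*⟩ supported-γ) ⟨*⟩ (supported-♯ 84 ⟨*⟩ r₁))))
    where
    s₀ : Supported 0F Tri.s₀
    s₀ = supported-α ⟨+⟩ (supported-♯ 80 ⟨*⟩ supported-γ)
    s₁ : Supported 0F Tri.s₁
    s₁ = (supported-♯ 24 ⟨*⟩ supported-α) ⟨+⟩ (supported-♯ 54 ⟨*⟩ supported-γ)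
    r₀ : Supported 0F Tri.r₀
    r₀ = (supported-α ⟨*⟩ supported-α) ⟨+⟩ ((supported-♯ 7 ⟨*⟩ (supported-α ⟨*⟩ supported-γ)) ⟨+⟩
      (supported-γ ⟨*⟩ supported-γ))
    r₁ : Supported 0F Tri.r₁
    r₁ = supported-♯ 3 ⟨*⟩ (supported-α ⟨+⟩ (supported-♯ 2 ⟨*⟩ supported-γ))
    r₂ : Supported 0F Tri.r₂
    r₂ = supported-♯ 3 ⟨*⟩ ((supported-♯ 2 ⟨*⟩ supported-α) ⟨+⟩ supported-γ)

  supported-N₁ : Supported 1F N₁
  supported-N₁ = supported-* {1F} {0F} supported-C₁
    ((supported-α ⟨*⟩ (supported-α ⟨*⟩ supported-α)) ⟨+⟩
      ((supported-♯ 36 ⟨*⟩ (supported-α ⟨*⟩ (supported-α ⟨*⟩ supported-γ)))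
      ⟨+⟩ ((supported-♯ 42 ⟨*⟩ (supported-α ⟨*⟩ (supported-γ ⟨*⟩ supported-γ))) ⟨+⟩
        (supported-♯ 2 ⟨*⟩ (supported-γ ⟨*⟩ (supported-γ ⟨*⟩ supported-γ))))))

  supported-N₂ : Supported 2F N₂
  supported-N₂ = supported-* {2F} {0F}
    (supported-* {0F} {2F} (supported-A ⟨*⟩ supported-A) (supported-* {1F} {1F} supported-C₁ supported-C₁))
    ((supported-♯ 2 ⟨*⟩ (supported-α ⟨*⟩ supported-α)) ⟨+⟩
      ((supported-♯ 17 ⟨*⟩ (supported-α ⟨*⟩ supported-γ)) ⟨+⟩ (supported-♯ 8 ⟨*⟩ (supported-γ ⟨*⟩ supported-γ))))

  coefficient-triple^ : ∀ k X n → tripleₛ^ k X n ≈ triple^ k (X n)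
  coefficient-triple^ zero    X n = refl
  coefficient-triple^ (suc k) X n = triple-cong (coefficient-triple^ k X n)

  respects : ∀ r {W} → Supported 0F W → ∀ i j → mod₃ (i ℕ.+ j) ≡ r → mod₃ j ≡ r ⊎ W i ≈ 0#
  respects r s i j e with mod₃ i Finₚ.≟ 0F
  ... | yes z = inj₁ (≡.trans (≡.sym (≡.trans (mod₃-+ i j) (≡.cong (_⊞ mod₃ j) z))) e)
  ... | no ne = inj₂ (s i ne)

  module _ {X Y V : Series} (k l : ℕ) where

    private
      sum : Series
      sum = X ⊕ (tripleₛ^ k Y ⊕ tripleₛ^ l V)

    residue-1 : Supported 0F X → Supported 2F V → ∀ n → mod₃ n ≡ 1F → sum n ⟨3^ k ⟩
    residue-1 sX sV n e = Y n , trans (+-cong (sX n (differ e (λ ())))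
        (+-cong (coefficient-triple^ k Y n) (trans (coefficient-triple^ l V n) (triple^-zero l (sV n (differ e (λ ())))))))
      (trans (+-identityˡ _) (+-identityʳ _))
      where
      differ : ∀ {r s t : Fin 3} → r ≡ s → s ≢ t → r ≢ t
      differ ≡.refl ne = ne

    residue-2 : Supported 0F X → Supported 1F Y → ∀ n → mod₃ n ≡ 2F → sum n ⟨3^ l ⟩
    residue-2 sX sY n e = V n , trans (+-cong (sX n (differ e (λ ())))
        (+-cong (trans (coefficient-triple^ k Y n) (triple^-zero k (sY n (differ e (λ ()))))) (coefficient-triple^ l V n)))
      (trans (+-identityˡ _) (+-identityˡ _))
      where
      differ : ∀ {r s t : Fin 3} → r ≡ s → s ≢ t → r ≢ t
      differ ≡.refl ne = ne

  -- At these exponents the parts with N₀ and N₂ vanish. Z³ has only exponents divisible by three,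
  -- so cancelling it stays within the residue class.
  Φ-1 : ∀ n → mod₃ n ≡ 1F → Φ n ⟨3^ 4 ⟩
  Φ-1 = cancel (powerIdeal 4) (λ n → mod₃ n ≡ 1F) (cubed Z) Φ Z³-constant (respects 1F (supported-cubed supported-Z))
    (λ n e → resp (powerIdeal 4) (sym (Φ-trisected n))
      (residue-1 {conv N₀ (cubed U)} {conv N₁ (cubed U)} {conv N₂ (cubed U)} 4 6
      (supported-N₀ ⟨*⟩ supported-cubed supported-U)
      (supported-* {2F} {0F} supported-N₂ (supported-cubed supported-U)) n e))

  Φ-2 : ∀ n → mod₃ n ≡ 2F → Φ n ⟨3^ 6 ⟩
  Φ-2 = cancel (powerIdeal 6) (λ n → mod₃ n ≡ 2F) (cubed Z) Φ Z³-constant (respects 2F (supported-cubed supported-Z))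
    (λ n e → resp (powerIdeal 6) (sym (Φ-trisected n))
      (residue-2 {conv N₀ (cubed U)} {conv N₁ (cubed U)} {conv N₂ (cubed U)} 4 6
      (supported-N₀ ⟨*⟩ supported-cubed supported-U)
      (supported-* {1F} {0F} supported-N₁ (supported-cubed supported-U)) n e))

  AU³ : Series
  AU³ = conv A (cubed U)

  -- Modulo 9 the trisection reads Z³ Φ ≡ Z³ A U³, and Z³ cancels at all exponents at once because
  -- its constant term is 1.
  Φ-difference : ∀ n → (Φ n + - AU³ n) ⟨3^ 2 ⟩
  Φ-difference n = cancel (powerIdeal 2) (λ _ → ⊤) (cubed Z) (λ k → Φ k + - AU³ k) Z³-constant (λ _ _ _ → inj₁ tt)
    (λ k _ → conv E (cubed U) k , trans (ID.difference-multiple 2 scaled k)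
      (coefficient-triple^ 2 (conv E (cubed U)) k)) n tt
    where
    E : Series
    E = Tri.trisect-mod-9 C-triple Z+γ
    scaled : conv (cubed Z) Φ ≋ (conv (conv A (cubed Z)) (cubed U) ⊕ tripleₛ^ 2 (conv E (cubed U)))
    scaled = S.trans (ID.clear-denominators bH≋U Θ) (S.trans
      (S.*-congʳ {cubed U} (S.trans (Tri.trisect C-triple a-split κ-value Θ-value)
        (Tri.trisect-mod-9-correct C-triple Z+γ)))
      (ID.distribute₂ 2 (conv A (cubed Z)) E (cubed U)))

  aH : Series
  aH = conv a H

  -- Since b H = U, multiplying a H by Z = b Q gives a Q U, which modulo 9 is (A³ + 2 C³) U and has
  -- only exponents divisible by three.
  aH-residue : ∀ n → mod₃ n ≢ 0F → aH n ⟨3^ 2 ⟩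
  aH-residue n ne = cancel (powerIdeal 2) (λ k → mod₃ k ≡ mod₃ n) Z aH Z-constant (respects (mod₃ n) supported-Z)
    (λ k e → conv E U k , trans (scaled k) (trans (+-cong (leading k (λ z → ne (≡.trans (≡.sym e) z)))
      (coefficient-triple^ 2 (conv E U) k)) (+-identityˡ _))) n ≡.refl
    where
    E : Series
    E = conv (conv A C₁) (A ⊕ C)
    leading : Supported 0F (conv (α ⊕ (γ ⊕ γ)) U)
    leading = (supported-α ⟨+⟩ (supported-γ ⟨+⟩ supported-γ)) ⟨*⟩ supported-U
    scaled : conv Z aH ≋ (conv (α ⊕ (γ ⊕ γ)) U ⊕ tripleₛ^ 2 (conv E U))
    scaled = S.trans (ID.clear-denominator bH≋U a) (S.trans
      (S.*-congʳ {U} (Tri.quadratic-mod-9 C-triple a-split)) (ID.distribute₂ 2 (α ⊕ (γ ⊕ γ)) E U))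

  AU³-triple : ∀ n → AU³ (3 ℕ.* n) ≈ aH n
  AU³-triple n = trans
    (sym (S.trans (gf-⊗ (gradedMultiple 2 (gradedCoset 0)) maya³ one neutral³)
      (conv-cong S.refl (gf-cube (gradedMultiple 2 gradedMaya) neutral neutral neutral)) (3 ℕ.* n)))
    (trans (gf-triple (gradedCoset 0 ⊗ maya¹) (gradedMultiple 2 (gradedCoset 0) ⊗ maya³) weights
      (λ (p , m) → one p * neutral³ m) n)
      (S.trans (gf-⊗ (gradedCoset 0) maya¹ one neutral³)
        (conv-cong S.refl (gf-cube (gradedMultiple 0 gradedMaya) neutral neutral neutral)) n))
    where
    maya¹ = cubeGraded (gradedMultiple 0 gradedMaya)
    maya³ = cubeGraded (gradedMultiple 2 gradedMaya)
    neutral³ : Cube Maya → Carrier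
    neutral³ (x , y , z) = neutral x * (neutral y * neutral z)
    weights : ∀ p → 3 ℕ.* coset 0 (proj₁ p) ℕ.+ cubeSum (λ m → 3 ℕ.* energy m) (proj₂ p) ≡
      3 ℕ.* (coset 0 (proj₁ p) ℕ.+ cubeSum (λ m → 1 ℕ.* energy m) (proj₂ p))
    weights (p , (x , y , z)) = solveℕ 4 (λ p x y z → k 3 ⊛ p ⊹ (k 3 ⊛ x ⊹ (k 3 ⊛ y ⊹ k 3 ⊛ z)) ≔
      k 3 ⊛ (p ⊹ (k 1 ⊛ x ⊹ (k 1 ⊛ y ⊹ k 1 ⊛ z)))) ≡.refl (coset 0 p) (energy x) (energy y) (energy z)
      where open ℕ-Solver.+-*-Solver using () renaming (solve to solveℕ; _:+_ to _⊹_; _:*_ to _⊛_; _:=_ to _≔_; con to k)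

  Φ-triple : ∀ n → mod₃ n ≢ 0F → Φ (3 ℕ.* n) ⟨3^ 2 ⟩
  Φ-triple n ne = resp (powerIdeal 2) (trans (+-assoc _ _ _) (trans (+-congˡ (-‿inverseˡ _)) (+-identityʳ _)))
    (add (powerIdeal 2) (Φ-difference (3 ℕ.* n)) (resp (powerIdeal 2) (sym (AU³-triple n)) (aH-residue n ne)))

  symbolCount : ℕ → Carrier
  symbolCount n = length (symbols n) ×ᴿ 1#

  symbolCount-1 : ∀ n → mod₃ n ≡ 1F → symbolCount n ⟨3^ 4 ⟩
  symbolCount-1 n e = resp (powerIdeal 4) (sym (symbols-series n)) (Φ-1 n e)

  symbolCount-2 : ∀ n → mod₃ n ≡ 2F → symbolCount n ⟨3^ 6 ⟩
  symbolCount-2 n e = resp (powerIdeal 6) (sym (symbols-series n)) (Φ-2 n e)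

  symbolCount-triple : ∀ n → mod₃ n ≢ 0F → symbolCount (3 ℕ.* n) ⟨3^ 2 ⟩
  symbolCount-triple n ne = resp (powerIdeal 2) (sym (symbols-series (3 ℕ.* n))) (Φ-triple n ne)

-- Specialisation to the Eisenstein integers and the theorem

open import Defs
open Enumeration
open import Data.Nat as ℕ using (ℕ; zero; suc; _+_; _*_)
import Data.Nat.Properties as ℕₚ
import Data.Nat.Solver as ℕ-Solver
open import Data.Nat.Divisibility using (_∣_; divides)
open import Data.Integer as ℤ using (ℤ; +_; 0ℤ; 1ℤ)
import Data.Integer.Properties as ℤₚ
import Data.Integer.Solver as ℤ-Solver
open import Data.Fin using (Fin)
open import Data.Fin.Patterns using (0F)
open import Data.List using (length)
open import Data.Product using (Σ; _×_; _,_; proj₁; proj₂)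
open import Relation.Binary.PropositionalEquality as ≡ using (_≡_; _≢_; refl; cong; cong₂)

-- ℤ[ω], with (a , b) standing for a + b ω.
module Eisenstein where

  open ℤ-Solver.+-*-Solver

  Eisenstein : Set
  Eisenstein = ℤ × ℤ

  eisensteinRing : CommutativeRing 0ℓ 0ℓ
  eisensteinRing = record
    { Carrier = Eisenstein
    ; _≈_ = _≡_
    ; _+_ = λ (a , b) (c , d) → a ℤ.+ c , b ℤ.+ d
    ; _*_ = λ (a , b) (c , d) → a ℤ.* c ℤ.- b ℤ.* d , a ℤ.* d ℤ.+ b ℤ.* c ℤ.- b ℤ.* d
    ; -_  = λ (a , b) → ℤ.- a , ℤ.- b
    ; 0#  = 0ℤ , 0ℤ
    ; 1#  = 1ℤ , 0ℤ
    ; isCommutativeRing = record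
      { isRing = record
        { +-isAbelianGroup = record
          { isGroup = record
            { isMonoid = record
              { isSemigroup = record
                { isMagma = record { isEquivalence = ≡.isEquivalence ; ∙-cong = λ { refl refl → refl } }
                ; assoc = λ (a , b) (c , d) (e , f) → cong₂ _,_ (ℤₚ.+-assoc a c e) (ℤₚ.+-assoc b d f) }
              ; identity = (λ (a , b) → cong₂ _,_ (ℤₚ.+-identityˡ a) (ℤₚ.+-identityˡ b))
                         , (λ (a , b) → cong₂ _,_ (ℤₚ.+-identityʳ a) (ℤₚ.+-identityʳ b)) }
            ; inverse = (λ (a , b) → cong₂ _,_ (ℤₚ.+-inverseˡ a) (ℤₚ.+-inverseˡ b))
                      , (λ (a , b) → cong₂ _,_ (ℤₚ.+-inverseʳ a) (ℤₚ.+-inverseʳ b))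
            ; ⁻¹-cong = λ { refl → refl } }
          ; comm = λ (a , b) (c , d) → cong₂ _,_ (ℤₚ.+-comm a c) (ℤₚ.+-comm b d) }
        ; *-cong = λ { refl refl → refl }
        ; *-assoc = λ (a , b) (c , d) (e , f) → cong₂ _,_
            (solve 6 (λ a b c d e f →
              (a :* c :- b :* d) :* e :- (a :* d :+ b :* c :- b :* d) :* f :=
              a :* (c :* e :- d :* f) :- b :* (c :* f :+ d :* e :- d :* f)) refl a b c d e f)
            (solve 6 (λ a b c d e f →
              (a :* c :- b :* d) :* f :+ (a :* d :+ b :* c :- b :* d) :* e :- (a :* d :+ b :* c :- b :* d) :* f :=
              a :* (c :* f :+ d :* e :- d :* f) :+ b :* (c :* e :- d :* f) :- b :* (c :* f :+ d :* e :- d :* f)) refl a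
                b c d e f)
        ; *-identity =
            (λ (a , b) → cong₂ _,_
              (solve 2 (λ a b → con 1ℤ :* a :- con 0ℤ :* b := a) refl a b)
              (solve 2 (λ a b → con 1ℤ :* b :+ con 0ℤ :* a :- con 0ℤ :* b := b) refl a b))
          , (λ (a , b) → cong₂ _,_
              (solve 2 (λ a b → a :* con 1ℤ :- b :* con 0ℤ := a) refl a b)
              (solve 2 (λ a b → a :* con 0ℤ :+ b :* con 1ℤ :- b :* con 0ℤ := b) refl a b))
        ; distrib =
            (λ (a , b) (c , d) (e , f) → cong₂ _,_
              (solve 6 (λ a b c d e f → a :* (c :+ e) :- b :* (d :+ f) := (a :* c :- b :* d) :+ (a :* e :- b :* f)) refl
                a b c d e f)
              (solve 6 (λ a b c d e f → a :* (d :+ f) :+ b :* (c :+ e) :- b :* (d :+ f) :=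
                (a :* d :+ b :* c :- b :* d) :+ (a :* f :+ b :* e :- b :* f)) refl a b c d e f))
          , (λ (a , b) (c , d) (e , f) → cong₂ _,_
              (solve 6 (λ a b c d e f → (c :+ e) :* a :- (d :+ f) :* b := (c :* a :- d :* b) :+ (e :* a :- f :* b)) refl
                a b c d e f)
              (solve 6 (λ a b c d e f → (c :+ e) :* b :+ (d :+ f) :* a :- (d :+ f) :* b :=
                (c :* b :+ d :* a :- d :* b) :+ (e :* b :+ f :* a :- f :* b)) refl a b c d e f)) }
      ; *-comm = λ (a , b) (c , d) → cong₂ _,_
          (solve 4 (λ a b c d → a :* c :- b :* d := c :* a :- d :* b) refl a b c d)
          (solve 4 (λ a b c d → a :* d :+ b :* c :- b :* d := c :* b :+ d :* a :- d :* b) refl a b c d) } }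

  triple-zero : ∀ a → a ℤ.+ (a ℤ.+ a) ≡ 0ℤ → a ≡ 0ℤ
  triple-zero a e = ℤₚ.*-cancelˡ-≡ (+ 3) a 0ℤ
    (≡.trans (solve 1 (λ a → con (+ 3) :* a := a :+ (a :+ a)) refl a) e)

  cubeRoot : CubeRoot eisensteinRing
  cubeRoot = record
    { ω = 0ℤ , 1ℤ
    ; ω-root = refl
    ; torsion-free = λ (a , b) e → cong₂ _,_ (triple-zero a (cong proj₁ e)) (triple-zero b (cong proj₂ e))
    }

open Eisenstein using (eisensteinRing; cubeRoot)
open Congruences eisensteinRing cubeRoot using
  (symbolCount; symbolCount-1; symbolCount-2; symbolCount-triple; _⟨3^_⟩; mod₃; mod₃-3*; mod₃-+; _×ᴿ_; 1#; _⊞_)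
open Identities eisensteinRing using (triple^)

natural : ∀ n → proj₁ (n ×ᴿ 1#) ≡ + n
natural zero    = refl
natural (suc n) = cong (λ k → 1ℤ ℤ.+ k) (natural n)

triple^-proj₁ : ∀ k x → proj₁ (triple^ k x) ≡ + (3 ℕ.^ k) ℤ.* proj₁ x
triple^-proj₁ zero    x = ≡.sym (ℤₚ.*-identityˡ (proj₁ x))
triple^-proj₁ (suc k) x = ≡.trans (cong (λ y → y ℤ.+ (y ℤ.+ y)) (triple^-proj₁ k x))
  (≡.trans (solve 2 (λ p y → p :* y :+ (p :* y :+ p :* y) := (con (+ 3) :* p) :* y) refl (+ (3 ℕ.^ k)) (proj₁ x))
    (cong (ℤ._* proj₁ x) (≡.sym (ℤₚ.pos-* 3 (3 ℕ.^ k)))))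
  where open ℤ-Solver.+-*-Solver

-- The coordinate at 1 of ℤ[ω] is additive and sends the count to itself, so a multiple of 3ᵏ in
-- ℤ[ω] yields one in ℤ.
count-divisible : ∀ k n → symbolCount n ⟨3^ k ⟩ → Σ ℕ λ m → cφ≡ 9 n m × 3 ℕ.^ k ∣ m
count-divisible k n (y , e) = length (symbols n) , symbols-count n , divides ℤ.∣ proj₁ y ∣ (begin
  length (symbols n)                               ≡⟨ cong ℤ.∣_∣ (≡.sym (natural (length (symbols n)))) ⟩
  ℤ.∣ proj₁ (length (symbols n) ×ᴿ 1#) ∣           ≡⟨ cong (λ x → ℤ.∣ proj₁ x ∣) e ⟩
  ℤ.∣ proj₁ (triple^ k y) ∣                        ≡⟨ cong ℤ.∣_∣ (triple^-proj₁ k y) ⟩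
  ℤ.∣ + (3 ℕ.^ k) ℤ.* proj₁ y ∣                    ≡⟨ ℤₚ.abs-* (+ (3 ℕ.^ k)) (proj₁ y) ⟩
  3 ℕ.^ k ℕ.* ℤ.∣ proj₁ y ∣                        ≡⟨ ℕₚ.*-comm (3 ℕ.^ k) ℤ.∣ proj₁ y ∣ ⟩
  ℤ.∣ proj₁ y ∣ ℕ.* 3 ℕ.^ k                        ∎)
  where open ≡.≡-Reasoning

mod₃-3*+ : ∀ n r → mod₃ (3 ℕ.* n ℕ.+ r) ≡ mod₃ r
mod₃-3*+ n r = ≡.trans (mod₃-+ (3 ℕ.* n) r) (cong (_⊞ mod₃ r) (mod₃-3* n))

nonzero-residue : ∀ {r s : Fin 3} → r ≡ s → s ≢ 0F → r ≢ 0F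
nonzero-residue refl ne = ne

theorem5p2 : (n : ℕ) →
    (Σ ℕ λ m → cφ≡ 9 (9 * n + 3) m × 9 ∣ m) ×
    (Σ ℕ λ m → cφ≡ 9 (9 * n + 6) m × 9 ∣ m) ×
    (Σ ℕ λ m → cφ≡ 9 (3 * n + 1) m × 81 ∣ m) ×
    (Σ ℕ λ m → cφ≡ 9 (3 * n + 2) m × 729 ∣ m)
theorem5p2 n =
  multiple 1 (9 * n + 3) (solve 1 (λ n → con 3 :* (con 3 :* n :+ con 1) := con 9 :* n :+ con 3) refl n) (λ ()) ,
  multiple 2 (9 * n + 6) (solve 1 (λ n → con 3 :* (con 3 :* n :+ con 2) := con 9 :* n :+ con 6) refl n) (λ ()) ,
  count-divisible 4 (3 * n + 1) (symbolCount-1 (3 * n + 1) (mod₃-3*+ n 1)) ,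
  count-divisible 6 (3 * n + 2) (symbolCount-2 (3 * n + 2) (mod₃-3*+ n 2))
  where
  open ℕ-Solver.+-*-Solver
  multiple : ∀ r k → 3 * (3 * n + r) ≡ k → mod₃ r ≢ 0F → Σ ℕ λ m → cφ≡ 9 k m × 9 ∣ m
  multiple r k refl ne = count-divisible 2 (3 * (3 * n + r))
    (symbolCount-triple (3 * n + r) (nonzero-residue (mod₃-3*+ n r) ne))
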